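{- Let $W$ be the affine Weyl group of type $\tilde B_2$ and let $u<w$ in $W$ with $a(u)\in\{1,2\}$ and $a(w)=4$. Then $\mu(u,w)=1$ if $l(w)-l(u)=1$, and $\mu(u,w)=0$ otherwise.
   Context: $W$ is the Coxeter group with simple reflections $r,s,t$ and relations $r^2=s^2=t^2=e$, $rt=tr$, $(rs)^4=(st)^4=e$; $l$ is the length and $<$ the Bruhat order. $a$ is Lusztig's $a$-function on $W$; its values on $W$ are $0$ (only at $e$), $1$, $2$, $4$. The elements with $a=1$ are the non-identity elements with a unique reduced expression; those with $a=2$ are $\{u\,rt(srt)^m\,v\mid u\in\{e,s,ts,rs\},\ v\in\{e,s,st,sr\},\ m\in\mathbb{N}\}$. $P_{u,w}$ are the Kazhdan–Lusztig polynomials and, for $u\le w$, $\mu(u,w)$ is the coefficient of $q^{\frac12(l(w)-l(u)-1)}$ in $P_{u,w}$ (zero if the exponent is not an integer). -}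

module Defs where

open import Data.Nat using (ℕ; zero; suc; _+_; _∸_; _≤_; _<_; ⌊_/2⌋)
open import Data.Integer as ℤ using (ℤ; +_)
open import Data.List using (List; []; _∷_; _++_; length; reverse; foldr; map)
open import Data.List.Relation.Unary.All using (All)
open import Data.List.Relation.Unary.Any using (Any)
open import Data.List.Relation.Unary.AllPairs using (AllPairs)
open import Data.Bool using (Bool; true; false; if_then_else_)
open import Data.Product using (Σ; ∃; _×_; _,_)
open import Relation.Binary.PropositionalEquality using (_≡_)
open import Relation.Nullary using (¬_)

-- The Coxeter group W of type B̃₂, by generators and relations.
-- Elements of W are represented by words in the generators r, s, t;
-- two words represent the same element iff they are related by _≈_,
-- the congruence on words generated by the Coxeter relations
--   r² = s² = t² = e,  rt = tr,  (rs)⁴ = e,  (st)⁴ = e.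

data Gen : Set where
  r s t : Gen

Word : Set
Word = List Gen

infix 4 _≈_
data _≈_ : Word → Word → Set where
  ≈-refl  : ∀ {w} → w ≈ w
  ≈-sym   : ∀ {u w} → u ≈ w → w ≈ u
  ≈-trans : ∀ {u v w} → u ≈ v → v ≈ w → u ≈ w
  ≈-cong  : ∀ {u u′ v v′} → u ≈ u′ → v ≈ v′ → u ++ v ≈ u′ ++ v′
  rel-sq  : ∀ g → g ∷ g ∷ [] ≈ []
  rel-rt  : r ∷ t ∷ [] ≈ t ∷ r ∷ []
  rel-rs  : r ∷ s ∷ r ∷ s ∷ r ∷ s ∷ r ∷ s ∷ [] ≈ []
  rel-st  : s ∷ t ∷ s ∷ t ∷ s ∷ t ∷ s ∷ t ∷ [] ≈ []

Reduced : Word → Set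
Reduced w = ∀ v → v ≈ w → length w ≤ length v

Length : Word → ℕ → Set
Length w n = Σ Word λ v → v ≈ w × Reduced v × length v ≡ n

LengthLt : Word → Word → Set
LengthLt v w = Σ ℕ λ m → Σ ℕ λ n → Length v m × Length w n × m < n

-- Reflections are the conjugates x g x⁻¹ of simple reflections
-- (the inverse of a word is its reverse, since generators are involutions).
reflection : Word → Gen → Word
reflection x g = x ++ g ∷ reverse x

infix 4 _≤B_ _<B_
data _≤B_ : Word → Word → Set where
  ≤B-refl : ∀ {u w} → u ≈ w → u ≤B w
  ≤B-step : ∀ {u v w} (x : Word) (g : Gen) → u ≤B v →
            w ≈ v ++ reflection x g → LengthLt v w → u ≤B w

_<B_ : Word → Word → Set
u <B w = u ≤B w × ¬ (u ≈ w)

Poly : Set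
Poly = ℕ → ℤ

shift : ℕ → Poly → Poly
shift zero    f i       = f i
shift (suc k) f zero    = + 0
shift (suc k) f (suc i) = shift k f i

one : Poly
one zero    = + 1
one (suc i) = + 0

odd : ℕ → Bool
odd zero          = false
odd (suc zero)    = true
odd (suc (suc n)) = odd n

-- μ(u,w) for a candidate family P of KL polynomials, u and w given by
-- reduced words (so l = list length): the coefficient of
-- q^{(l(w)-l(u)-1)/2} in P u w, and 0 if that exponent is not an integer.
mu : (Word → Word → Poly) → Word → Word → ℤ
mu P u w with odd (length w ∸ length u)
... | true  = P u w ⌊ length w ∸ length u /2⌋
... | false = + 0

-- Z is an enumeration (one reduced representative per element) of the
-- finite set { z ∈ W | z < v, gz < z }.
Enumerates : Gen → Word → List Word → Set
Enumerates g v Z =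
  All (λ z → Reduced z × z <B v × ¬ Reduced (g ∷ z)) Z ×
  AllPairs (λ z z′ → ¬ (z ≈ z′)) Z ×
  (∀ z → Reduced z → z <B v → ¬ Reduced (g ∷ z) → Any (λ z′ → z ≈ z′) Z)

sumℤ : List ℤ → ℤ
sumℤ = foldr ℤ._+_ (+ 0)

correction : (Word → Word → Poly) → Gen → Word → Word → List Word → Poly
correction P g v x Z i =
  sumℤ (map (λ z → mu P z v ℤ.* shift ⌊ length (g ∷ v) ∸ length z /2⌋ (P x z) i) Z)

-- P is the family of Kazhdan–Lusztig polynomials P_{x,w}: it is
-- determined by these conditions (Kazhdan–Lusztig 1979, (2.2.c)),
-- by induction on l(w).
record IsKL (P : Word → Word → Poly) : Set where
  field
    invariant : ∀ {x x′ w w′} → x ≈ x′ → w ≈ w′ → ∀ i → P x w i ≡ P x′ w′ i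
    vanish    : ∀ x w → ¬ (x ≤B w) → ∀ i → P x w i ≡ + 0
    diagonal  : ∀ w i → P w w i ≡ one i
    -- w = g v reduced (so g w < w), x ≤ w reduced, c = 0 (g x > x)
    recursion-up   : ∀ g v x → Reduced (g ∷ v) → Reduced x → x ≤B g ∷ v →
                     Reduced (g ∷ x) → ∀ Z → Enumerates g v Z → ∀ i →
                     P x (g ∷ v) i ≡
                       (shift 1 (P (g ∷ x) v) i ℤ.+ P x v i) ℤ.- correction P g v x Z i
    -- c = 1 (g x < x)
    recursion-down : ∀ g v x → Reduced (g ∷ v) → Reduced x → x ≤B g ∷ v →
                     ¬ Reduced (g ∷ x) → ∀ Z → Enumerates g v Z → ∀ i →
                     P x (g ∷ v) i ≡
                       (P (g ∷ x) v i ℤ.+ shift 1 (P x v) i) ℤ.- correction P g v x Z i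

-- Lusztig's a-function on W, via the description in the context:
-- a = 0 only at e; a = 1 exactly on non-identity elements with a unique
-- reduced expression; a = 2 exactly on the explicit family below;
-- a = 4 on all remaining elements.

UniqueReduced : Word → Set
UniqueReduced w = Σ Word λ w₀ → w₀ ≈ w × Reduced w₀ × (∀ v → v ≈ w → Reduced v → v ≡ w₀)

rep : ℕ → Word → Word
rep zero    x = []
rep (suc m) x = x ++ rep m x

data LeftFactor : Word → Set where
  lf-e  : LeftFactor []
  lf-s  : LeftFactor (s ∷ [])
  lf-ts : LeftFactor (t ∷ s ∷ [])
  lf-rs : LeftFactor (r ∷ s ∷ [])

data RightFactor : Word → Set where
  rf-e  : RightFactor []
  rf-s  : RightFactor (s ∷ [])
  rf-st : RightFactor (s ∷ t ∷ [])
  rf-sr : RightFactor (s ∷ r ∷ [])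

InA2 : Word → Set
InA2 w = Σ Word λ u → Σ Word λ v → Σ ℕ λ m →
  LeftFactor u × RightFactor v × w ≈ u ++ (r ∷ t ∷ rep m (s ∷ r ∷ t ∷ [])) ++ v

data HasA : Word → ℕ → Set where
  a-0 : ∀ {w} → w ≈ [] → HasA w 0
  a-1 : ∀ {w} → ¬ (w ≈ []) → UniqueReduced w → HasA w 1
  a-2 : ∀ {w} → InA2 w → HasA w 2
  a-4 : ∀ {w} → ¬ (w ≈ []) → ¬ UniqueReduced w → ¬ InA2 w → HasA w 4

{-# OPTIONS --safe #-}

-- The elements with a = 1, 2 are the fully commutative ones, those with a = 4 have a reduced expression
-- containing rsrs or stst.  If l(w) - l(u) = 1, then μ(u, w) = P_{u,w}(0) = 1.  Otherwise μ(u, w) ≠ 0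
-- forces L(w) ⊆ L(u), and one inducts on l(w).  Unless L(w) = {r, t} and neither r w nor t w has s
-- as a descent, some w = g x and h ∈ L(x) ∖ L(u) exist, and the recursion for P_{u,gx} collapses to
--   μ(u, gx) = μ(gu, x) + [g ∉ L(hu)] μ(hu, x) - [g ∈ L(hx)] μ(u, hx),
-- where all terms on the right vanish or cancel.  In the remaining case w = rt·s·rt·x, and one passes
-- to the inverse matrix F of the Kazhdan–Lusztig matrix, in powers of v⁻¹ with v² = q: its first order
-- term is -μ, and F u (g x) is expressed through F z x with z = u, z = g u or g ∉ L(z), μ(u, z) ≠ 0.
-- Hence only fully commutative z enter, and just two of them contribute.

module Submission where

open import Defs
open import Data.Bool using (Bool; true; false; not)
import Data.Bool.Properties as Boolₚ
open import Data.Empty using (⊥; ⊥-elim)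
open import Data.Integer as ℤ using (ℤ; +_; -[1+_]; ∣_∣; -1ℤ; 0ℤ; 1ℤ; _+_; _*_; _-_; -_)
import Data.Integer.Properties as ℤₚ
open import Data.Integer.Tactic.RingSolver using (solve-∀)
open import Data.List
  using (List; []; _∷_; _++_; length; reverse; foldr; map; upTo; cartesianProductWith)
import Data.List.Properties as Listₚ
open import Data.List.Membership.Propositional using (_∈_)
open import Data.List.Membership.Propositional.Properties
  using (∈-map⁺; ∈-map⁻; ∈-++⁺ˡ; ∈-++⁺ʳ; ∈-upTo⁺; ∈-cartesianProductWith⁺)
open import Data.List.Relation.Unary.All as All using (All; []; _∷_)
import Data.List.Relation.Unary.All.Properties as Allₚ
open import Data.List.Relation.Unary.AllPairs as AllPairs using ([]; _∷_)
import Data.List.Relation.Unary.AllPairs.Properties as AllPairsₚ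
open import Data.List.Relation.Unary.Any as Any using (Any; here; there)
import Data.List.Relation.Unary.Any.Properties as Anyₚ
open import Data.List.Relation.Unary.Unique.Propositional using (Unique)
import Data.List.Relation.Unary.Unique.Propositional.Properties as Uniqueₚ
open import Data.Nat as ℕ
  using (ℕ; zero; suc; _≤_; _<_; z≤n; s≤s; _∸_; ⌊_/2⌋)
import Data.Nat.Properties as ℕₚ
import Data.Nat.Tactic.RingSolver as ℕSolver
open import Data.Product using (Σ; _×_; _,_; proj₁; proj₂)
open import Data.Sum using (_⊎_; inj₁; inj₂)
open import Relation.Binary.Definitions using (DecidableEquality)
open import Relation.Binary.PropositionalEquality
  using (_≡_; _≢_; refl; sym; trans; cong; cong₂; subst; subst₂; module ≡-Reasoning)
open import Relation.Nullary using (¬_; Dec; yes; no; does)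
open import Relation.Nullary.Decidable
  using (decidable-stable; map′; _×-dec_; ¬¬-excluded-middle)

-- Alcoves, the action of W on them, left descents and length

-- For a generic point (a, b) of the plane let A = ⌊2a⌋, B = ⌊2b⌋, M = ⌊b - a⌋, S = ⌊a + b⌋.
-- These are constant on the alcoves of the reflections in a, b ∈ ½ℤ and a ± b ∈ ℤ, and W acts
-- simply transitively on the alcoves by r : a ↦ -a, s : a ↔ b, t : b ↦ 1 - b.  An element of W is
-- represented by its image of the alcove 0 < a < b < ½.  Up to one of four offsets, B and S are
-- functions of A and M.

-- Why the descent h ∈ L(x) ∖ L(u) matters: besides its sum over z, the recursion for μ(u, gx)
-- contains a second-order coefficient of P_{u,x}, about which the induction hypothesis is silent.
-- Such an h turns that coefficient into μ(hu, x) and leaves only z = hx and z = hu in the sum. In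
-- the remaining case L(rw) = {t} and L(tw) = {r}, while every relevant u has both r and t as
-- descents, so no h exists. Second-order recursions for P then have summands μ(z, x) times a
-- second-order coefficient of P_{u,z}; if z contains a braid, the hypothesis bounds neither factor.
-- For F the factor is μ(u, z) at every order, which is exactly what the hypothesis controls. The
-- statement carried through the induction, `Isolated`, quantifies over all fully commutative u,
-- since u is replaced by gu, hu and longer neighbours. Covers, where μ need not vanish, are exempt
-- from it and are settled separately each time they occur. The presentation of W provides neither
-- length nor descents. Both are read off from signs of integers in the alcove model, from which
-- strong exchange and the lifting property of the Bruhat order are derived.

data Type : Set where
  α β γ δ : Type

record Alcove : Set where
  constructor alc
  field
    A M : ℤ
    ty  : Type
open Alcove public

-- With x and y the fractional parts of 2a and b - a, these are ⌊x + 2y⌋ and ⌊x + y⌋. The lines x +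
-- y = 1, x + 2y = 1 and x + 2y = 2 cut the unit square into four triangles, one for each type.
offB offS : Type → ℤ
offB α = + 0
offB β = + 1
offB γ = + 1
offB δ = + 2
offS α = + 0
offS β = + 1
offS γ = + 0
offS δ = + 1

B S : Alcove → ℤ
B x = A x + (M x + M x) + offB (ty x)
S x = A x + M x + offS (ty x)

actTy : Gen → Type → Type
actTy r α = β
actTy r β = α
actTy r γ = δ
actTy r δ = γ
actTy s α = δ
actTy s β = β
actTy s γ = γ
actTy s δ = α
actTy t α = γ
actTy t β = δ
actTy t γ = α
actTy t δ = β

-- ⌊-x⌋ = -1 - ⌊x⌋ for non-integral x; so `+ 0` and `-1ℤ` are the values on the two sides of a wall.
flip : ℤ → ℤ
flip z = -1ℤ - z

data End : Gen → Set where
  end-r : End r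
  end-t : End t

abstract
  act : Gen → Alcove → Alcove
  act r x = alc (flip (A x)) (S x) (actTy r (ty x))
  act s x = alc (B x) (flip (M x)) (actTy s (ty x))
  act t x = alc (A x) (- S x) (actTy t (ty x))

  id₀ : Alcove
  id₀ = alc (+ 0) (+ 0) α


  offB-r : ∀ τ → offB (actTy r τ) ≡ offB τ + + 1 - (offS τ + offS τ)
  offB-r α = refl
  offB-r β = refl
  offB-r γ = refl
  offB-r δ = refl

  offS-r : ∀ τ → offS (actTy r τ) ≡ + 1 - offS τ
  offS-r α = refl
  offS-r β = refl
  offS-r γ = refl
  offS-r δ = refl

  offB-s : ∀ τ → offB (actTy s τ) ≡ + 2 - offB τ
  offB-s α = refl
  offB-s β = refl
  offB-s γ = refl
  offB-s δ = refl

  offS-s : ∀ τ → offS (actTy s τ) ≡ offS τ - offB τ + + 1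
  offS-s α = refl
  offS-s β = refl
  offS-s γ = refl
  offS-s δ = refl

  offB-t : ∀ τ → offB (actTy t τ) ≡ + 1 - offB τ + (offS τ + offS τ)
  offB-t α = refl
  offB-t β = refl
  offB-t γ = refl
  offB-t δ = refl

  offS-t : ∀ τ → offS (actTy t τ) ≡ offS τ
  offS-t α = refl
  offS-t β = refl
  offS-t γ = refl
  offS-t δ = refl

  B-r : ∀ x → B (act r x) ≡ B x
  B-r (alc A M τ) rewrite offB-r τ = lemma A M (offB τ) (offS τ)
    where
    lemma : ∀ A M i j → (-1ℤ - A) + ((A + M + j) + (A + M + j)) +
                        (i + + 1 - (j + j)) ≡ A + (M + M) + i
    lemma = solve-∀

  S-r : ∀ x → S (act r x) ≡ M x
  S-r (alc A M τ) rewrite offS-r τ = lemma A M (offS τ)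
    where
    lemma : ∀ A M j → (-1ℤ - A) + (A + M + j) + (+ 1 - j) ≡ M
    lemma = solve-∀

  B-s : ∀ x → B (act s x) ≡ A x
  B-s (alc A M τ) rewrite offB-s τ = lemma A M (offB τ)
    where
    lemma : ∀ A M i → A + (M + M) + i + ((-1ℤ - M) + (-1ℤ - M)) + (+ 2 - i) ≡ A
    lemma = solve-∀

  S-s : ∀ x → S (act s x) ≡ S x
  S-s (alc A M τ) rewrite offS-s τ = lemma A M (offB τ) (offS τ)
    where
    lemma : ∀ A M i j → A + (M + M) + i + (-1ℤ - M) + (j - i + + 1) ≡ A + M + j
    lemma = solve-∀

  B-t : ∀ x → B (act t x) ≡ + 1 - B x
  B-t (alc A M τ) rewrite offB-t τ = lemma A M (offB τ) (offS τ)
    where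
    lemma : ∀ A M i j → A + (- (A + M + j) + - (A + M + j)) +
                        (+ 1 - i + (j + j)) ≡ + 1 - (A + (M + M) + i)
    lemma = solve-∀

  S-t : ∀ x → S (act t x) ≡ - M x
  S-t (alc A M τ) rewrite offS-t τ = lemma A M (offS τ)
    where
    lemma : ∀ A M j → A + - (A + M + j) + j ≡ - M
    lemma = solve-∀

  alc-≡ : ∀ {x y} → A x ≡ A y → M x ≡ M y → ty x ≡ ty y → x ≡ y
  alc-≡ {alc _ _ _} {alc _ _ _} refl refl refl = refl

  flip-flip : ∀ z → flip (flip z) ≡ z
  flip-flip = lemma
    where
    lemma : ∀ z → -1ℤ - (-1ℤ - z) ≡ z
    lemma = solve-∀

  actTy-invol : ∀ g τ → actTy g (actTy g τ) ≡ τ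
  actTy-invol r α = refl
  actTy-invol r β = refl
  actTy-invol r γ = refl
  actTy-invol r δ = refl
  actTy-invol s α = refl
  actTy-invol s β = refl
  actTy-invol s γ = refl
  actTy-invol s δ = refl
  actTy-invol t α = refl
  actTy-invol t β = refl
  actTy-invol t γ = refl
  actTy-invol t δ = refl

  act-invol : ∀ g x → act g (act g x) ≡ x
  act-invol r x = alc-≡ (flip-flip (A x)) (S-r x) (actTy-invol r (ty x))
  act-invol s x = alc-≡ (B-s x) (flip-flip (M x)) (actTy-invol s (ty x))
  act-invol t x = alc-≡ refl (trans (cong -_ (S-t x)) (ℤₚ.neg-involutive (M x))) (actTy-invol t (ty x))

  act-rt : ∀ x → act r (act t x) ≡ act t (act r x)
  act-rt x@(alc _ _ τ) = alc-≡ refl (trans (S-t x) (cong -_ (sym (S-r x)))) (types τ)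
    where
    types : ∀ τ → actTy r (actTy t τ) ≡ actTy t (actTy r τ)
    types α = refl
    types β = refl
    types γ = refl
    types δ = refl

  act-braid : ∀ {h} → End h → ∀ x →
              act s (act h (act s (act h x))) ≡ act h (act s (act h (act s x)))
  act-braid end-r x@(alc _ _ τ) = alc-≡
    (trans (B-r (act s (act r x))) (trans (B-s (act r x)) (cong flip (sym
      (trans (B-r (act s x)) (B-s x))))))
    (trans (cong flip (trans (S-s (act r x)) (S-r x))) (sym
      (trans (S-s (act r (act s x))) (S-r (act s x)))))
    (types τ)
    where
    types : ∀ τ → actTy s (actTy r (actTy s (actTy r τ))) ≡ actTy r (actTy s (actTy r (actTy s τ)))
    types α = refl
    types β = refl
    types γ = refl
    types δ = refl
  act-braid end-t x@(alc _ _ τ) = alc-≡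
    (trans (B-t (act s (act t x))) (trans (cong (λ z → + 1 - z) (B-s (act t x))) (sym
      (trans (B-t (act s x)) (cong (λ z → + 1 - z) (B-s x))))))
    (trans (cong (λ z → flip (- z)) (trans (S-s (act t x)) (S-t x))) (trans
      (lemma (M x)) (cong -_ (sym (trans (S-s (act t (act s x))) (S-t (act s x)))))))
    (types τ)
    where
    lemma : ∀ z → -1ℤ - (- (- z)) ≡ - (- (-1ℤ - z))
    lemma = solve-∀
    types : ∀ τ → actTy s (actTy t (actTy s (actTy t τ))) ≡ actTy t (actTy s (actTy t (actTy s τ)))
    types α = refl
    types β = refl
    types γ = refl
    types δ = refl

  -- The floor whose sign tells the side of the wall of `g`, negative away from `id₀`. For t the far
  -- side is b > ½, that is ⌊2b⌋ ≥ 1, whence `- B x`.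
  coord : Gen → Alcove → ℤ
  coord r = A
  coord s = M
  coord t x = - B x

  neg : ℤ → Bool
  neg (+ _)    = false
  neg -[1+ _ ] = true

  desc : Gen → Alcove → Bool
  desc g x = neg (coord g x)

  coord-act : ∀ g x → coord g (act g x) ≡ flip (coord g x)
  coord-act r x = refl
  coord-act s x = refl
  coord-act t x = trans (cong -_ (B-t x)) (lemma (B x))
    where
    lemma : ∀ z → - (+ 1 - z) ≡ -1ℤ - (- z)
    lemma = solve-∀

  neg-flip : ∀ z → neg (flip z) ≡ not (neg z)
  neg-flip (+ zero)  = refl
  neg-flip (+ suc n) = refl
  neg-flip -[1+ n ]  = refl

  desc-act : ∀ g x → desc g (act g x) ≡ not (desc g x)
  desc-act g x = trans (cong neg (coord-act g x)) (neg-flip (coord g x))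

  -- The number of walls separating x from the alcove of the identity.
  len : Alcove → ℕ
  len x = ∣ A x ∣ ℕ.+ ∣ B x ∣ ℕ.+ ∣ M x ∣ ℕ.+ ∣ S x ∣

  ∣flip∣-≥0 : ∀ z → neg z ≡ false → ∣ flip z ∣ ≡ suc ∣ z ∣
  ∣flip∣-≥0 (+ zero)  _ = refl
  ∣flip∣-≥0 (+ suc n) _ = refl

  len-up : ∀ g x → desc g x ≡ false → len (act g x) ≡ suc (len x)
  len-up r x e
    rewrite B-r x | S-r x | ∣flip∣-≥0 (A x) e
    = cong suc (lemma (∣ A x ∣) (∣ B x ∣) (∣ M x ∣) (∣ S x ∣))
    where
    lemma : ∀ a b m j → a ℕ.+ b ℕ.+ j ℕ.+ m ≡ a ℕ.+ b ℕ.+ m ℕ.+ j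
    lemma = ℕSolver.solve-∀
  len-up s x e
    rewrite B-s x | S-s x | ∣flip∣-≥0 (M x) e = lemma (∣ A x ∣) (∣ B x ∣) (∣ M x ∣) (∣ S x ∣)
    where
    lemma : ∀ a b m j → b ℕ.+ a ℕ.+ suc m ℕ.+ j ≡ suc (a ℕ.+ b ℕ.+ m ℕ.+ j)
    lemma = ℕSolver.solve-∀
  len-up t x e = begin
    ∣ A x ∣ ℕ.+ ∣ B (act t x) ∣ ℕ.+ ∣ - S x ∣ ℕ.+ ∣ S (act t x) ∣
      ≡⟨ cong₂ (λ b m → ∣ A x ∣ ℕ.+ b ℕ.+ ∣ - S x ∣ ℕ.+ m) absB
        (trans (cong ∣_∣ (S-t x)) (ℤₚ.∣-i∣≡∣i∣ (M x))) ⟩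
    ∣ A x ∣ ℕ.+ suc ∣ B x ∣ ℕ.+ ∣ - S x ∣ ℕ.+ ∣ M x ∣
      ≡⟨ cong (λ j → ∣ A x ∣ ℕ.+ suc ∣ B x ∣ ℕ.+ j ℕ.+ ∣ M x ∣) (ℤₚ.∣-i∣≡∣i∣ (S x)) ⟩
    ∣ A x ∣ ℕ.+ suc ∣ B x ∣ ℕ.+ ∣ S x ∣ ℕ.+ ∣ M x ∣
      ≡⟨ lemma (∣ A x ∣) (∣ B x ∣) (∣ M x ∣) (∣ S x ∣) ⟩
    suc (len x) ∎
    where
    open ≡-Reasoning
    lemma : ∀ a b m j → a ℕ.+ suc b ℕ.+ j ℕ.+ m ≡ suc (a ℕ.+ b ℕ.+ m ℕ.+ j)
    lemma = ℕSolver.solve-∀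
    absB : ∣ B (act t x) ∣ ≡ suc ∣ B x ∣
    absB = trans (sym (ℤₚ.∣-i∣≡∣i∣ (B (act t x)))) (trans (cong ∣_∣ (coord-act t x))
             (trans (∣flip∣-≥0 (coord t x) e) (cong suc (ℤₚ.∣-i∣≡∣i∣ (B x)))))

  len-down : ∀ g x → desc g x ≡ true → suc (len (act g x)) ≡ len x
  len-down g x e = trans (sym (len-up g (act g x) (trans (desc-act g x) (cong not e))))
                         (cong len (act-invol g x))

  neg⇒≤ : ∀ {z} → neg z ≡ true → z ℤ.≤ -1ℤ
  neg⇒≤ { -[1+ n ]} _ = ℤ.-≤- ℕ.z≤n

  ≤⇒neg : ∀ {z} → z ℤ.≤ -1ℤ → neg z ≡ true
  ≤⇒neg { -[1+ n ]} _ = refl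

  -- In the plane, a < 0 and b < a give b < 0. In floors, A + 2M ≤ -3 and the offset is at most 2.
  A<0∧M<0⇒B<0 : ∀ x → neg (A x) ≡ true → neg (M x) ≡ true → neg (B x) ≡ true
  A<0∧M<0⇒B<0 x a m = ≤⇒neg (ℤₚ.+-mono-≤ (ℤₚ.+-mono-≤ (neg⇒≤ a) (ℤₚ.+-mono-≤ (neg⇒≤ m) (neg⇒≤ m)))
    (off (ty x)))
    where
    off : ∀ τ → offB τ ℤ.≤ + 2
    off α = ℤ.+≤+ ℕ.z≤n
    off β = ℤ.+≤+ (ℕ.s≤s ℕ.z≤n)
    off γ = ℤ.+≤+ (ℕ.s≤s ℕ.z≤n)
    off δ = ℤₚ.≤-refl

  A<0∧M<0⇒S<0 : ∀ x → neg (A x) ≡ true → neg (M x) ≡ true → neg (S x) ≡ true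
  A<0∧M<0⇒S<0 x a m = ≤⇒neg (ℤₚ.+-mono-≤ (ℤₚ.+-mono-≤ (neg⇒≤ a) (neg⇒≤ m)) (off (ty x)))
    where
    off : ∀ τ → offS τ ℤ.≤ + 1
    off α = ℤ.+≤+ ℕ.z≤n
    off β = ℤₚ.≤-refl
    off γ = ℤ.+≤+ ℕ.z≤n
    off δ = ℤₚ.≤-refl

  B>0∧M<0⇒A>0 : ∀ x → neg (- B x) ≡ true → neg (M x) ≡ true → neg (- A x) ≡ true
  B>0∧M<0⇒A>0 x b m = subst (λ z → neg z ≡ true) (lemma (A x) (M x) (offB (ty x)))
      (≤⇒neg (ℤₚ.+-mono-≤ (ℤₚ.+-mono-≤ (neg⇒≤ b) (ℤₚ.+-mono-≤ (neg⇒≤ m) (neg⇒≤ m))) (off (ty x))))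
    where
    lemma : ∀ A M i → (- (A + (M + M) + i)) + (M + M) + i ≡ - A
    lemma = solve-∀
    off : ∀ τ → offB τ ℤ.≤ + 2
    off α = ℤ.+≤+ ℕ.z≤n
    off β = ℤ.+≤+ (ℕ.s≤s ℕ.z≤n)
    off γ = ℤ.+≤+ (ℕ.s≤s ℕ.z≤n)
    off δ = ℤₚ.≤-refl

  B>0∧M<0⇒S>0 : ∀ x → neg (- B x) ≡ true → neg (M x) ≡ true → neg (- S x) ≡ true
  B>0∧M<0⇒S>0 x b m = subst (λ z → neg z ≡ true) (lemma (A x) (M x) (offB (ty x)) (offS (ty x)))
      (≤⇒neg (ℤₚ.+-mono-≤ (ℤₚ.+-mono-≤ (neg⇒≤ b) (neg⇒≤ m)) (off (ty x))))
    where
    lemma : ∀ A M i j → (- (A + (M + M) + i)) + M + (i - j) ≡ - (A + M + j)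
    lemma = solve-∀
    off : ∀ τ → offB τ - offS τ ℤ.≤ + 1
    off α = ℤ.+≤+ ℕ.z≤n
    off β = ℤ.+≤+ ℕ.z≤n
    off γ = ℤₚ.≤-refl
    off δ = ℤₚ.≤-refl

  desc-rt : ∀ x → desc r (act t x) ≡ desc r x
  desc-rt x = refl

  desc-tr : ∀ x → desc t (act r x) ≡ desc t x
  desc-tr x = cong (λ z → neg (- z)) (B-r x)

-- If s and h are both descents of x, then x = shsh y with lengths adding.
record Dihedral (h : Gen) (x : Alcove) : Set where
  field
    d-hs   : desc h (act s x) ≡ true
    d-shs  : desc s (act h (act s x)) ≡ true
    d-hshs : desc h (act s (act h (act s x))) ≡ true
    d-sh   : desc s (act h x) ≡ true
    d-hsh  : desc h (act s (act h x)) ≡ true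
    d-shsh : desc s (act h (act s (act h x))) ≡ true

abstract
  -- Each of the six conditions is the sign of one of A, B, M, S at `x` itself, up to negation. Two
  -- of the four signs are given, and the inequalities above force the other two.
  dihedral : ∀ {h} → End h → ∀ x → desc s x ≡ true → desc h x ≡ true → Dihedral h x
  dihedral end-r x m a = record
    { d-hs   = A<0∧M<0⇒B<0 x a m
    ; d-shs  = trans (cong neg (S-s x)) (A<0∧M<0⇒S<0 x a m)
    ; d-hshs = trans (cong neg (trans (B-r (act s x)) (B-s x))) a
    ; d-sh   = A<0∧M<0⇒S<0 x a m
    ; d-hsh  = trans (cong neg (B-r x)) (A<0∧M<0⇒B<0 x a m)
    ; d-shsh = trans (cong neg (trans (S-s (act r x)) (S-r x))) m
    }
  dihedral end-t x m b = record
    { d-hs   = trans (cong (λ z → neg (- z)) (B-s x)) (B>0∧M<0⇒A>0 x b m)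
    ; d-shs  = trans (cong (λ z → neg (- z)) (S-s x)) (B>0∧M<0⇒S>0 x b m)
    ; d-hshs = trans (cong (λ z → neg (- z)) (B-s (act t (act s x)))) b
    ; d-sh   = B>0∧M<0⇒S>0 x b m
    ; d-hsh  = trans (cong (λ z → neg (- z)) (B-s (act t x))) (B>0∧M<0⇒A>0 x b m)
    ; d-shsh = trans (cong (λ z → neg (- z)) (trans (S-s (act t x)) (S-t x)))
                     (trans (cong neg (ℤₚ.neg-involutive (M x))) m)
    }

  neg-neg : ∀ z → neg z ≡ true → neg (- z) ≡ true → ⊥
  neg-neg -[1+ n ] _ ()

  not-all-descents : ∀ x → desc r x ≡ true → desc s x ≡ true → desc t x ≡ true → ⊥
  not-all-descents x a m b = neg-neg (B x) (A<0∧M<0⇒B<0 x a m) b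

  -- A ≥ 0, M ≥ 0 and A + 2M + offset ≤ 0 leave only A = M = 0 with offset 0, which is type α.
  no-descents : ∀ x → desc r x ≡ false → desc s x ≡ false → desc t x ≡ false → x ≡ id₀
  no-descents (alc (+ 0) (+ 0) α) _ _ _ = refl
  no-descents (alc (+ 0) (+ 0) β) _ _ ()
  no-descents (alc (+ 0) (+ 0) γ) _ _ ()
  no-descents (alc (+ 0) (+ 0) δ) _ _ ()
  no-descents (alc (+ 0) (+ suc m) α) _ _ ()
  no-descents (alc (+ 0) (+ suc m) β) _ _ ()
  no-descents (alc (+ 0) (+ suc m) γ) _ _ ()
  no-descents (alc (+ 0) (+ suc m) δ) _ _ ()
  no-descents (alc (+ suc a) (+ m) α) _ _ ()
  no-descents (alc (+ suc a) (+ m) β) _ _ ()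
  no-descents (alc (+ suc a) (+ m) γ) _ _ ()
  no-descents (alc (+ suc a) (+ m) δ) _ _ ()

  len-id₀ : len id₀ ≡ 0
  len-id₀ = refl

  desc-id₀ : ∀ g → desc g id₀ ≡ false
  desc-id₀ r = refl
  desc-id₀ s = refl
  desc-id₀ t = refl

  desc-act-id₀ : ∀ g h → desc g (act h id₀) ≡ true → g ≡ h
  desc-act-id₀ r r _ = refl
  desc-act-id₀ r s ()
  desc-act-id₀ r t ()
  desc-act-id₀ s r ()
  desc-act-id₀ s s _ = refl
  desc-act-id₀ s t ()
  desc-act-id₀ t r ()
  desc-act-id₀ t s ()
  desc-act-id₀ t t _ = refl

  ∣A∣≤len : ∀ x → ∣ A x ∣ ℕ.≤ len x
  ∣A∣≤len x = ℕₚ.≤-trans (ℕₚ.m≤m+n _ _) (ℕₚ.≤-trans (ℕₚ.m≤m+n _ _) (ℕₚ.m≤m+n _ _))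

  ∣M∣≤len : ∀ x → ∣ M x ∣ ℕ.≤ len x
  ∣M∣≤len x = ℕₚ.≤-trans (ℕₚ.m≤n+m _ (∣ A x ∣ ℕ.+ ∣ B x ∣)) (ℕₚ.m≤m+n _ _)

true≢false : ∀ {b : Bool} → b ≡ true → b ≡ false → ⊥
true≢false refl ()

-- Pairs of generators and the word problem

data NonComm : Gen → Gen → Set where
  s-end : ∀ {h} → End h → NonComm s h
  end-s : ∀ {h} → End h → NonComm h s

nc-dihedral : ∀ {g k} → NonComm g k → ∀ x → desc g x ≡ true → desc k x ≡ true →
              desc g (act k x) ≡ true × desc k (act g (act k x)) ≡ true ×
              desc g (act k (act g (act k x))) ≡ true
nc-dihedral (s-end e) x p q = let open Dihedral (dihedral e x p q) in d-sh , d-hsh , d-shsh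
nc-dihedral (end-s e) x p q = let open Dihedral (dihedral e x q p) in d-hs , d-shs , d-hshs

nc-braid : ∀ {g k} → NonComm g k → ∀ x →
           act g (act k (act g (act k x))) ≡ act k (act g (act k (act g x)))
nc-braid (s-end e) x = act-braid e x
nc-braid (end-s e) x = sym (act-braid e x)

data Pair : Gen → Gen → Set where
  same    : ∀ {g} → Pair g g
  comm    : ∀ {g k} → (∀ x → act g (act k x) ≡ act k (act g x)) →
            (∀ x → desc g (act k x) ≡ desc g x) → (∀ x → desc k (act g x) ≡ desc k x) →
            g ∷ k ∷ [] ≈ k ∷ g ∷ [] → Pair g k
  noncomm : ∀ {g k} → NonComm g k → Pair g k

pair : ∀ g k → Pair g k
pair r r = same
pair r s = noncomm (end-s end-r)
pair r t = comm act-rt desc-rt desc-tr rel-rt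
pair s r = noncomm (s-end end-r)
pair s s = same
pair s t = noncomm (s-end end-t)
pair t r = comm (λ x → sym (act-rt x)) desc-tr desc-rt (≈-sym rel-rt)
pair t s = noncomm (end-s end-t)
pair t t = same

run : Word → Alcove → Alcove
run w x = foldr act x w

pt : Word → Alcove
pt w = run w id₀

run-++ : ∀ u v x → run (u ++ v) x ≡ run u (run v x)
run-++ u v x = Listₚ.foldr-++ act x u v

run-≈ : ∀ {u v} → u ≈ v → ∀ x → run u x ≡ run v x
run-≈ ≈-refl x = refl
run-≈ (≈-sym p) x = sym (run-≈ p x)
run-≈ (≈-trans p q) x = trans (run-≈ p x) (run-≈ q x)
run-≈ (≈-cong {u} {u′} {v} {v′} p q) x = begin
  run (u ++ v) x     ≡⟨ run-++ u v x ⟩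
  run u (run v x)    ≡⟨ run-≈ p (run v x) ⟩
  run u′ (run v x)   ≡⟨ cong (run u′) (run-≈ q x) ⟩
  run u′ (run v′ x)  ≡⟨ run-++ u′ v′ x ⟨
  run (u′ ++ v′) x   ∎
  where open ≡-Reasoning
run-≈ (rel-sq g) x = act-invol g x
run-≈ rel-rt x = act-rt x
run-≈ rel-rs x = trans (cong (λ y → act r (act s (act r (act s y)))) (sym (act-braid end-r x)))
  (cancel4 x)
  where
  cancel4 : ∀ x → act r (act s (act r (act s (act s (act r (act s (act r x))))))) ≡ x
  cancel4 x = trans (cong (λ y → act r (act s (act r y))) (act-invol s _))
             (trans (cong (λ y → act r (act s y)) (act-invol r _))
             (trans (cong (act r) (act-invol s _)) (act-invol r x)))
run-≈ rel-st x = trans (cong (λ y → act s (act t (act s (act t y)))) (act-braid end-t x)) (cancel4 x)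
  where
  cancel4 : ∀ x → act s (act t (act s (act t (act t (act s (act t (act s x))))))) ≡ x
  cancel4 x = trans (cong (λ y → act s (act t (act s y))) (act-invol t _))
             (trans (cong (λ y → act s (act t y)) (act-invol s _))
             (trans (cong (act s) (act-invol t _)) (act-invol s x)))

∷-cong : ∀ g {u v} → u ≈ v → g ∷ u ≈ g ∷ v
∷-cong g p = ≈-cong (≈-refl {g ∷ []}) p

cancel : ∀ g w → g ∷ g ∷ w ≈ w
cancel g w = ≈-cong (rel-sq g) (≈-refl {w})

++-reverse : ∀ w → w ++ reverse w ≈ []
++-reverse [] = ≈-refl
++-reverse (g ∷ w) = subst (_≈ []) (cong (g ∷_) eq)
  (≈-trans (∷-cong g (≈-cong (++-reverse w) (≈-refl {g ∷ []}))) (rel-sq g))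
  where
  eq : (w ++ reverse w) ++ g ∷ [] ≡ w ++ reverse (g ∷ w)
  eq = trans (Listₚ.++-assoc w (reverse w) (g ∷ [])) (cong (w ++_) (sym (Listₚ.unfold-reverse g w)))

braid-≈ : ∀ {g k} → NonComm g k → g ∷ k ∷ g ∷ k ∷ [] ≈ k ∷ g ∷ k ∷ g ∷ []
braid-≈ (s-end end-r) = ≈-sym (braid-≈ (end-s end-r))
braid-≈ (s-end end-t) = ≈-trans (≈-cong (≈-refl {s ∷ t ∷ s ∷ t ∷ []})
  (≈-sym (++-reverse (s ∷ t ∷ s ∷ t ∷ []))))
                                (≈-cong rel-st (≈-refl {t ∷ s ∷ t ∷ s ∷ []}))
braid-≈ (end-s end-r) = ≈-trans (≈-cong (≈-refl {r ∷ s ∷ r ∷ s ∷ []})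
  (≈-sym (++-reverse (r ∷ s ∷ r ∷ s ∷ []))))
                                (≈-cong rel-rs (≈-refl {s ∷ r ∷ s ∷ r ∷ []}))
braid-≈ (end-s end-t) = ≈-sym (braid-≈ (s-end end-t))

bool? : (b : Bool) → (b ≡ true) ⊎ (b ≡ false)
bool? true  = inj₁ refl
bool? false = inj₂ refl

descent? : ∀ x → (x ≡ id₀) ⊎ Σ Gen λ g → desc g x ≡ true
descent? x with bool? (desc r x) | bool? (desc s x) | bool? (desc t x)
... | inj₁ p | _ | _ = inj₂ (r , p)
... | inj₂ _ | inj₁ p | _ = inj₂ (s , p)
... | inj₂ _ | inj₂ _ | inj₁ p = inj₂ (t , p)
... | inj₂ p | inj₂ q | inj₂ o = inj₁ (no-descents x p q o)

nfN : ℕ → Alcove → Word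
nfN zero    x = []
nfN (suc n) x with descent? x
... | inj₁ _       = []
... | inj₂ (g , _) = g ∷ nfN n (act g x)

nf : Alcove → Word
nf x = nfN (len x) x

nf-id₀ : nf id₀ ≡ []
nf-id₀ = cong (λ n → nfN n id₀) len-id₀

nf-step : ∀ x → (x ≡ id₀) ⊎ Σ Gen λ g → desc g x ≡ true × nf x ≡ g ∷ nf (act g x)
nf-step x = go (len x) refl
  where
  go : ∀ n → len x ≡ n → (x ≡ id₀) ⊎ Σ Gen λ g → desc g x ≡ true × nfN n x ≡ g ∷ nf (act g x)
  go zero e with descent? x
  ... | inj₁ p = inj₁ p
  ... | inj₂ (g , p) = ⊥-elim (ℕₚ.1+n≢0 (trans (len-down g x p) e))
  go (suc n) e with descent? x
  ... | inj₁ p = inj₁ p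
  ... | inj₂ (g , p) = inj₂ (g , p , cong (λ m → g ∷ nfN m (act g x))
                                         (sym (ℕₚ.suc-injective (trans (len-down g x p) e))))

len-< : ∀ g {x} → desc g x ≡ true → len (act g x) < len x
len-< g {x} p = ℕₚ.≤-reflexive (len-down g x p)

-- If `nf x` begins with k, then g and k are both descents of x, so x begins with the longest
-- element of ⟨g, k⟩. By induction both sides can be rewritten to begin with it, and one defining
-- relation exchanges its two expressions.
nf-desc : ∀ n x → len x < n → ∀ g → desc g x ≡ true → nf x ≈ g ∷ nf (act g x)
nf-desc (suc n) x (s≤s x≤n) g p with nf-step x
... | inj₁ refl = ⊥-elim (true≢false p (desc-id₀ g))
... | inj₂ (k , q , eq) = subst (_≈ g ∷ nf (act g x)) (sym eq) (by (pair g k) p q)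
  where
  smaller : ∀ {g y} → desc g y ≡ true → len y ≤ n → len (act g y) < n
  smaller {g} p b = ℕₚ.<-≤-trans (len-< g p) b
  by : ∀ {g k} → Pair g k → desc g x ≡ true → desc k x ≡ true → k ∷ nf (act k x) ≈ g ∷ nf (act g x)
  by same _ _ = ≈-refl
  by {g} {k} (comm c dg dk ceq) p q =
    ≈-trans (∷-cong k (nf-desc n (act k x) (smaller q x≤n) g (trans (dg x) p)))
   (≈-trans (≈-cong (≈-sym ceq) (≈-refl {nf (act g (act k x))}))
   (subst (λ y → g ∷ k ∷ nf y ≈ g ∷ nf (act g x)) (sym (c x))
     (∷-cong g (≈-sym (nf-desc n (act g x) (smaller p x≤n) k (trans (dk x) q))))))
  by {g} {k} (noncomm nc) p q =
    ≈-trans (chain nc p q)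
   (≈-trans (≈-cong (≈-sym (braid-≈ nc)) (≈-refl {nf (act g (act k (act g (act k x))))}))
   (subst (λ y → g ∷ k ∷ g ∷ k ∷ nf y ≈ g ∷ nf (act g x)) (sym (nc-braid nc x))
     (≈-sym (chain (flipNC nc) q p))))
    where
    flipNC : ∀ {g k} → NonComm g k → NonComm k g
    flipNC (s-end e) = end-s e
    flipNC (end-s e) = s-end e
    chain : ∀ {g k} → NonComm g k → desc g x ≡ true → desc k x ≡ true →
            k ∷ nf (act k x) ≈ k ∷ g ∷ k ∷ g ∷ nf (act g (act k (act g (act k x))))
    chain {g} {k} nc p q with nc-dihedral nc x p q
    ... | d₁ , d₂ , d₃ = ∷-cong k (≈-trans (nf-desc n _ l₁ g d₁) (∷-cong g
                          (≈-trans (nf-desc n _ l₂ k d₂) (∷-cong k (nf-desc n _ l₃ g d₃)))))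
      where
      l₁ = smaller q x≤n
      l₂ = smaller d₁ (ℕₚ.<⇒≤ l₁)
      l₃ = smaller d₂ (ℕₚ.<⇒≤ l₂)

nf-act : ∀ g x → g ∷ nf x ≈ nf (act g x)
nf-act g x with bool? (desc g x)
... | inj₁ p = ≈-trans (∷-cong g (nf-desc _ x (ℕₚ.n<1+n _) g p)) (cancel g _)
... | inj₂ p = ≈-sym (subst (λ y → nf (act g x) ≈ g ∷ nf y) (act-invol g x)
                 (nf-desc _ (act g x) (ℕₚ.n<1+n _) g (trans (desc-act g x) (cong not p))))

nf-pt : ∀ w → w ≈ nf (pt w)
nf-pt []      = subst ([] ≈_) (sym nf-id₀) ≈-refl
nf-pt (g ∷ w) = ≈-trans (∷-cong g (nf-pt w)) (nf-act g (pt w))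

pt-nf : ∀ x → pt (nf x) ≡ x
pt-nf x = go (suc (len x)) x (ℕₚ.n<1+n _)
  where
  go : ∀ n x → len x < n → pt (nf x) ≡ x
  go (suc n) x (s≤s b) with nf-step x
  ... | inj₁ refl = cong pt nf-id₀
  ... | inj₂ (g , p , eq) = trans (cong pt eq)
          (trans (cong (act g) (go n (act g x) (ℕₚ.<-≤-trans (len-< g p) b))) (act-invol g x))

length-nf : ∀ x → length (nf x) ≡ len x
length-nf x = go (suc (len x)) x (ℕₚ.n<1+n _)
  where
  go : ∀ n x → len x < n → length (nf x) ≡ len x
  go (suc n) x (s≤s b) with nf-step x
  ... | inj₁ refl = trans (cong length nf-id₀) (sym len-id₀)
  ... | inj₂ (g , p , eq) = trans (cong length eq)
          (trans (cong suc (go n (act g x) (ℕₚ.<-≤-trans (len-< g p) b))) (len-down g x p))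

-- The action is free. Together with `pt-≈` this turns `_≈_` into equality of alcoves, which is
-- decidable.
pt-injective : ∀ {u v} → pt u ≡ pt v → u ≈ v
pt-injective {u} {v} e = ≈-trans (nf-pt u) (subst (λ x → nf x ≈ v) (sym e) (≈-sym (nf-pt v)))

pt-≈ : ∀ {u v} → u ≈ v → pt u ≡ pt v
pt-≈ p = run-≈ p id₀

len-act≤ : ∀ g x → len (act g x) ≤ suc (len x)
len-act≤ g x with bool? (desc g x)
... | inj₁ p = ℕₚ.≤-trans (ℕₚ.n≤1+n _) (ℕₚ.≤-trans (ℕₚ.≤-reflexive (len-down g x p)) (ℕₚ.n≤1+n _))
... | inj₂ p = ℕₚ.≤-reflexive (len-up g x p)

len≤length : ∀ w → len (pt w) ≤ length w
len≤length []      = ℕₚ.≤-reflexive len-id₀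
len≤length (g ∷ w) = ℕₚ.≤-trans (len-act≤ g (pt w)) (s≤s (len≤length w))

reduced⇒len : ∀ {w} → Reduced w → length w ≡ len (pt w)
reduced⇒len {w} red = ℕₚ.≤-antisym
  (subst (length w ≤_) (length-nf (pt w)) (red (nf (pt w)) (≈-sym (nf-pt w))))
  (len≤length w)

len⇒reduced : ∀ {w} → length w ≡ len (pt w) → Reduced w
len⇒reduced {w} e v v≈w = subst₂ _≤_ (trans (cong len (pt-≈ v≈w)) (sym e)) refl (len≤length v)

nf-reduced : ∀ x → Reduced (nf x)
nf-reduced x = len⇒reduced (trans (length-nf x) (cong len (sym (pt-nf x))))

length⇒len : ∀ {w n} → Length w n → n ≡ len (pt w)
length⇒len (v , v≈w , red , refl) = trans (reduced⇒len red) (cong len (pt-≈ v≈w))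

len⇒length : ∀ w → Length w (len (pt w))
len⇒length w = nf (pt w) , ≈-sym (nf-pt w) , nf-reduced (pt w) , length-nf (pt w)

reduced-∷⇒ : ∀ {g w} → Reduced (g ∷ w) → Reduced w × desc g (pt w) ≡ false
reduced-∷⇒ {g} {w} red = len⇒reduced eq , nd
  where
  full : suc (length w) ≡ len (act g (pt w))
  full = reduced⇒len red
  eq : length w ≡ len (pt w)
  eq = ℕₚ.≤-antisym (ℕₚ.≤-pred (subst (_≤ suc (len (pt w))) (sym full) (len-act≤ g (pt w))))
    (len≤length w)
  nd : desc g (pt w) ≡ false
  nd with bool? (desc g (pt w))
  ... | inj₂ p = p
  ... | inj₁ p = ⊥-elim (ℕₚ.<-irrefl (trans (sym full) (cong suc eq))
    (ℕₚ.<-trans (len-< g p) (ℕₚ.n<1+n _)))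

reduced-∷⇐ : ∀ {g w} → Reduced w → desc g (pt w) ≡ false → Reduced (g ∷ w)
reduced-∷⇐ {g} {w} red p = len⇒reduced (trans (cong suc (reduced⇒len red)) (sym (len-up g (pt w) p)))

¬reduced-∷ : ∀ {g w} → desc g (pt w) ≡ true → ¬ Reduced (g ∷ w)
¬reduced-∷ p red = true≢false p (proj₂ (reduced-∷⇒ red))

-- Galleries, walls and the strong exchange condition

-- Right multiplication by h.
R : Gen → Alcove → Alcove
R h x = run (nf x) (act h id₀)

R-pt : ∀ h w → R h (pt w) ≡ pt (w ++ h ∷ [])
R-pt h w = trans (run-≈ (≈-sym (nf-pt w)) (act h id₀)) (sym (run-++ w (h ∷ []) id₀))

R-id₀ : ∀ h → R h id₀ ≡ act h id₀
R-id₀ h = cong (λ w → run w (act h id₀)) nf-id₀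

R-act : ∀ h g x → R h (act g x) ≡ act g (R h x)
R-act h g x = sym (run-≈ (nf-act g x) (act h id₀))

R-invol : ∀ h x → R h (R h x) ≡ x
R-invol h x = begin
  R h (R h x)                           ≡⟨ cong (λ y → R h (R h y)) (sym (pt-nf x)) ⟩
  R h (R h (pt (nf x)))                 ≡⟨ cong (R h) (R-pt h (nf x)) ⟩
  R h (pt (nf x ++ h ∷ []))             ≡⟨ R-pt h (nf x ++ h ∷ []) ⟩
  pt ((nf x ++ h ∷ []) ++ h ∷ [])       ≡⟨ cong pt (Listₚ.++-assoc (nf x) (h ∷ []) (h ∷ [])) ⟩
  pt (nf x ++ h ∷ h ∷ [])               ≡⟨ pt-≈ (≈-cong (≈-refl {nf x}) (rel-sq h)) ⟩
  pt (nf x ++ [])                       ≡⟨ cong pt (Listₚ.++-identityʳ (nf x)) ⟩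
  pt (nf x)                             ≡⟨ pt-nf x ⟩
  x ∎
  where open ≡-Reasoning

len-R≤ : ∀ h x → len (R h x) ≤ suc (len x)
len-R≤ h x = begin
  len (R h x)                    ≡⟨ cong (λ y → len (R h y)) (sym (pt-nf x)) ⟩
  len (R h (pt (nf x)))          ≡⟨ cong len (R-pt h (nf x)) ⟩
  len (pt (nf x ++ h ∷ []))      ≤⟨ len≤length (nf x ++ h ∷ []) ⟩
  length (nf x ++ h ∷ [])        ≡⟨ Listₚ.length-++ (nf x) ⟩
  length (nf x) ℕ.+ 1              ≡⟨ ℕₚ.+-comm _ 1 ⟩
  suc (length (nf x))            ≡⟨ cong suc (length-nf x) ⟩
  suc (len x)                    ∎
  where open ℕₚ.≤-Reasoning

-- Adjacent alcoves separated by the wall of g are mirror images in it. A descent k of x is also one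
-- of xh, because xh is longer than x. If k and g commute, it is stripped from both. Otherwise xh
-- begins with the longest element of ⟨g, k⟩, and x is followed down that element until induction
-- applies.
folding : ∀ h n x → len x < n → ∀ g → desc g x ≡ false → desc g (R h x) ≡ true → act g x ≡ R h x
folding h (suc n) x (s≤s x≤n) g p q with descent? x
... | inj₁ refl = trans (cong (λ k → act k id₀) (desc-act-id₀ g h
  (subst (λ y → desc g y ≡ true) (R-id₀ h) q))) (sym (R-id₀ h))
... | inj₂ (k , kx) = by (pair g k) p q kx kRx
  where
  x₁ = act k x
  lenRx : suc (len x) ≤ len (R h x)
  lenRx = begin
    suc (len x)               ≡⟨ len-up g x p ⟨
    len (act g x)             ≡⟨ cong len (R-invol h (act g x)) ⟨
    len (R h (R h (act g x))) ≤⟨ len-R≤ h (R h (act g x)) ⟩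
    suc (len (R h (act g x))) ≡⟨ cong (λ y → suc (len y)) (R-act h g x) ⟩
    suc (len (act g (R h x))) ≡⟨ len-down g (R h x) q ⟩
    len (R h x)               ∎
    where open ℕₚ.≤-Reasoning
  kRx : desc k (R h x) ≡ true
  kRx with bool? (desc k (R h x))
  ... | inj₁ e = e
  ... | inj₂ e = ⊥-elim (ℕₚ.<-irrefl refl (begin-strict
    len x                 <⟨ lenRx ⟩
    len (R h x)           <⟨ ℕₚ.≤-reflexive (sym (len-up k (R h x) e)) ⟩
    len (act k (R h x))   ≡⟨ cong len (R-act h k x) ⟨
    len (R h x₁)          ≤⟨ len-R≤ h x₁ ⟩
    suc (len x₁)          ≡⟨ len-down k x kx ⟩
    len x                 ∎))
    where open ℕₚ.≤-Reasoning
  flipped : ∀ k {y} → desc k y ≡ true → desc k (act k y) ≡ false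
  flipped k {y} e = trans (desc-act k y) (cong not e)
  by : ∀ {g k} → Pair g k → desc g x ≡ false → desc g (R h x) ≡ true → desc k x ≡ true →
       desc k (R h x) ≡ true → act g x ≡ R h x
  by same p q kx _ = ⊥-elim (true≢false kx p)
  by {g} {k} (comm c dg dk _) p q kx kRx = begin
    act g x                     ≡⟨ act-invol k (act g x) ⟨
    act k (act k (act g x))     ≡⟨ cong (act k) (sym (c x)) ⟩
    act k (act g (act k x))     ≡⟨ cong (act k) (folding h n (act k x) (ℕₚ.<-≤-trans (len-< k kx) x≤n) g
                                     (trans (dg x) p) (trans (cong (desc g) (R-act h k x))
                                       (trans (dg (R h x)) q))) ⟩
    act k (R h (act k x))       ≡⟨ cong (act k) (R-act h k x) ⟩
    act k (act k (R h x))       ≡⟨ act-invol k (R h x) ⟩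
    R h x                       ∎
    where open ≡-Reasoning
  by {g} {k} (noncomm nc) p q kx kRx with nc-dihedral nc (R h x) q kRx
  ... | d₁ , d₂ , d₃ = step₁
    where
    y₁ = act k x
    y₂ = act g y₁
    y₃ = act k y₂
    Ry₁ : R h y₁ ≡ act k (R h x)
    Ry₁ = R-act h k x
    Ry₂ : R h y₂ ≡ act g (act k (R h x))
    Ry₂ = trans (R-act h g y₁) (cong (act g) Ry₁)
    Ry₃ : R h y₃ ≡ act k (act g (act k (R h x)))
    Ry₃ = trans (R-act h k y₂) (cong (act k) Ry₂)
    open ≡-Reasoning
    l₁ : len y₁ < n
    l₁ = ℕₚ.<-≤-trans (len-< k kx) x≤n
    step₃ : desc g y₁ ≡ true → desc k y₂ ≡ true → act g x ≡ R h x
    step₃ e₁ e₂ with bool? (desc g y₃)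
    -- Here x begins with kgkg = gkgk, so g would shorten it.
    ... | inj₁ e₃ = ⊥-elim (ℕₚ.<-irrefl refl (ℕₚ.<-trans small big))
      where
      y₄ = act g y₃
      unwind : x ≡ act k (act g (act k (act g y₄)))
      unwind = sym (trans (cong (λ y → act k (act g (act k y))) (act-invol g y₃))
                   (trans (cong (λ y → act k (act g y)) (act-invol k y₂))
                   (trans (cong (act k) (act-invol g y₁)) (act-invol k x))))
      gx : act g x ≡ act k (act g (act k y₄))
      gx = trans (cong (act g) (trans unwind (sym (nc-braid nc y₄)))) (act-invol g _)
      len4 : 4 ℕ.+ len y₄ ≡ len x
      len4 = trans (cong (3 ℕ.+_) (len-down g y₃ e₃)) (trans (cong (2 ℕ.+_) (len-down k y₂ e₂))
             (trans (cong suc (len-down g y₁ e₁)) (len-down k x kx)))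
      small : len (act g x) < len x
      small = subst₂ _<_ (cong len (sym gx)) len4 (s≤s (ℕₚ.≤-trans (len-act≤ k _)
                (s≤s (ℕₚ.≤-trans (len-act≤ g _) (s≤s (len-act≤ k y₄))))))
      big : len x < len (act g x)
      big = ℕₚ.≤-reflexive (sym (len-up g x p))
    ... | inj₂ e₃ = begin
      act g x                                    ≡⟨ cong (act g) unwind ⟩
      act g (act k (act g (act k y₃)))           ≡⟨ nc-braid nc y₃ ⟩
      act k (act g (act k (act g y₃)))           ≡⟨ cong (λ y → act k (act g (act k y))) ih ⟩
      act k (act g (act k (R h y₃)))             ≡⟨ cong (λ y → act k (act g (act k y))) Ry₃ ⟩
      act k (act g (act k (act k (act g (act k (R h x))))))
                                                 ≡⟨ cong (λ y → act k (act g y)) (act-invol k _) ⟩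
      act k (act g (act g (act k (R h x))))      ≡⟨ cong (act k) (act-invol g _) ⟩
      act k (act k (R h x))                      ≡⟨ act-invol k _ ⟩
      R h x                                      ∎
      where
      unwind : x ≡ act k (act g (act k y₃))
      unwind = sym (trans (cong (λ y → act k (act g y)) (act-invol k y₂))
                   (trans (cong (act k) (act-invol g y₁)) (act-invol k x)))
      ih : act g y₃ ≡ R h y₃
      ih = folding h n y₃ (ℕₚ.<-trans (len-< k e₂) (ℕₚ.<-trans (len-< g e₁) l₁)) g e₃
             (trans (cong (desc g) Ry₃) d₃)
    step₂ : desc g y₁ ≡ true → act g x ≡ R h x
    step₂ e₁ with bool? (desc k y₂)
    ... | inj₁ e₂ = step₃ e₁ e₂
    -- Folding at `y₂` makes it equal to kgk(xh), of which g is a descent by `d₃`; but `y₂` is g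
    -- `y₁`, from which g has just been removed.
    ... | inj₂ e₂ = ⊥-elim (true≢false (trans (cong (desc g) y₂≡) d₃) (flipped g e₁))
      where
      ih : act k y₂ ≡ R h y₂
      ih = folding h n y₂ (ℕₚ.<-trans (len-< g e₁) l₁) k e₂ (trans (cong (desc k) Ry₂) d₂)
      y₂≡ : y₂ ≡ act k (act g (act k (R h x)))
      y₂≡ = trans (sym (act-invol k y₂)) (cong (act k) (trans ih Ry₂))
    step₁ : act g x ≡ R h x
    step₁ with bool? (desc g y₁)
    ... | inj₁ e₁ = step₂ e₁
    ... | inj₂ e₁ = ⊥-elim (true≢false (trans (cong (desc k) y₁≡) d₂) (flipped k kx))
      where
      ih : act g y₁ ≡ R h y₁
      ih = folding h n y₁ l₁ g e₁ (trans (cong (desc g) Ry₁) d₁)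
      y₁≡ : y₁ ≡ act g (act k (R h x))
      y₁≡ = trans (sym (act-invol g y₁)) (cong (act g) (trans ih Ry₁))

infixl 5 _▹_
-- The end of the gallery of type v that starts at x: right multiplication passes to an adjacent
-- alcove.
_▹_ : Alcove → Word → Alcove
x ▹ []      = x
x ▹ (k ∷ v) = R k x ▹ v

act-▹ : ∀ g x v → act g x ▹ v ≡ act g (x ▹ v)
act-▹ g x []      = refl
act-▹ g x (k ∷ v) = trans (cong (_▹ v) (R-act k g x)) (act-▹ g (R k x) v)

run-▹ : ∀ w x v → run w x ▹ v ≡ run w (x ▹ v)
run-▹ []      x v = refl
run-▹ (g ∷ w) x v = trans (act-▹ g (run w x) v) (cong (act g) (run-▹ w x v))

id-▹ : ∀ v → id₀ ▹ v ≡ pt v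
id-▹ []      = refl
id-▹ (k ∷ v) = trans (cong (_▹ v) (R-id₀ k)) (trans (act-▹ k id₀ v) (cong (act k) (id-▹ v)))

run-reverse : ∀ w x → run (reverse w) (run w x) ≡ x
run-reverse w x = trans (sym (run-++ (reverse w) w x)) (run-≈ rev x)
  where
  rev : reverse w ++ w ≈ []
  rev = subst (λ v → reverse w ++ v ≈ []) (Listₚ.reverse-involutive w) (++-reverse (reverse w))

run-reverse′ : ∀ w x → run w (run (reverse w) x) ≡ x
run-reverse′ w x = trans (sym (run-++ w (reverse w) x)) (run-≈ (++-reverse w) x)

-- The reflection in the wall y·H_h, and the side of that wall on which an alcove lies.
reflect : Word → Gen → Alcove → Alcove
reflect y h x = run y (act h (run (reverse y) x))

side : Word → Gen → Alcove → Bool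
side y h x = desc h (run (reverse y) x)

reflect-invol : ∀ y h x → reflect y h (reflect y h x) ≡ x
reflect-invol y h x = trans (cong (λ z → run y (act h z)) (run-reverse y _))
                     (trans (cong (run y) (act-invol h _)) (run-reverse′ y x))

side-reflect : ∀ y h x → side y h (reflect y h x) ≡ not (side y h x)
side-reflect y h x = trans (cong (desc h) (run-reverse y _)) (desc-act h _)

run-R : ∀ w k x → R k (run w x) ≡ run w (R k x)
run-R w k x = run-▹ w x (k ∷ [])

reflect-▹ : ∀ y h x v → reflect y h (x ▹ v) ≡ reflect y h x ▹ v
reflect-▹ y h x v = sym (trans (run-▹ y _ v) (cong (run y)
  (trans (act-▹ h _ v) (cong (act h) (run-▹ (reverse y) x v)))))

-- Transported by y⁻¹ the wall becomes that of h, and `folding` applies to whichever of the two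
-- alcoves lies on the side of `id₀`.
crossing : ∀ y h k x → side y h x ≢ side y h (R k x) → reflect y h x ≡ R k x
crossing y h k x ne = trans (cong (run y) fold) (trans (cong (run y) (run-R (reverse y) k x))
  (run-reverse′ y (R k x)))
  where
  z = run (reverse y) x
  Rz : run (reverse y) (R k x) ≡ R k z
  Rz = sym (run-R (reverse y) k x)
  fold : act h z ≡ R k z
  fold with bool? (desc h z) | bool? (desc h (R k z))
  ... | inj₁ p | inj₁ q = ⊥-elim (ne (trans p (sym (trans (cong (desc h) Rz) q))))
  ... | inj₂ p | inj₂ q = ⊥-elim (ne (trans p (sym (trans (cong (desc h) Rz) q))))
  ... | inj₂ p | inj₁ q = folding k _ z (ℕₚ.n<1+n _) h p q
  ... | inj₁ p | inj₂ q = trans (cong (act h) (trans (sym (R-invol k z)) (sym back)))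
    (act-invol h (R k z))
    where
    back : act h (R k z) ≡ R k (R k z)
    back = folding k _ (R k z) (ℕₚ.n<1+n _) h q (trans (cong (desc h) (R-invol k z)) p)

-- Strong exchange: the gallery must cross the wall at some letter, and reflecting everything behind
-- the first crossing amounts to dropping that letter.
exchange : ∀ y h x v → side y h x ≢ side y h (x ▹ v) →
           Σ Word λ a → Σ Gen λ k → Σ Word λ b → v ≡ a ++ k ∷ b × reflect y h (x ▹ v) ≡ x ▹ (a ++ b)
exchange y h x [] ne = ⊥-elim (ne refl)
exchange y h x (k ∷ v) ne with side y h x Boolₚ.≟ side y h (R k x)
... | no ne₁ = [] , k , v , refl , trans (reflect-▹ y h (R k x) v) (cong (_▹ v)
       (trans (cong (reflect y h) (sym (crossing y h k x ne₁))) (reflect-invol y h x)))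
... | yes eq with exchange y h (R k x) v (λ e → ne (trans eq e))
...   | a , j , b , eq₁ , eq₂ = k ∷ a , j , b , cong (k ∷_) eq₁ , eq₂

reflect-< : ∀ y h x → side y h id₀ ≢ side y h x → len (reflect y h x) < len x
reflect-< y h x ne with exchange y h id₀ (nf x) (λ e → ne (trans e (cong (side y h) id-▹-nf)))
  where
  id-▹-nf : id₀ ▹ nf x ≡ x
  id-▹-nf = trans (id-▹ (nf x)) (pt-nf x)
... | a , k , b , eq₁ , eq₂ = begin-strict
  len (reflect y h x)             ≡⟨ cong (λ z → len (reflect y h z))
    (sym (trans (id-▹ (nf x)) (pt-nf x))) ⟩
  len (reflect y h (id₀ ▹ nf x))  ≡⟨ cong len (trans eq₂ (id-▹ (a ++ b))) ⟩
  len (pt (a ++ b))               ≤⟨ len≤length (a ++ b) ⟩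
  length (a ++ b)                 <⟨ ℕₚ.≤-reflexive (drop a) ⟩
  length (a ++ k ∷ b)             ≡⟨ cong length eq₁ ⟨
  length (nf x)                   ≡⟨ length-nf x ⟩
  len x                           ∎
  where
  open ℕₚ.≤-Reasoning
  drop : ∀ a → suc (length (a ++ b)) ≡ length (a ++ k ∷ b)
  drop []      = refl
  drop (_ ∷ a) = cong suc (drop a)

reflect-> : ∀ y h x → side y h id₀ ≡ side y h x → len x < len (reflect y h x)
reflect-> y h x eq = subst (λ z → len z < len (reflect y h x)) (reflect-invol y h x)
  (reflect-< y h (reflect y h x) (λ e → not-fixed (side y h x)
    (trans (trans (sym eq) e) (side-reflect y h x))))
  where
  not-fixed : ∀ b → b ≡ not b → ⊥
  not-fixed false ()
  not-fixed true ()

reflect-conj : ∀ g y h x → reflect (g ∷ y) h x ≡ act g (reflect y h (act g x))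
reflect-conj g y h x = cong (λ v → act g (run y (act h v)))
  (trans (cong (λ w → run w x) (Listₚ.unfold-reverse g y)) (run-++ (reverse y) (g ∷ []) x))

-- Let ρ be the reflection. Exchange for gρg and the word of gx drops one letter. If it is the
-- leading g, then gρx = x, as claimed; if it is a later one, ρx has an expression shorter than x,
-- against the hypothesis.
reflect-fold : ∀ y h g x → len x < len (reflect y h x) → desc g x ≡ false →
               len (act g (reflect y h x)) < len (act g x) → act g x ≡ reflect y h x
reflect-fold y h g x up gx down = conclude (exchange (g ∷ y) h id₀ (g ∷ nf x) ne)
  where
  whole : id₀ ▹ (g ∷ nf x) ≡ act g x
  whole = trans (id-▹ (g ∷ nf x)) (cong (act g) (pt-nf x))
  conj-gx : reflect (g ∷ y) h (id₀ ▹ (g ∷ nf x)) ≡ act g (reflect y h x)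
  conj-gx = trans (cong (reflect (g ∷ y) h) whole) (trans (reflect-conj g y h (act g x))
              (cong (λ z → act g (reflect y h z)) (act-invol g x)))
  ne : side (g ∷ y) h id₀ ≢ side (g ∷ y) h (id₀ ▹ (g ∷ nf x))
  ne e = ℕₚ.<-asym down (subst₂ _<_ (cong len whole) (cong len conj-gx)
           (reflect-> (g ∷ y) h (id₀ ▹ (g ∷ nf x)) e))
  conclude : (Σ Word λ a → Σ Gen λ k → Σ Word λ b → g ∷ nf x ≡ a ++ k ∷ b ×
              reflect (g ∷ y) h (id₀ ▹ (g ∷ nf x)) ≡ id₀ ▹ (a ++ b)) → act g x ≡ reflect y h x
  conclude ([] , k , b , refl , eq) =
    trans (cong (act g) (sym (trans (sym conj-gx) (trans eq (trans (id-▹ (nf x)) (pt-nf x))))))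
          (act-invol g _)
  conclude (_ ∷ a , k , b , eq₁ , eq) with Listₚ.∷-injective eq₁
  ... | refl , eq₂ = ⊥-elim (ℕₚ.<-asym up (begin-strict
    len (reflect y h x)  ≡⟨ cong len (sym (act-invol g _)) ⟩
    len (act g (act g (reflect y h x))) ≡⟨ cong (λ z → len (act g z))
      (trans (sym conj-gx) (trans eq (id-▹ (g ∷ a ++ b)))) ⟩
    len (act g (act g (pt (a ++ b)))) ≡⟨ cong len (act-invol g _) ⟩
    len (pt (a ++ b))    ≤⟨ len≤length (a ++ b) ⟩
    length (a ++ b)      <⟨ ℕₚ.≤-reflexive (drop a) ⟩
    length (a ++ k ∷ b)  ≡⟨ cong length eq₂ ⟨
    length (nf x)        ≡⟨ length-nf x ⟩
    len x                ∎))
    where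
    open ℕₚ.≤-Reasoning
    drop : ∀ a → suc (length (a ++ b)) ≡ length (a ++ k ∷ b)
    drop []      = refl
    drop (_ ∷ a) = cong suc (drop a)

-- Bruhat order

≤B-step′ : ∀ {u v w} → u ≤B v → ∀ y h → pt w ≡ reflect y h (pt v) → len (pt v) < len (pt w) → u ≤B w
≤B-step′ {u} {v} {w} u≤v y h eq lt = ≤B-step (reverse v ++ y) h u≤v (pt-injective (trans eq (sym calc)))
    (len (pt v) , len (pt w) , len⇒length v , len⇒length w , lt)
  where
  open ≡-Reasoning
  calc : pt (v ++ reflection (reverse v ++ y) h) ≡ reflect y h (pt v)
  calc = begin
    pt (v ++ (reverse v ++ y) ++ h ∷ reverse (reverse v ++ y))
      ≡⟨ trans (run-++ v _ id₀) (cong (run v) (trans (run-++ (reverse v ++ y) _ id₀)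
        (run-++ (reverse v) y _))) ⟩
    run v (run (reverse v) (run y (act h (pt (reverse (reverse v ++ y))))))
      ≡⟨ run-reverse′ v _ ⟩
    run y (act h (pt (reverse (reverse v ++ y))))
      ≡⟨ cong (λ z → run y (act h (pt z))) (trans (Listₚ.reverse-++ (reverse v) y)
        (cong (reverse y ++_) (Listₚ.reverse-involutive v))) ⟩
    run y (act h (pt (reverse y ++ v)))
      ≡⟨ cong (λ z → run y (act h z)) (run-++ (reverse y) v id₀) ⟩
    reflect y h (pt v) ∎

step-reflect : ∀ {v w} x h → w ≈ v ++ reflection x h → pt w ≡ reflect (v ++ x) h (pt v)
step-reflect {v} {w} x h eq = begin
  pt w                                                    ≡⟨ pt-≈ eq ⟩
  pt (v ++ x ++ h ∷ reverse x)                            ≡⟨ trans (run-++ v _ id₀)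
    (cong (run v) (run-++ x _ id₀)) ⟩
  run v (run x (act h (pt (reverse x))))                  ≡⟨ run-++ v x _ ⟨
  run (v ++ x) (act h (pt (reverse x)))                   ≡⟨ cong
    (λ z → run (v ++ x) (act h (run (reverse x) z))) (run-reverse v id₀) ⟨
  run (v ++ x) (act h (run (reverse x) (run (reverse v) (pt v)))) ≡⟨ cong
    (λ z → run (v ++ x) (act h z)) (run-++ (reverse x) (reverse v) (pt v)) ⟨
  run (v ++ x) (act h (run (reverse x ++ reverse v) (pt v))) ≡⟨ cong
    (λ z → run (v ++ x) (act h (run z (pt v)))) (Listₚ.reverse-++ v x) ⟨
  reflect (v ++ x) h (pt v)                               ∎
  where open ≡-Reasoning

lengthLt⇒ : ∀ {v w} → LengthLt v w → len (pt v) < len (pt w)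
lengthLt⇒ (m , n , lv , lw , lt) = subst₂ _<_ (length⇒len lv) (length⇒len lw) lt

≤B-trans : ∀ {u v w} → u ≤B v → v ≤B w → u ≤B w
≤B-trans p (≤B-refl e) = ≤B-resp p e
  where
  ≤B-resp : ∀ {u v w} → u ≤B v → v ≈ w → u ≤B w
  ≤B-resp (≤B-refl e) e′ = ≤B-refl (≈-trans e e′)
  ≤B-resp {w = w} (≤B-step {v = v} x g p eq lt) e′ =
    ≤B-step x g p (≈-trans (≈-sym e′) eq) (len (pt v) , len (pt w) , len⇒length v , len⇒length w ,
      subst (λ z → len (pt v) < len z) (pt-≈ e′) (lengthLt⇒ lt))
≤B-trans p (≤B-step x g q eq lt) = ≤B-step x g (≤B-trans p q) eq lt

≤B-len : ∀ {u w} → u ≤B w → (pt u ≡ pt w) ⊎ (len (pt u) < len (pt w))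
≤B-len (≤B-refl e) = inj₁ (pt-≈ e)
≤B-len (≤B-step x g p eq lt) with ≤B-len p
... | inj₁ e = inj₂ (subst (_< _) (cong len (sym e)) (lengthLt⇒ lt))
... | inj₂ l = inj₂ (ℕₚ.<-trans l (lengthLt⇒ lt))

≤B-act : ∀ g v → desc g (pt v) ≡ false → v ≤B g ∷ v
≤B-act g v p = ≤B-step′ (≤B-refl ≈-refl) [] g refl (ℕₚ.≤-reflexive (sym (len-up g (pt v) p)))

-- Left multiplication by g carries a step v < b of the Bruhat chain to a step between gv and gb. If
-- gv > v and this step points downwards, `reflect-fold` identifies gv with b.
≤B-lift : ∀ g {a b} → a ≤B b → (g ∷ a ≤B b) ⊎ (g ∷ a ≤B g ∷ b)
≤B-lift g (≤B-refl e) = inj₂ (≤B-refl (∷-cong g e))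
≤B-lift g {a} {b} (≤B-step {v = v} x h p eq lt) with ≤B-lift g p
... | inj₁ q = inj₁ (≤B-step x h q eq lt)
... | inj₂ q with bool? (desc g (pt v))
...   | inj₁ gv = inj₁ (≤B-step x h (≤B-trans q gv≤v) eq lt)
  where
  gv≤v : g ∷ v ≤B v
  gv≤v = ≤B-step′ (≤B-refl ≈-refl) [] g (sym (act-invol g (pt v))) (len-< g gv)
...   | inj₂ gv with side ((g ∷ v) ++ x) h id₀ Boolₚ.≟ side ((g ∷ v) ++ x) h (pt (g ∷ v))
...     | yes e = inj₂ (≤B-step′ q ((g ∷ v) ++ x) h gb
                    (subst (len (pt (g ∷ v)) <_) (cong len (sym gb))
                      (reflect-> ((g ∷ v) ++ x) h (pt (g ∷ v)) e)))
  where
  gb : pt (g ∷ b) ≡ reflect ((g ∷ v) ++ x) h (pt (g ∷ v))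
  gb = step-reflect {g ∷ v} {g ∷ b} x h (∷-cong g eq)
...     | no ne = inj₁ (≤B-trans q (≤B-refl (pt-injective (trans folded (sym pb)))))
  where
  pb : pt b ≡ reflect (v ++ x) h (pt v)
  pb = step-reflect {v} {b} x h eq
  gb : pt (g ∷ b) ≡ reflect ((g ∷ v) ++ x) h (pt (g ∷ v))
  gb = step-reflect {g ∷ v} {g ∷ b} x h (∷-cong g eq)
  folded : act g (pt v) ≡ reflect (v ++ x) h (pt v)
  folded = reflect-fold (v ++ x) h g (pt v) (subst (λ z → len (pt v) < len z) pb (lengthLt⇒ lt)) gv
    (subst (λ z → len z < len (act g (pt v))) (trans (sym gb) (cong (act g) pb))
      (reflect-< ((g ∷ v) ++ x) h (pt (g ∷ v)) ne))

-- Used contrapositively: for y not below gx, the polynomial P_{gy,x} in the recursion vanishes as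
-- well.
≤B-lift-up : ∀ g {a v} → desc g (pt v) ≡ false → g ∷ a ≤B v → a ≤B g ∷ v
≤B-lift-up g {a} {v} p q with ≤B-lift g q
... | inj₁ l = ≤B-trans (≤B-refl (≈-sym (cancel g a))) (≤B-trans l (≤B-act g v p))
... | inj₂ l = ≤B-trans (≤B-refl (≈-sym (cancel g a))) l

-- Finite sums

∑ : {X : Set} → List X → (X → ℤ) → ℤ
∑ xs f = sumℤ (map f xs)

∑-cong : {X : Set} (xs : List X) {f g : X → ℤ} → (∀ x → f x ≡ g x) → ∑ xs f ≡ ∑ xs g
∑-cong []       e = refl
∑-cong (x ∷ xs) e = cong₂ _+_ (e x) (∑-cong xs e)

∑-zero : {X : Set} (xs : List X) {f : X → ℤ} → (∀ x → f x ≡ 0ℤ) → ∑ xs f ≡ 0ℤ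
∑-zero []       e = refl
∑-zero (x ∷ xs) e = trans (cong₂ _+_ (e x) (∑-zero xs e)) refl

∑-+ : {X : Set} (xs : List X) (f g : X → ℤ) → ∑ xs (λ x → f x + g x) ≡ ∑ xs f + ∑ xs g
∑-+ []       f g = refl
∑-+ (x ∷ xs) f g = trans (cong (λ z → f x + g x + z) (∑-+ xs f g)) (lemma (f x) (g x) (∑ xs f) (∑ xs g))
  where
  lemma : ∀ a b c d → a + b + (c + d) ≡ (a + c) + (b + d)
  lemma = solve-∀

∑-* : {X : Set} (xs : List X) (c : ℤ) (f : X → ℤ) → ∑ xs (λ x → c * f x) ≡ c * ∑ xs f
∑-* []       c f = sym (ℤₚ.*-zeroʳ c)
∑-* (x ∷ xs) c f = trans (cong (λ z → c * f x + z) (∑-* xs c f))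
  (sym (ℤₚ.*-distribˡ-+ c (f x) (∑ xs f)))

∑-swap : {X Y : Set} (xs : List X) (ys : List Y) (f : X → Y → ℤ) →
         ∑ xs (λ x → ∑ ys (f x)) ≡ ∑ ys (λ y → ∑ xs (λ x → f x y))
∑-swap []       ys f = sym (∑-zero ys (λ _ → refl))
∑-swap (x ∷ xs) ys f = trans (cong (λ z → ∑ ys (f x) + z) (∑-swap xs ys f))
                             (sym (∑-+ ys (f x) (λ y → ∑ xs (λ x′ → f x′ y))))

∑-zero∈ : {X : Set} (xs : List X) {f : X → ℤ} → All (λ x → f x ≡ 0ℤ) xs → ∑ xs f ≡ 0ℤ
∑-zero∈ []       []       = refl
∑-zero∈ (x ∷ xs) (e ∷ es) = trans (cong₂ _+_ e (∑-zero∈ xs es)) refl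

∑-single : {X : Set} {xs : List X} {a : X} (f : X → ℤ) → Unique xs → a ∈ xs →
           (∀ x → x ≢ a → f x ≡ 0ℤ) → ∑ xs f ≡ f a
∑-single {xs = x ∷ xs} f (n ∷ u) (here refl) z =
  trans (cong (λ z → f x + z) (∑-zero∈ xs (All.map (λ x≢y → z _ (λ e → x≢y (sym e))) n)))
    (ℤₚ.+-identityʳ (f x))
∑-single {xs = x ∷ xs} {a} f (n ∷ u) (there a∈) z =
  trans (cong₂ _+_ (z x (λ e → All.lookup n a∈ e)) (∑-single f u a∈ z)) (ℤₚ.+-identityˡ (f a))

_≟ᵗ_ : DecidableEquality Type
α ≟ᵗ α = yes refl
α ≟ᵗ β = no λ ()
α ≟ᵗ γ = no λ ()
α ≟ᵗ δ = no λ ()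
β ≟ᵗ α = no λ ()
β ≟ᵗ β = yes refl
β ≟ᵗ γ = no λ ()
β ≟ᵗ δ = no λ ()
γ ≟ᵗ α = no λ ()
γ ≟ᵗ β = no λ ()
γ ≟ᵗ γ = yes refl
γ ≟ᵗ δ = no λ ()
δ ≟ᵗ α = no λ ()
δ ≟ᵗ β = no λ ()
δ ≟ᵗ γ = no λ ()
δ ≟ᵗ δ = yes refl

infix 4 _≟_
abstract
  _≟_ : DecidableEquality Alcove
  alc a m τ ≟ alc a′ m′ τ′ = map′ (λ { (refl , refl , refl) → refl }) (λ { refl → refl , refl , refl })
                                  (a ℤ.≟ a′ ×-dec (m ℤ.≟ m′ ×-dec τ ≟ᵗ τ′))

types : List Type
types = α ∷ β ∷ γ ∷ δ ∷ []

interval : ℕ → List ℤ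
interval n = map +_ (upTo (suc n)) ++ map -[1+_] (upTo n)

∈-interval : ∀ n z → ∣ z ∣ ≤ n → z ∈ interval n
∈-interval n (+ m) l = ∈-++⁺ˡ (∈-map⁺ +_ (∈-upTo⁺ (s≤s l)))
∈-interval n -[1+ m ] l = ∈-++⁺ʳ (map +_ (upTo (suc n))) (∈-map⁺ -[1+_] (∈-upTo⁺ l))

interval-unique : ∀ n → Unique (interval n)
interval-unique n = Uniqueₚ.++⁺ (Uniqueₚ.map⁺ ℤₚ.+-injective (Uniqueₚ.upTo⁺ (suc n)))
                                (Uniqueₚ.map⁺ ℤₚ.-[1+-injective (Uniqueₚ.upTo⁺ n)) disjoint
  where
  disjoint : ∀ {z} → ¬ (z ∈ map +_ (upTo (suc n)) × z ∈ map -[1+_] (upTo n))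
  disjoint (p , q) with ∈-map⁻ +_ p | ∈-map⁻ -[1+_] q
  ... | _ , _ , refl | _ , _ , ()

types-unique : Unique types
types-unique = ((λ ()) ∷ (λ ()) ∷ (λ ()) ∷ []) ∷ ((λ ()) ∷ (λ ()) ∷ []) ∷ ((λ ()) ∷ []) ∷ [] ∷ []

∈-types : ∀ τ → τ ∈ types
∈-types α = here refl
∈-types β = there (here refl)
∈-types γ = there (there (here refl))
∈-types δ = there (there (there (here refl)))

abstract
  -- A box in the coordinates. It also contains alcoves longer than n, so summands belonging to them
  -- have to be seen to vanish.
  ball : ℕ → List Alcove
  ball n = cartesianProductWith (λ a p → alc a (proj₁ p) (proj₂ p)) (interval n)
              (cartesianProductWith _,_ (interval n) types)

  ∈-ball : ∀ n x → len x ≤ n → x ∈ ball n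
  ∈-ball n x l = ∈-cartesianProductWith⁺ (λ a p → alc a (proj₁ p) (proj₂ p))
    (∈-interval n (A x) (ℕₚ.≤-trans (∣A∣≤len x) l))
    (∈-cartesianProductWith⁺ _,_ (∈-interval n (M x) (ℕₚ.≤-trans (∣M∣≤len x) l)) (∈-types (ty x)))

  ball-unique : ∀ n → Unique (ball n)
  ball-unique n = Uniqueₚ.cartesianProductWith⁺ _ (λ { refl → refl , refl }) (interval-unique n)
    (Uniqueₚ.cartesianProductWith⁺ _,_ (λ { refl → refl , refl }) (interval-unique n) types-unique)

-- Coefficients in powers of v

⟦_⟧ : Bool → ℤ
⟦ true ⟧  = 1ℤ
⟦ false ⟧ = 0ℤ

-- The coefficient of v^m in f(v²).
half : Poly → ℕ → ℤ
half f zero          = f zero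
half f (suc zero)    = 0ℤ
half f (suc (suc m)) = half (λ i → f (suc i)) m

-- coeff f m n is the coefficient of q^((m-n)/2) in f.
coeff : Poly → ℕ → ℕ → ℤ
coeff f m       zero    = half f m
coeff f zero    (suc n) = 0ℤ
coeff f (suc m) (suc n) = coeff f m n

half-cong : ∀ {f g} → (∀ i → f i ≡ g i) → ∀ m → half f m ≡ half g m
half-cong e zero          = e zero
half-cong e (suc zero)    = refl
half-cong e (suc (suc m)) = half-cong (λ i → e (suc i)) m

-- The alternative is uniform in f: for given m and n, `coeff` is either evaluation at one index or
-- identically zero, hence linear in f.
coeff-view : ∀ m n → (Σ ℕ λ i → m ≡ i ℕ.+ i ℕ.+ n × ∀ f → coeff f m n ≡ f i) ⊎
                     ((∀ f → coeff f m n ≡ 0ℤ) × ∀ i → m ≢ i ℕ.+ i ℕ.+ n)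
coeff-view zero zero = inj₁ (0 , refl , λ _ → refl)
coeff-view (suc zero) zero = inj₂ ((λ _ → refl) , odd≢)
  where
  odd≢ : ∀ i → 1 ≢ i ℕ.+ i ℕ.+ 0
  odd≢ zero ()
  odd≢ (suc i) e = ℕₚ.1+n≢0 (sym (trans (ℕₚ.suc-injective e) (cong (ℕ._+ 0) (ℕₚ.+-suc i i))))
coeff-view (suc (suc m)) zero with coeff-view m zero
... | inj₁ (i , e , p) = inj₁ (suc i , trans (cong (λ k → suc (suc k)) e)
  (cong (λ k → suc (k ℕ.+ 0)) (sym (ℕₚ.+-suc i i))) ,
                               λ f → p (λ j → f (suc j)))
... | inj₂ (z , ne) = inj₂ ((λ f → z (λ j → f (suc j))) , λ
  { zero () ; (suc i) e → ne i (ℕₚ.suc-injective (trans (ℕₚ.suc-injective e)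
    (cong (ℕ._+ 0) (ℕₚ.+-suc i i)))) })
coeff-view zero (suc n) = inj₂ ((λ _ → refl) , λ i e → ℕₚ.1+n≢0 (sym (trans e (ℕₚ.+-suc (i ℕ.+ i) n))))
coeff-view (suc m) (suc n) with coeff-view m n
... | inj₁ (i , e , p) = inj₁ (i , trans (cong suc e) (sym (ℕₚ.+-suc (i ℕ.+ i) n)) , p)
... | inj₂ (z , ne) = inj₂ (z , λ i e → ne i (ℕₚ.suc-injective (trans e (ℕₚ.+-suc (i ℕ.+ i) n))))

coeff-cong : ∀ {f g} → (∀ i → f i ≡ g i) → ∀ m n → coeff f m n ≡ coeff g m n
coeff-cong e m n with coeff-view m n
... | inj₁ (i , _ , p) = trans (p _) (trans (e i) (sym (p _)))
... | inj₂ (z , _)     = trans (z _) (sym (z _))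

coeff-cancel : ∀ f k m n → coeff f (k ℕ.+ m) (k ℕ.+ n) ≡ coeff f m n
coeff-cancel f zero    m n = refl
coeff-cancel f (suc k) m n = coeff-cancel f k m n

coeff-shift1 : ∀ f m n → coeff (shift 1 f) m n ≡ coeff f m (2 ℕ.+ n)
coeff-shift1 f zero zero = refl
coeff-shift1 f (suc zero) zero = refl
coeff-shift1 f (suc (suc m)) zero = refl
coeff-shift1 f zero (suc n) = refl
coeff-shift1 f (suc m) (suc n) = trans (coeff-shift1 f m n) (reindex m)
  where
  reindex : ∀ m → coeff f m (2 ℕ.+ n) ≡ coeff f (suc m) (3 ℕ.+ n)
  reindex m = refl

shift-suc : ∀ j f i → shift (suc j) f i ≡ shift 1 (shift j f) i
shift-suc j f zero    = refl
shift-suc j f (suc i) = refl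

coeff-shift : ∀ j f m n → coeff (shift j f) m n ≡ coeff f m (j ℕ.+ j ℕ.+ n)
coeff-shift zero    f m n = refl
coeff-shift (suc j) f m n = begin
  coeff (shift (suc j) f) m n            ≡⟨ coeff-cong (shift-suc j f) m n ⟩
  coeff (shift 1 (shift j f)) m n        ≡⟨ coeff-shift1 (shift j f) m n ⟩
  coeff (shift j f) m (2 ℕ.+ n)          ≡⟨ coeff-shift j f m (2 ℕ.+ n) ⟩
  coeff f m (j ℕ.+ j ℕ.+ (2 ℕ.+ n))      ≡⟨ cong (coeff f m) (trans (ℕₚ.+-suc (j ℕ.+ j) (suc n))
                                             (cong suc (trans (ℕₚ.+-suc (j ℕ.+ j) n)
                                               (cong (ℕ._+ n) (sym (ℕₚ.+-suc j j)))))) ⟩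
  coeff f m (suc j ℕ.+ suc j ℕ.+ n)      ∎
  where open ≡-Reasoning

shift-zero : ∀ j f i → (∀ i′ → i ≡ j ℕ.+ i′ → f i′ ≡ 0ℤ) → shift j f i ≡ 0ℤ
shift-zero zero    f i       h = h i refl
shift-zero (suc j) f zero    h = refl
shift-zero (suc j) f (suc i) h = shift-zero j f i (λ i′ e → h i′ (cong suc e))

shift-at : ∀ j f i → shift j f (j ℕ.+ i) ≡ f i
shift-at zero    f i = refl
shift-at (suc j) f i = shift-at j f i

odd-half : ∀ n → odd n ≡ true → n ≡ suc (⌊ n /2⌋ ℕ.+ ⌊ n /2⌋)
odd-half (suc zero)    _ = refl
odd-half (suc (suc n)) o = cong suc (trans (cong suc (odd-half n o))
  (sym (cong suc (ℕₚ.+-suc ⌊ n /2⌋ ⌊ n /2⌋))))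

odd-double : ∀ m → odd (suc (m ℕ.+ m)) ≡ true
odd-double zero    = refl
odd-double (suc m) = trans (cong (λ k → odd (suc (suc k))) (ℕₚ.+-suc m m)) (odd-double m)

half-double : ∀ m → ⌊ suc (m ℕ.+ m) /2⌋ ≡ m
half-double zero    = refl
half-double (suc m) = trans (cong (λ k → ⌊ suc (suc k) /2⌋) (ℕₚ.+-suc m m)) (cong suc (half-double m))

-- The Kazhdan-Lusztig recursion over a fixed finite range, and the degree bound

-- No decision procedure for the Bruhat order is needed: every goal below is an equality of integers,
-- hence stable, so the enumeration Z of the recursion may be selected up to double negation.

¬¬-All-Dec : {X : Set} {Q : X → Set} (xs : List X) → ¬ ¬ All (λ x → Dec (Q x)) xs
¬¬-All-Dec []       k = k []
¬¬-All-Dec (x ∷ xs) k = ¬¬-excluded-middle λ d → ¬¬-All-Dec xs λ ds → k (d ∷ ds)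

module _ {X : Set} {Q : X → Set} where

  select : (xs : List X) → All (λ x → Dec (Q x)) xs → List X
  select []       []           = []
  select (x ∷ xs) (yes _ ∷ ds) = x ∷ select xs ds
  select (x ∷ xs) (no _ ∷ ds)  = select xs ds

  select-All : ∀ xs ds → All Q (select xs ds)
  select-All []       []           = []
  select-All (x ∷ xs) (yes q ∷ ds) = q ∷ select-All xs ds
  select-All (x ∷ xs) (no _ ∷ ds)  = select-All xs ds

  select-⊆ : ∀ {T : X → Set} xs ds → All T xs → All T (select xs ds)
  select-⊆ []       []           []       = []
  select-⊆ (x ∷ xs) (yes _ ∷ ds) (p ∷ ps) = p ∷ select-⊆ xs ds ps
  select-⊆ (x ∷ xs) (no _ ∷ ds)  (p ∷ ps) = select-⊆ xs ds ps

  select-unique : ∀ xs ds → Unique xs → Unique (select xs ds)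
  select-unique []       []           []      = []
  select-unique (x ∷ xs) (yes _ ∷ ds) (n ∷ u) = select-⊆ xs ds n ∷ select-unique xs ds u
  select-unique (x ∷ xs) (no _ ∷ ds)  (n ∷ u) = select-unique xs ds u

  select-∈ : ∀ xs ds {x} → x ∈ xs → Q x → x ∈ select xs ds
  select-∈ (x ∷ xs) (yes _ ∷ ds) (here refl) q = here refl
  select-∈ (x ∷ xs) (yes _ ∷ ds) (there p)   q = there (select-∈ xs ds p q)
  select-∈ (x ∷ xs) (no ¬q ∷ ds) (here refl) q = ⊥-elim (¬q q)
  select-∈ (x ∷ xs) (no _ ∷ ds)  (there p)   q = select-∈ xs ds p q

  ∑-select : ∀ xs ds (f : X → ℤ) → (∀ x → ¬ Q x → f x ≡ 0ℤ) → ∑ (select xs ds) f ≡ ∑ xs f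
  ∑-select []       []            f z = refl
  ∑-select (x ∷ xs) (yes _ ∷ ds)  f z = cong (λ z → f x + z) (∑-select xs ds f z)
  ∑-select (x ∷ xs) (no ¬q ∷ ds)  f z = trans (∑-select xs ds f z)
    (trans (sym (ℤₚ.+-identityˡ _)) (cong (λ z → z + ∑ xs f) (sym (z x ¬q))))

∑-map : {X Y : Set} (h : X → Y) (xs : List X) (f : Y → ℤ) → ∑ (map h xs) f ≡ ∑ xs (λ x → f (h x))
∑-map h []       f = refl
∑-map h (x ∷ xs) f = cong (λ z → f (h x) + z) (∑-map h xs f)

desc-≢ : ∀ g {x y} → desc g x ≡ true → desc g y ≡ false → x ≢ y
desc-≢ g p q refl = true≢false p q

nf-≈⇒≡ : ∀ {x y} → nf x ≈ nf y → x ≡ y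
nf-≈⇒≡ {x} {y} e = trans (sym (pt-nf x)) (trans (pt-≈ e) (pt-nf y))

desc-nf : ∀ g x {b} → desc g x ≡ b → desc g (pt (nf x)) ≡ b
desc-nf g x e = trans (cong (desc g) (pt-nf x)) e

∑-congAll : {X : Set} {xs : List X} {f g : X → ℤ} → All (λ x → f x ≡ g x) xs → ∑ xs f ≡ ∑ xs g
∑-congAll []       = refl
∑-congAll (e ∷ es) = cong₂ _+_ e (∑-congAll es)

mu-view : ∀ P u w → (Σ ℕ λ m → length w ≡ length u ℕ.+ suc (m ℕ.+ m) × mu P u w ≡ P u w m) ⊎
                    (mu P u w ≡ 0ℤ × ∀ m → length w ≢ length u ℕ.+ suc (m ℕ.+ m))
mu-view P u w with odd (length w ∸ length u) in e
... | true  = inj₁ (⌊ length w ∸ length u /2⌋ , eq , refl)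
  where
  d = odd-half (length w ∸ length u) e
  eq : length w ≡ length u ℕ.+ suc (⌊ length w ∸ length u /2⌋ ℕ.+ ⌊ length w ∸ length u /2⌋)
  eq = trans (sym (ℕₚ.m+[n∸m]≡n {length u} (ℕₚ.<⇒≤ (ℕₚ.m∸n≢0⇒n<m λ z → ℕₚ.1+n≢0 (trans (sym d) z)))))
             (cong (length u ℕ.+_) d)
... | false = inj₂ (refl , λ m eq → true≢false (odd-double m)
                 (trans (cong odd (sym (trans (cong (_∸ length u) eq) (ℕₚ.m+n∸m≡n (length u) _)))) e))

module KL (P : Word → Word → Poly) (K : IsKL P) (N : ℕ) where
  open IsKL K

  P̂ : Alcove → Alcove → Poly
  P̂ y w = P (nf y) (nf w)

  μ : Alcove → Alcove → ℤ
  μ y w = mu P (nf y) (nf w)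

  E : List Alcove
  E = ball N

  μ-view : ∀ y w → (Σ ℕ λ m → len w ≡ len y ℕ.+ suc (m ℕ.+ m) × μ y w ≡ P̂ y w m) ⊎
                   (μ y w ≡ 0ℤ × ∀ m → len w ≢ len y ℕ.+ suc (m ℕ.+ m))
  μ-view y w with mu-view P (nf y) (nf w)
  ... | inj₁ (m , e , p) = inj₁ (m , subst₂ (λ a b → a ≡ b ℕ.+ suc (m ℕ.+ m)) (length-nf w)
    (length-nf y) e , p)
  ... | inj₂ (z , ne) = inj₂ (z , λ m e → ne m
          (subst₂ (λ a b → a ≡ b ℕ.+ suc (m ℕ.+ m)) (sym (length-nf w)) (sym (length-nf y)) e))

  P̂-act : ∀ g y x i → P (nf y) (g ∷ nf x) i ≡ P̂ y (act g x) i
  P̂-act g y x = invariant ≈-refl (nf-act g x)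

  P̂-act′ : ∀ g y x i → P (g ∷ nf y) (nf x) i ≡ P̂ (act g y) x i
  P̂-act′ g y x = invariant (nf-act g y) ≈-refl

  -- The summand of the correction term in the recursion for P y (g x), extended by 0 to all z.
  cterm : Gen → Alcove → Alcove → ℕ → Alcove → ℤ
  cterm g x y i z = ⟦ desc g z ⟧ * (μ z x * shift ⌊ suc (len x) ∸ len z /2⌋ (P̂ y z) i)

  cterm-0 : ∀ g x y i z → (desc g z ≡ true → μ z x ≢ 0ℤ →
            shift ⌊ suc (len x) ∸ len z /2⌋ (P̂ y z) i ≡ 0ℤ) → cterm g x y i z ≡ 0ℤ
  cterm-0 g x y i z h with desc g z in d
  ... | false = refl
  ... | true with μ z x ℤ.≟ 0ℤ
  ...   | yes e = cong (λ m → 1ℤ * (m * shift ⌊ suc (len x) ∸ len z /2⌋ (P̂ y z) i)) e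
  ...   | no ne = trans (cong (λ k → 1ℤ * (μ z x * k)) (h refl ne))
    (cong (1ℤ ℤ.*_) (ℤₚ.*-zeroʳ (μ z x)))

  module Enumeration (g : Gen) (x : Alcove) (x≤N : len x ≤ N) where
    Q : Alcove → Set
    Q z = nf z <B nf x × desc g z ≡ true

    module _ (ds : All (λ z → Dec (Q z)) E) where
      zs = select E ds

      enumerates : Enumerates g (nf x) (map nf zs)
      enumerates = Allₚ.map⁺ (All.map (λ { {z} (lt , d) → nf-reduced z , lt , ¬reduced-∷
        (desc-nf g z d) }) (select-All E ds))
                 , AllPairsₚ.map⁺ (AllPairs.map (λ ne e → ne (nf-≈⇒≡ e))
                   (select-unique E ds (ball-unique N)))
                 , complete
        where
        complete : ∀ z → Reduced z → z <B nf x → ¬ Reduced (g ∷ z) → Any (λ z′ → z ≈ z′) (map nf zs)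
        complete z red (le , ne) nr = Anyₚ.map⁺ (Any.map (λ { refl → nf-pt z }) z∈)
          where
          short : len (pt z) ≤ N
          short with ≤B-len le
          ... | inj₁ e = subst (λ y → len y ≤ N) (sym (trans e (pt-nf x))) x≤N
          ... | inj₂ l = ℕₚ.<⇒≤ (ℕₚ.<-≤-trans (subst (λ y → len (pt z) < len y) (pt-nf x) l) x≤N)
          down : desc g (pt z) ≡ true
          down with bool? (desc g (pt z))
          ... | inj₁ d = d
          ... | inj₂ d = ⊥-elim (nr (reduced-∷⇐ red d))
          z∈ : pt z ∈ zs
          z∈ = select-∈ E ds (∈-ball N (pt z) short)
                 ((≤B-trans (≤B-refl (≈-sym (nf-pt z))) le , λ e → ne (≈-trans (nf-pt z) e)) , down)

      correction-∑ : ∀ y i → correction P g (nf x) (nf y) (map nf zs) i ≡ ∑ E (cterm g x y i)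
      correction-∑ y i = trans (∑-map nf zs _) (trans (∑-congAll (All.map same-term (select-All E ds)))
                           (∑-select E ds (cterm g x y i) vanishing))
        where
        same-term : ∀ {z} → Q z → μ z x * shift ⌊ length (g ∷ nf x) ∸ length (nf z) /2⌋ (P̂ y z) i
          ≡ cterm g x y i z
        same-term {z} (_ , d) rewrite length-nf x | length-nf z | d = sym (ℤₚ.*-identityˡ _)
        vanishing : ∀ z → ¬ Q z → cterm g x y i z ≡ 0ℤ
        vanishing z ¬q = cterm-0 g x y i z contra
          where
          contra : desc g z ≡ true → μ z x ≢ 0ℤ → _ ≡ 0ℤ
          contra d ne with μ-view z x
          ... | inj₂ (e , _) = ⊥-elim (ne e)
          ... | inj₁ (m , l , e) = ⊥-elim (ne (trans e (vanish (nf z) (nf x)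
            (λ le → ¬q ((le , distinct) , d)) m)))
            where
            distinct : ¬ nf z ≈ nf x
            distinct e with nf-≈⇒≡ {z} {x} e
            ... | refl = ℕₚ.m≢1+m+n (len z) (trans l (ℕₚ.+-suc (len z) (m ℕ.+ m)))

  -- The recursion as an identity for all y, not only for y ≤ g x.
  module Total (g : Gen) (x : Alcove) (x≤N : len x ≤ N) (gx : desc g x ≡ false) (y : Alcove)
    (i : ℕ) where
    open Enumeration g x x≤N

    red-gx : Reduced (g ∷ nf x)
    red-gx = reduced-∷⇐ (nf-reduced x) (desc-nf g x gx)

    module Below (¬le : ¬ nf y ≤B g ∷ nf x) where
      z₁ : P̂ y (act g x) i ≡ 0ℤ
      z₁ = trans (sym (P̂-act g y x i)) (vanish _ _ ¬le i)
      z₂ : ∀ j → P̂ (act g y) x j ≡ 0ℤ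
      z₂ j = trans (sym (P̂-act′ g y x j)) (vanish _ _ (λ q → ¬le (≤B-lift-up g (desc-nf g x gx) q)) j)
      z₃ : ∀ j → P̂ y x j ≡ 0ℤ
      z₃ j = vanish _ _ (λ q → ¬le (≤B-trans q (≤B-act g (nf x) (desc-nf g x gx)))) j
      -- A summand with z ≤ x vanishes because y is not below z, and one with z not below x because
      -- μ(z, x) = 0. The case distinction is legitimate as the goal is stable.
      z₄ : ∑ E (cterm g x y i) ≡ 0ℤ
      z₄ = ∑-zero E λ z → decidable-stable (_ ℤ.≟ _) λ ne → ¬¬-excluded-middle λ
        { (yes le) → ne (cterm-0 g x y i z λ _ _ → shift-zero ⌊ suc (len x) ∸ len z /2⌋
          (P̂ y z) i λ j _ →
                       vanish _ _ (λ q → ¬le (≤B-trans q (≤B-trans le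
                         (≤B-act g (nf x) (desc-nf g x gx))))) j)
        ; (no ¬le′) → ne (cterm-0 g x y i z λ _ μ≢0 → ⊥-elim (μ≢0 (μ-zero z ¬le′))) }
        where
        μ-zero : ∀ z → ¬ nf z ≤B nf x → μ z x ≡ 0ℤ
        μ-zero z ¬le′ with μ-view z x
        ... | inj₂ (e , _) = e
        ... | inj₁ (m , _ , e) = trans e (vanish _ _ ¬le′ m)

    up : desc g y ≡ false →
         P̂ y (act g x) i ≡ (shift 1 (P̂ (act g y) x) i + P̂ y x i) - ∑ E (cterm g x y i)
    up gy = decidable-stable (_ ℤ.≟ _) λ ne → ¬¬-All-Dec E λ ds → ¬¬-excluded-middle λ
      { (yes le) → ne (trans (sym (P̂-act g y x i)) (trans
            (recursion-up g (nf x) (nf y) red-gx (nf-reduced y) le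
              (reduced-∷⇐ (nf-reduced y) (desc-nf g y gy)) _ (enumerates ds) i)
            (cong₂ (λ a b → (a + P̂ y x i) - b) (shifted i) (correction-∑ ds y i))))
      ; (no ¬le) → let open Below ¬le in ne (trans z₁ (sym (trans (cong₂ _-_ (cong₂ _+_
            (shift-zero 1 _ i (λ j _ → z₂ j)) (z₃ i)) z₄) refl))) }
      where
      shifted : ∀ i → shift 1 (P (g ∷ nf y) (nf x)) i ≡ shift 1 (P̂ (act g y) x) i
      shifted zero    = refl
      shifted (suc i) = P̂-act′ g y x i

    down : desc g y ≡ true →
           P̂ y (act g x) i ≡ (P̂ (act g y) x i + shift 1 (P̂ y x) i) - ∑ E (cterm g x y i)
    down gy = decidable-stable (_ ℤ.≟ _) λ ne → ¬¬-All-Dec E λ ds → ¬¬-excluded-middle λ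
      { (yes le) → ne (trans (sym (P̂-act g y x i)) (trans
            (recursion-down g (nf x) (nf y) red-gx (nf-reduced y) le (¬reduced-∷ (desc-nf g y gy)) _
              (enumerates ds) i)
            (cong₂ (λ a b → (a + shift 1 (P̂ y x) i) - b) (P̂-act′ g y x i) (correction-∑ ds y i))))
      ; (no ¬le) → let open Below ¬le in ne (trans z₁ (sym (trans (cong₂ _-_ (cong₂ _+_
            (z₂ i) (shift-zero 1 _ i (λ j _ → z₃ j))) z₄) refl))) }

  half-shift : ∀ {z x m} → len x ≡ len z ℕ.+ suc (m ℕ.+ m) → ⌊ suc (len x) ∸ len z /2⌋ ≡ suc m
  half-shift {z} {x} {m} e = trans (cong ⌊_/2⌋ (trans (cong (λ k → suc k ∸ len z) e)
      (trans (cong (_∸ len z) (sym (ℕₚ.+-suc (len z) (suc (m ℕ.+ m))))) (ℕₚ.m+n∸m≡n (len z) _))))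
    (trans (cong ⌊_/2⌋ (cong suc (sym (ℕₚ.+-suc m m)))) (trans (eq m) refl))
    where
    eq : ∀ m → ⌊ suc (m ℕ.+ suc m) /2⌋ ≡ suc m
    eq m = trans (cong (λ k → ⌊ suc k /2⌋) (ℕₚ.+-suc m m)) (cong suc (⌊n+n/2⌋ m))
      where
      ⌊n+n/2⌋ : ∀ m → ⌊ m ℕ.+ m /2⌋ ≡ m
      ⌊n+n/2⌋ zero = refl
      ⌊n+n/2⌋ (suc m) = trans (cong (λ k → ⌊ suc k /2⌋) (ℕₚ.+-suc m m)) (cong suc (⌊n+n/2⌋ m))

  -- The bound 2 deg P_{y,w} ≤ l(w) - l(y) - 1 is not among the conditions `IsKL`; it comes out of
  -- the recursion by induction. Only q P_{y,x} can exceed it, and the correction term is designed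
  -- to remove this excess.
  degree : ∀ n w → len w < n → len w ≤ N → ∀ y → y ≢ w → ∀ i → len w ≤ len y ℕ.+ (i ℕ.+ i) → P̂ y w i
    ≡ 0ℤ
  degree (suc n) w (s≤s w≤n) w≤N y y≢w i bd with descent? w
  ... | inj₁ refl = vanish _ _ (λ le → contra (≤B-len le)) i
    where
    contra : (pt (nf y) ≡ pt (nf id₀)) ⊎ (len (pt (nf y)) < len (pt (nf id₀))) → ⊥
    contra (inj₁ e) = y≢w (trans (sym (pt-nf y)) (trans e (pt-nf id₀)))
    contra (inj₂ l) = ℕₚ.n≮0 (subst (len (pt (nf y)) <_) (trans (cong len (pt-nf id₀)) len-id₀) l)
  ... | inj₂ (g , gw) = trans (cong (λ v → P̂ y v i) (sym gX≡w)) goal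
    where
    X = act g w
    gX≡w = act-invol g w
    gX : desc g X ≡ false
    gX = trans (desc-act g w) (cong not gw)
    lenw : suc (len X) ≡ len w
    lenw = len-down g w gw
    X<n : len X < n
    X<n = ℕₚ.<-≤-trans (len-< g gw) w≤n
    X≤N : len X ≤ N
    X≤N = ℕₚ.<⇒≤ (ℕₚ.<-≤-trans (len-< g gw) w≤N)
    bd′ : suc (len X) ≤ len y ℕ.+ (i ℕ.+ i)
    bd′ = subst (_≤ _) (sym lenw) bd
    double-suc : ∀ a i → a ℕ.+ (suc i ℕ.+ suc i) ≡ suc (suc (a ℕ.+ (i ℕ.+ i)))
    double-suc = ℕSolver.solve-∀
    ih : ∀ v → v ≢ X → ∀ j → len X ≤ len v ℕ.+ (j ℕ.+ j) → P̂ v X j ≡ 0ℤ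
    ih = degree n X X<n X≤N
    other : ∀ z → z ≢ y → cterm g X y i z ≡ 0ℤ
    other z z≢y = cterm-0 g X y i z λ _ ne → by ne (μ-view z X)
      where
      by : μ z X ≢ 0ℤ → (Σ ℕ λ m → len X ≡ len z ℕ.+ suc (m ℕ.+ m) × μ z X ≡ P̂ z X m) ⊎
           (μ z X ≡ 0ℤ × ∀ m → len X ≢ len z ℕ.+ suc (m ℕ.+ m)) →
           shift ⌊ suc (len X) ∸ len z /2⌋ (P̂ y z) i ≡ 0ℤ
      by ne (inj₂ (e , _)) = ⊥-elim (ne e)
      by ne (inj₁ (m , l , _)) = trans (cong (λ j → shift j (P̂ y z) i) (half-shift {z} {X} l))
        (shift-zero (suc m) (P̂ y z) i λ i′ e → degree n z
          (ℕₚ.<-trans z<X X<n) (ℕₚ.<⇒≤ (ℕₚ.<-≤-trans z<X X≤N)) y (λ e → z≢y (sym e)) i′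
          (ℕₚ.+-cancelʳ-≤ (suc m ℕ.+ suc m) _ _ (subst₂ _≤_
            (trans (cong suc l) (lemma₁ (len z) m)) (trans (cong (λ j → len y ℕ.+ (j ℕ.+ j)) e)
              (lemma₂ (len y) m i′)) bd′)))
        where
        z<X : len z < len X
        z<X = subst (len z <_) (sym l) (ℕₚ.m<m+n (len z) (s≤s z≤n))
        lemma₁ : ∀ a m → suc (a ℕ.+ suc (m ℕ.+ m)) ≡ a ℕ.+ (suc m ℕ.+ suc m)
        lemma₁ = ℕSolver.solve-∀
        lemma₂ : ∀ a m i → a ℕ.+ ((suc m ℕ.+ i) ℕ.+ (suc m ℕ.+ i)) ≡ a ℕ.+ (i ℕ.+ i) ℕ.+
          (suc m ℕ.+ suc m)
        lemma₂ = ℕSolver.solve-∀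
    goal : P̂ y (act g X) i ≡ 0ℤ
    goal with bool? (desc g y)
    ... | inj₂ gy = trans (Total.up g X X≤N gX y i gy) (trans
      (cong₂ _-_ (cong₂ _+_ (first i bd′) second)
                       (∑-zero E λ z → corr z)) refl)
      where
      first : ∀ i → suc (len X) ≤ len y ℕ.+ (i ℕ.+ i) → shift 1 (P̂ (act g y) X) i ≡ 0ℤ
      first zero    b = refl
      first (suc i) b = ih (act g y) (desc-≢ g (trans (desc-act g y) (cong not gy)) gX) i
        (subst (λ k → len X ≤ k ℕ.+ (i ℕ.+ i)) (sym (len-up g y gy))
          (ℕₚ.≤-pred (subst (suc (len X) ≤_) (double-suc (len y) i) b)))
      second : P̂ y X i ≡ 0ℤ
      second with y ≟ X
      ... | no ne = ih y ne i (ℕₚ.≤-trans (ℕₚ.n≤1+n _) bd′)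
      ... | yes refl = trans (diagonal (nf X) i) (big i bd′)
        where
        big : ∀ i → suc (len X) ≤ len X ℕ.+ (i ℕ.+ i) → one i ≡ 0ℤ
        big zero b = ⊥-elim (ℕₚ.<-irrefl (sym (ℕₚ.+-identityʳ (len X))) b)
        big (suc i) _ = refl
      corr : ∀ z → cterm g X y i z ≡ 0ℤ
      corr z with z ≟ y
      ... | no ne = other z ne
      ... | yes refl = cterm-0 g X y i z λ gz _ → ⊥-elim (true≢false gz gy)
    ... | inj₁ gy = trans (Total.down g X X≤N gX y i gy) (trans (cong₂ _-_ (cong₂ _+_ first second) ∑y)
                      (trans (cong (λ c → c - cterm g X y i y) (ℤₚ.+-identityˡ (cterm g X y i y)))
                        (ℤₚ.+-inverseʳ (cterm g X y i y))))
      where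
      leny : suc (len (act g y)) ≡ len y
      leny = len-down g y gy
      y≢X : y ≢ X
      y≢X = desc-≢ g gy gX
      first : P̂ (act g y) X i ≡ 0ℤ
      first = ih (act g y) (λ e → y≢w (trans (sym (act-invol g y)) (trans (cong (act g) e) gX≡w))) i
        (ℕₚ.≤-pred (subst (λ k → suc (len X) ≤ k ℕ.+ (i ℕ.+ i)) (sym leny) bd′))
      ∑y : ∑ E (cterm g X y i) ≡ cterm g X y i y
      ∑y with len y ℕ.≤? N
      ... | yes l = ∑-single (cterm g X y i) (ball-unique N) (∈-ball N y l) other
      ... | no ¬l = trans (∑-zero E all0) (sym y0)
        where
        y0 : cterm g X y i y ≡ 0ℤ
        y0 = cterm-0 g X y i y λ _ ne → ⊥-elim (by ne (μ-view y X))
          where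
          by : μ y X ≢ 0ℤ → (Σ ℕ λ m → len X ≡ len y ℕ.+ suc (m ℕ.+ m) × μ y X ≡ P̂ y X m) ⊎
               (μ y X ≡ 0ℤ × ∀ m → len X ≢ len y ℕ.+ suc (m ℕ.+ m)) → ⊥
          by ne (inj₂ (e , _)) = ne e
          by ne (inj₁ (m , e , _)) = ¬l (ℕₚ.≤-trans (ℕₚ.≤-trans (ℕₚ.m≤m+n (len y) _)
            (ℕₚ.≤-reflexive (sym e))) X≤N)
        all0 : ∀ z → cterm g X y i z ≡ 0ℤ
        all0 z with z ≟ y
        ... | no ne = other z ne
        ... | yes refl = y0
      -- The summand z = y of the correction cancels the top coefficient of q P y X.
      second : shift 1 (P̂ y X) i ≡ cterm g X y i y
      second with μ-view y X
      ... | inj₂ (e , ne) = trans (zero-shift i bd′) (sym (cterm-0 g X y i y λ _ n → ⊥-elim (n e)))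
        where
        zero-shift : ∀ i → suc (len X) ≤ len y ℕ.+ (i ℕ.+ i) → shift 1 (P̂ y X) i ≡ 0ℤ
        zero-shift zero    b = refl
        zero-shift (suc i) b with ℕₚ.m≤n⇒m<n∨m≡n (ℕₚ.≤-pred
          (subst (suc (len X) ≤_) (double-suc (len y) i) b))
        ... | inj₁ (s≤s l) = ih y y≢X i l
        ... | inj₂ l = ⊥-elim (ne i (trans l (sym (ℕₚ.+-suc (len y) (i ℕ.+ i)))))
      ... | inj₁ (m , l , e) = trans (by i bd′) (sym (trans
        (cong (λ b → ⟦ b ⟧ * (μ y X * shift ⌊ suc (len X) ∸ len y /2⌋ (P̂ y y) i)) gy)
                    (trans (ℤₚ.*-identityˡ _) (cong₂ _*_ e (cong (λ j → shift j (P̂ y y) i)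
                      (half-shift {y} {X} l))))))
        where
        by : ∀ i → suc (len X) ≤ len y ℕ.+ (i ℕ.+ i) → shift 1 (P̂ y X) i ≡ P̂ y X m * shift (suc m)
          (P̂ y y) i
        by zero b = sym (ℤₚ.*-zeroʳ (P̂ y X m))
        by (suc i) b with m ℕ.≟ i
        ... | yes refl = sym (trans (cong (P̂ y X m ℤ.*_)
          (trans (cong (shift m (P̂ y y)) (sym (ℕₚ.+-identityʳ m)))
                           (trans (shift-at m (P̂ y y) 0) (diagonal (nf y) 0)))) (ℤₚ.*-identityʳ _))
        ... | no m≢i = trans (ih y y≢X i enough) (sym (trans (cong (P̂ y X m ℤ.*_)
                         (shift-zero m (P̂ y y) i λ { zero e → ⊥-elim
                           (m≢i (sym (trans e (ℕₚ.+-identityʳ m))))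
                                                   ; (suc i′) _ → diagonal (nf y) (suc i′) }))
                                                     (ℤₚ.*-zeroʳ (P̂ y X m))))
          where
          b′ : len X ≤ suc (len y ℕ.+ (i ℕ.+ i))
          b′ = ℕₚ.≤-pred (subst (suc (len X) ≤_) (double-suc (len y) i) b)
          enough : len X ≤ len y ℕ.+ (i ℕ.+ i)
          enough with ℕₚ.m≤n⇒m<n∨m≡n b′
          ... | inj₁ (s≤s l′) = l′
          ... | inj₂ l′ = ⊥-elim (m≢i (double-inj (ℕₚ.suc-injective (ℕₚ.+-cancelˡ-≡ (len y) _ _
                  (trans (sym l) (trans l′ (sym (ℕₚ.+-suc (len y) (i ℕ.+ i)))))))))
            where
            double-inj : ∀ {m n} → m ℕ.+ m ≡ n ℕ.+ n → m ≡ n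
            double-inj {zero} {zero} _ = refl
            double-inj {suc m} {suc n} e = cong suc (double-inj (ℕₚ.suc-injective
              (trans (sym (ℕₚ.+-suc m m)) (trans (ℕₚ.suc-injective e) (ℕₚ.+-suc n n)))))

-- The recursion in the normalisation by powers of v⁻¹

X : Poly → Poly
X = shift 1

coeff-linear : {Z : Set} (zs : List Z) (a b : Poly) (c : Z → Poly) → ∀ m n →
  coeff (λ i → (a i + b i) - ∑ zs (λ z → c z i)) m n ≡
  (coeff a m n + coeff b m n) - ∑ zs (λ z → coeff (c z) m n)
coeff-linear zs a b c m n with coeff-view m n
... | inj₁ (i , _ , p) = trans (p _) (sym (cong₂ _-_ (cong₂ _+_ (p a) (p b))
  (∑-cong zs (λ z → p (c z)))))
... | inj₂ (z , _) = trans (z _) (sym (cong₂ _-_ (cong₂ _+_ (z a) (z b)) (∑-zero zs (λ y → z (c y)))))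

coeff-scale : ∀ c f m n → coeff (λ i → c * f i) m n ≡ c * coeff f m n
coeff-scale c f m n with coeff-view m n
... | inj₁ (i , _ , p) = trans (p _) (cong (c ℤ.*_) (sym (p f)))
... | inj₂ (z , _) = trans (z _) (sym (trans (cong (c ℤ.*_) (z f)) (ℤₚ.*-zeroʳ c)))

coeff-big : ∀ f {m n} → m < n → coeff f m n ≡ 0ℤ
coeff-big f {m} {n} l with coeff-view m n
... | inj₁ (i , e , _) = ⊥-elim (ℕₚ.<⇒≱ l (subst (n ≤_) (sym e) (ℕₚ.m≤n+m n (i ℕ.+ i))))
... | inj₂ (z , _) = z f

⟦⟧-false : ∀ {b} c → b ≡ false → ⟦ b ⟧ * c ≡ 0ℤ
⟦⟧-false c refl = refl

⟦⟧-true : ∀ {b} c → b ≡ true → ⟦ b ⟧ * c ≡ c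
⟦⟧-true c refl = ℤₚ.*-identityˡ c

⟦⟧-cong : ∀ b {c d} → (b ≡ true → c ≡ d) → ⟦ b ⟧ * c ≡ ⟦ b ⟧ * d
⟦⟧-cong true  h = cong (1ℤ ℤ.*_) (h refl)
⟦⟧-cong false h = refl

module Normalised (P : Word → Word → Poly) (K : IsKL P) (N : ℕ) where
  open IsKL K using (diagonal)
  open KL P K N public

  -- With v² = q, p y w k is the coefficient of v⁻ᵏ in v^(l(y)-l(w)) P y w.
  p : Alcove → Alcove → ℕ → ℤ
  p y w k = coeff (P̂ y w) (len w) (len y ℕ.+ k)

  p-big : ∀ y w k → len w < len y ℕ.+ k → p y w k ≡ 0ℤ
  p-big y w k = coeff-big (P̂ y w)

  p-refl : ∀ y → p y y 0 ≡ 1ℤ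
  p-refl y = trans (subst (λ k → coeff (P̂ y y) k (len y ℕ.+ 0) ≡ coeff (P̂ y y) 0 0)
    (ℕₚ.+-identityʳ (len y))
                     (coeff-cancel (P̂ y y) (len y) 0 0)) (diagonal (nf y) 0)

  -- The degree bound in this normalisation: off the diagonal p lies in v⁻¹ℤ[v⁻¹].
  p-zero : ∀ {y w} → len w ≤ N → y ≢ w → p y w 0 ≡ 0ℤ
  p-zero {y} {w} w≤N y≢w with coeff-view (len w) (len y ℕ.+ 0)
  ... | inj₂ (z , _) = z _
  ... | inj₁ (i , e , v) = trans (v _) (degree (suc (len w)) w (ℕₚ.n<1+n _) w≤N y y≢w i
          (ℕₚ.≤-reflexive (trans e (trans (ℕₚ.+-comm (i ℕ.+ i) _)
            (cong (ℕ._+ (i ℕ.+ i)) (ℕₚ.+-identityʳ (len y)))))))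

  p-one : ∀ y w → p y w 1 ≡ μ y w
  p-one y w with coeff-view (len w) (len y ℕ.+ 1) | μ-view y w
  ... | inj₂ (z , _)     | inj₂ (z′ , _) = trans (z _) (sym z′)
  ... | inj₁ (i , e , v) | inj₂ (_ , ne) = ⊥-elim (ne i (trans e (rearrange (len y) i)))
    where
    rearrange : ∀ a i → i ℕ.+ i ℕ.+ (a ℕ.+ 1) ≡ a ℕ.+ suc (i ℕ.+ i)
    rearrange = ℕSolver.solve-∀
  ... | inj₂ (_ , ne)    | inj₁ (m , e , _) = ⊥-elim (ne m (trans e (rearrange (len y) m)))
    where
    rearrange : ∀ a i → a ℕ.+ suc (i ℕ.+ i) ≡ i ℕ.+ i ℕ.+ (a ℕ.+ 1)
    rearrange = ℕSolver.solve-∀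
  ... | inj₁ (i , e , v) | inj₁ (m , e′ , v′) = trans (v _) (trans (cong (P̂ y w) (half-inj
            (ℕₚ.suc-injective (ℕₚ.+-cancelˡ-≡ (len y) _ _ (trans (sym (rearrange (len y) i))
              (trans (sym e) e′))))))
            (sym v′))
    where
    rearrange : ∀ a i → i ℕ.+ i ℕ.+ (a ℕ.+ 1) ≡ a ℕ.+ suc (i ℕ.+ i)
    rearrange = ℕSolver.solve-∀
    half-inj : ∀ {i m} → i ℕ.+ i ≡ m ℕ.+ m → i ≡ m
    half-inj {i} {m} e = trans (sym (half-double i)) (trans (cong (λ k → ⌊ suc k /2⌋) e)
      (half-double m))

  -- When μ(z, x) ≠ 0, the power q^((l(gx)-l(z))/2) is exactly the difference between the
  -- normalisations at gx and at z, so the correction reduces to μ(z, x) p_{y,z}.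
  coeff-cterm : ∀ g x y k z → coeff (λ i → cterm g x y i z) (suc (len x)) (len y ℕ.+ k) ≡
                              ⟦ desc g z ⟧ * (μ z x * p y z k)
  coeff-cterm g x y k z = trans (coeff-scale ⟦ desc g z ⟧ (λ i → μ z x * shift j (P̂ y z) i)
    (suc (len x)) (len y ℕ.+ k))
    (cong (⟦ desc g z ⟧ ℤ.*_) (trans (coeff-scale (μ z x) (shift j (P̂ y z)) (suc (len x))
      (len y ℕ.+ k)) (by (μ-view z x))))
    where
    j = ⌊ suc (len x) ∸ len z /2⌋
    by : (Σ ℕ λ m → len x ≡ len z ℕ.+ suc (m ℕ.+ m) × μ z x ≡ P̂ z x m) ⊎
         (μ z x ≡ 0ℤ × ∀ m → len x ≢ len z ℕ.+ suc (m ℕ.+ m)) →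
         μ z x * coeff (shift j (P̂ y z)) (suc (len x)) (len y ℕ.+ k) ≡ μ z x * p y z k
    by (inj₂ (e , _)) = trans (cong (ℤ._* coeff (shift j (P̂ y z)) (suc (len x)) (len y ℕ.+ k)) e)
                              (sym (cong (ℤ._* p y z k) e))
    by (inj₁ (m , e , _)) = cong (μ z x ℤ.*_) (begin
      coeff (shift j (P̂ y z)) (suc (len x)) (len y ℕ.+ k)
        ≡⟨ cong₂ (λ j l → coeff (shift j (P̂ y z)) l (len y ℕ.+ k)) (half-shift {z} {x} e)
             (trans (cong suc e) (rearrange (len z) m)) ⟩
      coeff (shift (suc m) (P̂ y z)) (suc m ℕ.+ suc m ℕ.+ len z) (len y ℕ.+ k)
        ≡⟨ coeff-shift (suc m) (P̂ y z) (suc m ℕ.+ suc m ℕ.+ len z) (len y ℕ.+ k) ⟩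
      coeff (P̂ y z) (suc m ℕ.+ suc m ℕ.+ len z) (suc m ℕ.+ suc m ℕ.+ (len y ℕ.+ k))
        ≡⟨ coeff-cancel (P̂ y z) (suc m ℕ.+ suc m) (len z) (len y ℕ.+ k) ⟩
      p y z k ∎)
      where
      open ≡-Reasoning
      rearrange : ∀ a m → suc (a ℕ.+ suc (m ℕ.+ m)) ≡ suc m ℕ.+ suc m ℕ.+ a
      rearrange = ℕSolver.solve-∀

  module _ (g : Gen) (x : Alcove) (x≤N : len x ≤ N) (gx : desc g x ≡ false) (y : Alcove) where

    private
      m : ℕ
      m = suc (len x)

      c : ℕ → Alcove → ℤ
      c k z = ⟦ desc g z ⟧ * (μ z x * p y z k)

    corr : ℕ → ℤ
    corr k = ∑ E (c k)

    move : ∀ a b c → a ≡ b - c → a + c ≡ b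
    move a b c e = trans (cong (ℤ._+ c) e) (cancel′ b c)
      where
      cancel′ : ∀ b c → b - c + c ≡ b
      cancel′ = solve-∀

    p-act : ∀ k → p y (act g x) k ≡ coeff (P̂ y (act g x)) m (len y ℕ.+ k)
    p-act k = cong (λ l → coeff (P̂ y (act g x)) l (len y ℕ.+ k)) (len-up g x gx)

    step-up : desc g y ≡ false → ∀ k → p y (act g x) k + corr k ≡ p (act g y) x k + X (p y x) k
    step-up gy k = move (p y (act g x) k) _ (corr k) (begin
      p y (act g x) k
        ≡⟨ p-act k ⟩
      coeff (P̂ y (act g x)) m (len y ℕ.+ k)
        ≡⟨ coeff-cong (λ i → Total.up g x x≤N gx y i gy) m (len y ℕ.+ k) ⟩
      coeff (λ i → (X (P̂ (act g y) x) i + P̂ y x i) - ∑ E (cterm g x y i)) m (len y ℕ.+ k)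
        ≡⟨ coeff-linear E (X (P̂ (act g y) x)) (P̂ y x) (λ z i → cterm g x y i z) m (len y ℕ.+ k) ⟩
      (coeff (X (P̂ (act g y) x)) m (len y ℕ.+ k) + coeff (P̂ y x) m (len y ℕ.+ k))
        - ∑ E (λ z → coeff (λ i → cterm g x y i z) m (len y ℕ.+ k))
        ≡⟨ cong₂ _-_ (cong₂ _+_ first (second k)) (∑-cong E (coeff-cterm g x y k)) ⟩
      (p (act g y) x k + X (p y x) k) - corr k ∎)
      where
      open ≡-Reasoning
      first : coeff (X (P̂ (act g y) x)) m (len y ℕ.+ k) ≡ p (act g y) x k
      first = trans (coeff-shift1 (P̂ (act g y) x) m (len y ℕ.+ k))
                    (cong (λ l → coeff (P̂ (act g y) x) (len x) (l ℕ.+ k)) (sym (len-up g y gy)))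
      second : ∀ k → coeff (P̂ y x) m (len y ℕ.+ k) ≡ X (p y x) k
      second (suc k) = cong (coeff (P̂ y x) m) (ℕₚ.+-suc (len y) k)
      second zero with y ≟ x
      ... | no ne = by (coeff-view m (len y ℕ.+ 0))
        where
        by : (Σ ℕ λ i → m ≡ i ℕ.+ i ℕ.+ (len y ℕ.+ 0) × ∀ f → coeff f m (len y ℕ.+ 0) ≡ f i) ⊎
             ((∀ f → coeff f m (len y ℕ.+ 0) ≡ 0ℤ) × ∀ i → m ≢ i ℕ.+ i ℕ.+ (len y ℕ.+ 0)) →
             coeff (P̂ y x) m (len y ℕ.+ 0) ≡ 0ℤ
        by (inj₂ (z , _)) = z _
        by (inj₁ (i , e , v)) = trans (v _) (degree (suc (len x)) x (ℕₚ.n<1+n _) x≤N y ne i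
          (ℕₚ.≤-trans (ℕₚ.n≤1+n (len x)) (ℕₚ.≤-reflexive (trans e
            (trans (ℕₚ.+-comm (i ℕ.+ i) _) (cong (ℕ._+ (i ℕ.+ i)) (ℕₚ.+-identityʳ (len y))))))))
      ... | yes refl = by (coeff-view m (len y ℕ.+ 0))
        where
        by : (Σ ℕ λ i → m ≡ i ℕ.+ i ℕ.+ (len y ℕ.+ 0) × ∀ f → coeff f m (len y ℕ.+ 0) ≡ f i) ⊎
             ((∀ f → coeff f m (len y ℕ.+ 0) ≡ 0ℤ) × ∀ i → m ≢ i ℕ.+ i ℕ.+ (len y ℕ.+ 0)) →
             coeff (P̂ y y) m (len y ℕ.+ 0) ≡ 0ℤ
        by (inj₂ (z , _)) = z _
        by (inj₁ (zero , e , v)) = ⊥-elim (ℕₚ.1+n≢n (trans e (ℕₚ.+-identityʳ (len y))))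
        by (inj₁ (suc i , e , v)) = trans (v _) (diagonal (nf y) (suc i))

    step-down : desc g y ≡ true → ∀ k → p y (act g x) k + corr k ≡ p (act g y) x k + p y x (suc k)
    step-down gy k = move (p y (act g x) k) _ (corr k) (begin
      p y (act g x) k
        ≡⟨ p-act k ⟩
      coeff (P̂ y (act g x)) m (len y ℕ.+ k)
        ≡⟨ coeff-cong (λ i → Total.down g x x≤N gx y i gy) m (len y ℕ.+ k) ⟩
      coeff (λ i → (P̂ (act g y) x i + X (P̂ y x) i) - ∑ E (cterm g x y i)) m (len y ℕ.+ k)
        ≡⟨ coeff-linear E (P̂ (act g y) x) (X (P̂ y x)) (λ z i → cterm g x y i z) m (len y ℕ.+ k) ⟩
      (coeff (P̂ (act g y) x) m (len y ℕ.+ k) + coeff (X (P̂ y x)) m (len y ℕ.+ k))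
        - ∑ E (λ z → coeff (λ i → cterm g x y i z) m (len y ℕ.+ k))
        ≡⟨ cong₂ _-_ (cong₂ _+_ first second) (∑-cong E (coeff-cterm g x y k)) ⟩
      (p (act g y) x k + p y x (suc k)) - corr k ∎)
      where
      open ≡-Reasoning
      first : coeff (P̂ (act g y) x) m (len y ℕ.+ k) ≡ p (act g y) x k
      first = cong (λ l → coeff (P̂ (act g y) x) m (l ℕ.+ k)) (sym (len-down g y gy))
      second : coeff (X (P̂ y x)) m (len y ℕ.+ k) ≡ p y x (suc k)
      second = trans (coeff-shift1 (P̂ y x) m (len y ℕ.+ k))
                     (cong (coeff (P̂ y x) (len x)) (sym (ℕₚ.+-suc (len y) k)))

  μ-len : ∀ {y w} → μ y w ≢ 0ℤ → len y < len w
  μ-len {y} {w} ne with μ-view y w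
  ... | inj₂ (e , _) = ⊥-elim (ne e)
  ... | inj₁ (m , e , _) = subst (len y <_) (sym e) (ℕₚ.m<m+n (len y) (s≤s z≤n))

  -- In terms of P this is P_{gy,w} = P_{y,w} for g ∈ L(w). With w = gx, the recursions for gy and
  -- for y share their two main terms; their corrections agree by induction, since every z in them
  -- is shorter than x and has g as a descent.
  p-desc : ∀ n w → len w < n → len w ≤ N → ∀ g → desc g w ≡ true → ∀ y → desc g y ≡ true →
           ∀ k → p (act g y) w (suc k) ≡ p y w k
  p-desc (suc n) w (s≤s w≤n) w≤N g gw y gy k =
    subst (λ v → p (act g y) v (suc k) ≡ p y v k) (act-invol g w)
      (cancelʳ (trans (step-up g x x≤N gx (act g y) gy′ (suc k)) (trans
        (cong (λ v → p v x (suc k) + p (act g y) x k) (act-invol g y)) (trans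
        (ℤₚ.+-comm (p y x (suc k)) (p (act g y) x k)) (trans
        (sym (step-down g x x≤N gx y gy k))
        (cong (λ c → p y (act g x) k + c) (∑-cong E λ z → ⟦⟧-cong (desc g z) λ gz → sym
          (termwise z gz))))))))
    where
    x = act g w
    gx : desc g x ≡ false
    gx = trans (desc-act g w) (cong not gw)
    gy′ : desc g (act g y) ≡ false
    gy′ = trans (desc-act g y) (cong not gy)
    x<w = len-< g gw
    x≤N : len x ≤ N
    x≤N = ℕₚ.≤-trans (ℕₚ.<⇒≤ x<w) w≤N
    cancelʳ : ∀ {a b c} → a + c ≡ b + c → a ≡ b
    cancelʳ {a} {b} {c} e = trans (lemma a c) (trans (cong (ℤ._- c) e) (sym (lemma b c)))
      where
      lemma : ∀ a c → a ≡ a + c - c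
      lemma = solve-∀
    termwise : ∀ z → desc g z ≡ true → μ z x * p (act g y) z (suc k) ≡ μ z x * p y z k
    termwise z gz with μ z x ℤ.≟ 0ℤ
    ... | yes e = trans (cong (ℤ._* p (act g y) z (suc k)) e) (sym (cong (ℤ._* p y z k) e))
    ... | no ne = cong (μ z x ℤ.*_) (p-desc n z (ℕₚ.<-≤-trans z<x (ℕₚ.<⇒≤ (ℕₚ.<-≤-trans x<w w≤n))) 
                    (ℕₚ.≤-trans (ℕₚ.<⇒≤ z<x) x≤N) g gz y gy k)
      where
      z<x : len z < len x
      z<x = μ-len ne

-- Products of power series

tail : Poly → Poly
tail f k = f (suc k)

conv : Poly → Poly → Poly
conv f g zero    = f 0 * g 0
conv f g (suc k) = f (suc k) * g 0 + conv f (tail g) k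

conv-cong≤ : ∀ {f f′ g g′} k → (∀ i → i ≤ k → f i ≡ f′ i) → (∀ i → i ≤ k → g i ≡ g′ i) →
             conv f g k ≡ conv f′ g′ k
conv-cong≤ zero    e e′ = cong₂ _*_ (e 0 z≤n) (e′ 0 z≤n)
conv-cong≤ (suc k) e e′ = cong₂ _+_ (cong₂ _*_ (e (suc k) ℕₚ.≤-refl) (e′ 0 z≤n))
                            (conv-cong≤ k (λ i l → e i (ℕₚ.m≤n⇒m≤1+n l)) (λ i l → e′ (suc i) (s≤s l)))

conv-congʳ : ∀ f {g g′} k → (∀ i → g i ≡ g′ i) → conv f g k ≡ conv f g′ k
conv-congʳ f k e = conv-cong≤ k (λ _ _ → refl) (λ i _ → e i)

conv-zero : ∀ f g k → (∀ i j → i ℕ.+ j ≡ k → f i ≡ 0ℤ ⊎ g j ≡ 0ℤ) → conv f g k ≡ 0ℤ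
conv-zero f g zero h with h 0 0 refl
... | inj₁ e = cong (λ ⋆ → ⋆ * g 0) e
... | inj₂ e = trans (cong (λ ⋆ → f 0 * ⋆) e) (ℤₚ.*-zeroʳ (f 0))
conv-zero f g (suc k) h = trans (cong₂ _+_ (head (h (suc k) 0 (ℕₚ.+-identityʳ (suc k))))
    (conv-zero f (tail g) k (λ i j e → h i (suc j) (trans (ℕₚ.+-suc i j) (cong suc e))))) refl
  where
  head : f (suc k) ≡ 0ℤ ⊎ g 0 ≡ 0ℤ → f (suc k) * g 0 ≡ 0ℤ
  head (inj₁ e) = cong (λ ⋆ → ⋆ * g 0) e
  head (inj₂ e) = trans (cong (λ ⋆ → f (suc k) * ⋆) e) (ℤₚ.*-zeroʳ (f (suc k)))

conv-zeroˡ : ∀ f g k → (∀ i → f i ≡ 0ℤ) → conv f g k ≡ 0ℤ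
conv-zeroˡ f g k e = conv-zero f g k (λ i _ _ → inj₁ (e i))

conv-+ˡ : ∀ f f′ g k → conv (λ i → f i + f′ i) g k ≡ conv f g k + conv f′ g k
conv-+ˡ f f′ g zero    = ℤₚ.*-distribʳ-+ (g 0) (f 0) (f′ 0)
conv-+ˡ f f′ g (suc k) = trans (cong (λ z → (f (suc k) + f′ (suc k)) * g 0 + z)
  (conv-+ˡ f f′ (tail g) k))
    (lemma (f (suc k)) (f′ (suc k)) (g 0) _ _)
  where
  lemma : ∀ a b c d e → (a + b) * c + (d + e) ≡ (a * c + d) + (b * c + e)
  lemma = solve-∀

conv-+ʳ : ∀ f g g′ k → conv f (λ i → g i + g′ i) k ≡ conv f g k + conv f g′ k
conv-+ʳ f g g′ zero    = ℤₚ.*-distribˡ-+ (f 0) (g 0) (g′ 0)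
conv-+ʳ f g g′ (suc k) = trans (cong (λ z → f (suc k) * (g 0 + g′ 0) + z)
  (conv-+ʳ f (tail g) (tail g′) k))
    (lemma (f (suc k)) (g 0) (g′ 0) _ _)
  where
  lemma : ∀ a b c d e → a * (b + c) + (d + e) ≡ (a * b + d) + (a * c + e)
  lemma = solve-∀

conv-*ˡ : ∀ c f g k → conv (λ i → c * f i) g k ≡ c * conv f g k
conv-*ˡ c f g zero    = ℤₚ.*-assoc c (f 0) (g 0)
conv-*ˡ c f g (suc k) = trans (cong (λ z → c * f (suc k) * g 0 + z) (conv-*ˡ c f (tail g) k))
    (lemma c (f (suc k)) (g 0) _)
  where
  lemma : ∀ c a b d → c * a * b + c * d ≡ c * (a * b + d)
  lemma = solve-∀

conv-*ʳ : ∀ c f g k → conv f (λ i → c * g i) k ≡ c * conv f g k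
conv-*ʳ c f g zero    = lemma c (f 0) (g 0)
  where
  lemma : ∀ c a b → a * (c * b) ≡ c * (a * b)
  lemma = solve-∀
conv-*ʳ c f g (suc k) = trans (cong (λ z → f (suc k) * (c * g 0) + z) (conv-*ʳ c f (tail g) k))
    (lemma c (f (suc k)) (g 0) _)
  where
  lemma : ∀ c a b d → a * (c * b) + c * d ≡ c * (a * b + d)
  lemma = solve-∀

conv-∑ˡ : {Z : Set} (zs : List Z) (f : Z → Poly) (g : Poly) → ∀ k →
          conv (λ i → ∑ zs (λ z → f z i)) g k ≡ ∑ zs (λ z → conv (f z) g k)
conv-∑ˡ []       f g k = conv-zeroˡ (λ _ → 0ℤ) g k (λ _ → refl)
conv-∑ˡ (z ∷ zs) f g k = trans (conv-+ˡ (f z) (λ i → ∑ zs (λ z → f z i)) g k)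
                               (cong (λ c → conv (f z) g k + c) (conv-∑ˡ zs f g k))

conv-∑ʳ : {Z : Set} (zs : List Z) (f : Poly) (g : Z → Poly) → ∀ k →
          conv f (λ i → ∑ zs (λ z → g z i)) k ≡ ∑ zs (λ z → conv f (g z) k)
conv-∑ʳ []       f g k = conv-zero f (λ _ → 0ℤ) k (λ _ _ _ → inj₂ refl)
conv-∑ʳ (z ∷ zs) f g k = trans (conv-+ʳ f (g z) (λ i → ∑ zs (λ z → g z i)) k)
                               (cong (λ c → conv f (g z) k + c) (conv-∑ʳ zs f g k))

X-cong : ∀ {f g : Poly} → (∀ i → f i ≡ g i) → ∀ k → X f k ≡ X g k
X-cong e zero    = refl
X-cong e (suc k) = e k

X-zero : ∀ {f : Poly} → (∀ i → f i ≡ 0ℤ) → ∀ k → X f k ≡ 0ℤ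
X-zero e zero    = refl
X-zero e (suc k) = e k

conv-Xʳ : ∀ f g k → conv f (X g) k ≡ X (conv f g) k
conv-Xʳ f g zero    = ℤₚ.*-zeroʳ (f 0)
conv-Xʳ f g (suc k) = trans (cong (λ ⋆ → ⋆ + conv f g k) (ℤₚ.*-zeroʳ (f (suc k)))) (ℤₚ.+-identityˡ _)

conv-Xˡ : ∀ f g k → conv (X f) g k ≡ X (conv f g) k
conv-Xˡ f g zero          = refl
conv-Xˡ f g (suc zero)    = ℤₚ.+-identityʳ (f 0 * g 0)
conv-Xˡ f g (suc (suc k)) = cong (λ ⋆ → f (suc k) * g 0 + ⋆) (conv-Xˡ f (tail g) (suc k))

-- The inverse matrix F and its recursion

does-refl : ∀ x → does (x ≟ x) ≡ true
does-refl x with x ≟ x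
... | yes _ = refl
... | no n  = ⊥-elim (n refl)

does-≢ : ∀ {x y} → x ≢ y → does (x ≟ y) ≡ false
does-≢ {x} {y} n with x ≟ y
... | yes e = ⊥-elim (n e)
... | no _  = refl

module Inverse (P : Word → Word → Poly) (K : IsKL P) (N : ℕ) where
  open Normalised P K N public

  p′ : Alcove → Alcove → Poly
  p′ y u = tail (p y u)

  -- Up to length N the matrix p is 1 + v⁻¹p′, so its inverse satisfies F = 1 - v⁻¹p′F, where the
  -- coefficient at k + 1 needs only those up to k. The first argument is fuel for this recursion.
  approx : ℕ → Alcove → Alcove → Poly
  approx zero    y x k       = 0ℤ
  approx (suc n) y x zero    = ⟦ does (y ≟ x) ⟧
  approx (suc n) y x (suc k) = - ∑ E (λ u → conv (approx n u x) (p′ y u) k)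

  -- F u x is the coefficient of C_u in the standard basis element T_x, as a power series in v⁻¹.
  F : Alcove → Alcove → Poly
  F y x k = approx (suc k) y x k

  approx-stable : ∀ n m y x k → k < n → k < m → approx n y x k ≡ approx m y x k
  approx-stable (suc n) (suc m) y x zero    _       _       = refl
  approx-stable (suc n) (suc m) y x (suc k) (s≤s l) (s≤s l′) =
    cong -_ (∑-cong E λ u → conv-cong≤ k (λ i b → approx-stable n m u x i (ℕₚ.≤-<-trans b l)
      (ℕₚ.≤-<-trans b l′)) (λ _ _ → refl))

  F-suc : ∀ y x k → F y x (suc k) ≡ - ∑ E (λ u → conv (F u x) (p′ y u) k)
  F-suc y x k = cong -_ (∑-cong E λ u → conv-cong≤ k
    (λ i b → approx-stable (suc k) (suc i) u x i (s≤s b) (ℕₚ.n<1+n i)) (λ _ _ → refl))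

  approx-big : ∀ n y x k → len x < len y ℕ.+ k → approx n y x k ≡ 0ℤ
  approx-big zero    y x k       l = refl
  approx-big (suc n) y x zero    l = cong ⟦_⟧ (does-≢ {y} {x} λ { refl → ℕₚ.<-irrefl
    (sym (ℕₚ.+-identityʳ (len y))) l })
  approx-big (suc n) y x (suc k) l = trans (cong -_ (∑-zero E λ u → conv-zero _ _ k
    (λ i j e → by u i j e))) refl
    where
    by : ∀ u i j → i ℕ.+ j ≡ k → approx n u x i ≡ 0ℤ ⊎ p′ y u j ≡ 0ℤ
    by u i j e with len x ℕ.<? len u ℕ.+ i
    ... | yes b = inj₁ (approx-big n u x i b)
    ... | no ¬b = inj₂ (p-big y u (suc j) (ℕₚ.+-cancelʳ-< i (len u) _ (ℕₚ.≤-<-trans (ℕₚ.≮⇒≥ ¬b)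
            (subst (len x <_) (trans (cong (λ k → len y ℕ.+ suc k) (sym e))
              (rearrange (len y) i j)) l))))
      where
      rearrange : ∀ a i j → a ℕ.+ suc (i ℕ.+ j) ≡ a ℕ.+ suc j ℕ.+ i
      rearrange = ℕSolver.solve-∀

  F-big : ∀ y x k → len x < len y ℕ.+ k → F y x k ≡ 0ℤ
  F-big y x k = approx-big (suc k) y x k

  F-long : ∀ y x → len x < len y → ∀ k → F y x k ≡ 0ℤ
  F-long y x l k = F-big y x k (ℕₚ.<-≤-trans l (ℕₚ.m≤m+n (len y) k))

  F-zero-refl : ∀ x → F x x 0 ≡ 1ℤ
  F-zero-refl x = cong ⟦_⟧ (does-refl x)

  F-zero-≢ : ∀ {y x} → y ≢ x → F y x 0 ≡ 0ℤ
  F-zero-≢ ne = cong ⟦_⟧ (does-≢ ne)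

  F-one : ∀ y x → len x ≤ N → F y x 1 ≡ - μ y x
  F-one y x x≤N = trans (F-suc y x 0) (cong -_ (trans
    (∑-single {a = x} (λ u → conv (F u x) (p′ y u) 0) (ball-unique N) (∈-ball N x x≤N)
      (λ u ne → cong (λ ⋆ → ⋆ * p y u 1) (F-zero-≢ ne)))
    (trans (cong (λ ⋆ → ⋆ * p y x 1) (F-zero-refl x)) (trans (ℤₚ.*-identityˡ _) (p-one y x)))))

  Δ : Alcove → Alcove → Poly
  Δ y x zero    = ⟦ does (y ≟ x) ⟧
  Δ y x (suc k) = 0ℤ

  ∑-p-zero : ∀ (h : Alcove → ℤ) → (∀ u → N < len u → h u ≡ 0ℤ) → ∀ y → len y ≤ N →
             ∑ E (λ u → h u * p y u 0) ≡ h y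
  ∑-p-zero h hN y y≤N = trans (∑-single {a = y} (λ u → h u * p y u 0) (ball-unique N)
    (∈-ball N y y≤N) away)
                          (trans (cong (λ ⋆ → h y * ⋆) (p-refl y)) (ℤₚ.*-identityʳ (h y)))
    where
    away : ∀ u → u ≢ y → h u * p y u 0 ≡ 0ℤ
    away u ne with len u ℕ.≤? N
    ... | yes l = trans (cong (λ ⋆ → h u * ⋆) (p-zero l (λ e → ne (sym e)))) (ℤₚ.*-zeroʳ (h u))
    ... | no ¬l = cong (λ ⋆ → ⋆ * p y u 0) (hN u (ℕₚ.≰⇒> ¬l))

  F-inverse : ∀ x → len x ≤ N → ∀ y k → ∑ E (λ u → conv (F u x) (p y u) k) ≡ Δ y x k
  F-inverse x x≤N y zero = trans
      (∑-single {a = x} (λ u → F u x 0 * p y u 0) (ball-unique N) (∈-ball N x x≤N)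
        (λ u ne → cong (λ ⋆ → ⋆ * p y u 0) (F-zero-≢ ne)))
      (trans (cong (λ ⋆ → ⋆ * p y x 0) (F-zero-refl x)) (trans (ℤₚ.*-identityˡ _) p0))
    where
    p0 : p y x 0 ≡ ⟦ does (y ≟ x) ⟧
    p0 with y ≟ x
    ... | yes refl = p-refl x
    ... | no ne    = p-zero x≤N ne
  F-inverse x x≤N y (suc k) with len y ℕ.≤? N
  ... | yes y≤N = trans (∑-+ E (λ u → F u x (suc k) * p y u 0) (λ u → conv (F u x) (p′ y u) k))
                    (trans (cong₂ _+_ (trans (∑-p-zero (λ u → F u x (suc k))
                       (λ u l → F-long u x (ℕₚ.≤-<-trans x≤N l) (suc k)) y y≤N) (F-suc y x k)) refl)
                     (ℤₚ.+-inverseˡ (∑ E (λ u → conv (F u x) (p′ y u) k))))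
  -- A nonzero term would need l(y) ≤ l(u) ≤ l(x) ≤ N.
  ... | no ¬y = ∑-zero E λ u → conv-zero (F u x) (p y u) (suc k) λ i j _ → by u i j
    where
    by : ∀ u i j → F u x i ≡ 0ℤ ⊎ p y u j ≡ 0ℤ
    by u i j with len x ℕ.<? len u ℕ.+ i
    ... | yes b = inj₁ (F-big u x i b)
    ... | no ¬b = inj₂ (p-big y u j (ℕₚ.≤-<-trans (ℕₚ.m≤m+n (len u) i) (ℕₚ.≤-<-trans (ℕₚ.≮⇒≥ ¬b)
                    (ℕₚ.≤-<-trans x≤N (ℕₚ.<-≤-trans (ℕₚ.≰⇒> ¬y) (ℕₚ.m≤m+n (len y) j))))))

  -- p is the identity modulo v⁻¹, so a relation ∑ H p = 0 kills the coefficients of H one order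
  -- after the other.
  unique-zero : (H : Alcove → Poly) → (∀ u k → N < len u → H u k ≡ 0ℤ) →
                (∀ y → len y ≤ N → ∀ k → ∑ E (λ u → conv (H u) (p y u) k) ≡ 0ℤ) →
                ∀ n k → k < n → ∀ y → H y k ≡ 0ℤ
  unique-zero H HN eq (suc n) k (s≤s k≤n) y with len y ℕ.≤? N
  ... | no ¬y = HN y k (ℕₚ.≰⇒> ¬y)
  ... | yes y≤N = by k k≤n
    where
    by : ∀ k → k ≤ n → H y k ≡ 0ℤ
    by zero    _ = trans (sym (∑-p-zero (λ u → H u 0) (λ u → HN u 0) y y≤N)) (eq y y≤N 0)
    by (suc k) l = trans (sym (∑-p-zero (λ u → H u (suc k)) (λ u → HN u (suc k)) y y≤N))
      (trans (sym (ℤₚ.+-identityʳ _)) (trans (cong (λ c → ∑ E (λ u → H u (suc k) * p y u 0) + c)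
        (sym (∑-zero E λ u → conv-zero (H u) (p′ y u) k λ i j e → inj₁
          (unique-zero H HN eq n i (ℕₚ.≤-<-trans (subst (i ≤_) e (ℕₚ.m≤m+n i j)) l) u))))
        (trans (sym (∑-+ E (λ u → H u (suc k) * p y u 0) (λ u → conv (H u) (p′ y u) k)))
          (eq y y≤N (suc k)))))

  -- The substitution z = gu exchanges ascents and descents. As the ball is not stable under g, it
  -- is carried out by a double sum over the graph of u ↦ gu, with f vanishing on long descents.
  reindex : ∀ g (f : Alcove → ℤ) → (∀ u → desc g u ≡ true → N < len u → f u ≡ 0ℤ) →
            ∑ E (λ u → ⟦ desc g u ⟧ * f u) ≡ ∑ E (λ z → ⟦ not (desc g z) ⟧ * f (act g z))
  reindex g f fN = trans (∑-cong E λ u → sym (from u)) (trans (∑-swap E E _) (∑-cong E into))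
    where
    τ : Alcove → Alcove → ℤ
    τ u z = ⟦ does (z ≟ act g u) ⟧ * (⟦ desc g u ⟧ * f u)
    τ-≢ : ∀ u z → z ≢ act g u → τ u z ≡ 0ℤ
    τ-≢ u z ne = cong (λ b → ⟦ b ⟧ * (⟦ desc g u ⟧ * f u)) (does-≢ ne)
    τ-0 : ∀ u z → ⟦ desc g u ⟧ * f u ≡ 0ℤ → τ u z ≡ 0ℤ
    τ-0 u z e = trans (cong (λ ⋆ → ⟦ does (z ≟ act g u) ⟧ * ⋆) e) (ℤₚ.*-zeroʳ ⟦ does (z ≟ act g u) ⟧)
    τ-≡ : ∀ u → τ u (act g u) ≡ ⟦ desc g u ⟧ * f u
    τ-≡ u = trans (cong (λ b → ⟦ b ⟧ * (⟦ desc g u ⟧ * f u)) (does-refl (act g u))) (ℤₚ.*-identityˡ _)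
    from : ∀ u → ∑ E (τ u) ≡ ⟦ desc g u ⟧ * f u
    from u with bool? (desc g u)
    ... | inj₂ e = let z = ⟦⟧-false (f u) e in trans (∑-zero E λ v → τ-0 u v z) (sym z)
    ... | inj₁ e with len u ℕ.≤? N
    ...   | yes l = trans (∑-single (τ u) (ball-unique N)
      (∈-ball N (act g u) (ℕₚ.<⇒≤ (ℕₚ.<-≤-trans (len-< g e) l))) (τ-≢ u)) (τ-≡ u)
    ...   | no ¬l = let z = trans (⟦⟧-true (f u) e) (fN u e (ℕₚ.≰⇒> ¬l)) in trans (∑-zero E λ v → τ-0 u v z) (sym z)
    into : ∀ z → ∑ E (λ u → τ u z) ≡ ⟦ not (desc g z) ⟧ * f (act g z)
    into z with len (act g z) ℕ.≤? N
    ... | yes l = trans (∑-single (λ u → τ u z) (ball-unique N) (∈-ball N (act g z) l)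
                    (λ u ne → τ-≢ u z (λ e → ne (sym (trans (cong (act g) e) (act-invol g u))))))
                    (trans (cong (τ (act g z)) (sym (act-invol g z))) (trans (τ-≡ (act g z))
                      (cong (λ b → ⟦ b ⟧ * f (act g z)) (desc-act g z))))
    ... | no ¬l = trans (∑-zero E zero-at) (sym z0)
      where
      z0 : ⟦ not (desc g z) ⟧ * f (act g z) ≡ 0ℤ
      z0 with bool? (desc g z)
      ... | inj₁ e = ⟦⟧-false (f (act g z)) (cong not e)
      ... | inj₂ e = trans (⟦⟧-true (f (act g z)) (cong not e))
        (fN (act g z) (trans (desc-act g z) (cong not e)) (ℕₚ.≰⇒> ¬l))
      zero-at : ∀ u → τ u z ≡ 0ℤ
      zero-at u with z ≟ act g u
      ... | no ne = refl
      ... | yes refl = trans (ℤₚ.*-identityˡ _) (trans (cong₂ (λ a b → a * f b) dd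
        (sym (act-invol g u))) z0)
        where
        dd : ⟦ desc g u ⟧ ≡ ⟦ not (desc g (act g u)) ⟧
        dd = cong ⟦_⟧ (trans (cong (desc g) (sym (act-invol g u))) (desc-act g (act g u)))

  module Step (g : Gen) (x : Alcove) (gx≤N : len (act g x) ≤ N) (gx : desc g x ≡ false) where
    x<N : len x < N
    x<N = subst (_≤ N) (len-up g x gx) gx≤N

    x≤N : len x ≤ N
    x≤N = ℕₚ.<⇒≤ x<N

    Fx : Alcove → Poly
    Fx u = F u x

    above : Alcove → Poly
    above u k = ∑ E (λ z → ⟦ not (desc g z) ⟧ * (μ u z * Fx z k))

    -- v⁻¹ times the coefficient of C_u in T_gT_x = C_gT_x - v⁻¹T_x. Here T_x = ∑ F_{z,x}C_z is
    -- inserted, and C_gC_z is (v + v⁻¹)C_z if gz < z, and C_{gz} + ∑ μ(u, z)C_u over u with gu < u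
    -- otherwise. The factor v⁻¹ keeps all exponents of v nonpositive.
    lhs : Alcove → Poly
    lhs u k = ⟦ desc g u ⟧ * ((Fx u k + X (X (Fx u)) k) + X (λ k → Fx (act g u) k + above u k) k)
              + - 1ℤ * X (X (Fx u)) k

    module At (y : Alcove) where
      cv : Alcove → Alcove → Poly
      cv z u = conv (Fx z) (p y u)

      -- v⁻¹ C_g C_z has y-coordinate c z; it is computed from the two expressions for C_g C_z.
      c : Alcove → Poly
      c z k = ⟦ desc g y ⟧ * p y z k + (⟦ not (desc g y) ⟧ * X (X (p y z)) k + X (p (act g y) z) k)

      -- C_gC_z = (v + v⁻¹)C_z, which amounts to `p-desc`.
      c-desc : ∀ z → len z ≤ N → desc g z ≡ true → ∀ k → c z k ≡ p y z k + X (X (p y z)) k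
      c-desc z z≤N gz k with bool? (desc g y)
      ... | inj₁ gy rewrite gy = trans (cong₂ _+_ (ℤₚ.*-identityˡ (p y z k))
        (ℤₚ.+-identityˡ (X (p (act g y) z) k)))
                                       (cong (λ ⋆ → p y z k + ⋆) (tail-eq k))
        where
        tail-eq : ∀ k → X (p (act g y) z) k ≡ X (X (p y z)) k
        tail-eq zero          = refl
        tail-eq (suc zero)    = p-zero z≤N (λ e → true≢false (trans (cong (desc g) e) gz)
          (trans (desc-act g y) (cong not gy)))
        tail-eq (suc (suc k)) = p-desc _ z (ℕₚ.n<1+n _) z≤N g gz y gy k
      ... | inj₂ gy rewrite gy = trans (ℤₚ.+-identityˡ _) (trans (ℤₚ.+-comm _ (X (p (act g y) z) k))
                                       (cong₂ _+_ (head-eq k) (ℤₚ.*-identityˡ (X (X (p y z)) k))))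
        where
        gy′ : desc g (act g y) ≡ true
        gy′ = trans (desc-act g y) (cong not gy)
        head-eq : ∀ k → X (p (act g y) z) k ≡ p y z k
        head-eq zero    = sym (p-zero z≤N (λ e → true≢false (trans (cong (desc g) e) gz) gy))
        head-eq (suc k) = trans (sym (p-desc _ z (ℕₚ.n<1+n _) z≤N g gz (act g y) gy′ k))
                                (cong (λ v → p v z (suc k)) (act-invol g y))

      asc : Alcove → Poly
      asc z k = p y (act g z) k + ∑ E (λ u → ⟦ desc g u ⟧ * (μ u z * p y u k))

      -- C_gC_z = C_{gz} + ∑ μ(u, z)C_u, which is the recursion for p in both of its cases.
      c-asc : ∀ z → len z ≤ N → desc g z ≡ false → ∀ k → c z k ≡ X (asc z) k
      c-asc z z≤N gz k with bool? (desc g y)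
      ... | inj₁ gy rewrite gy = trans (cong₂ _+_ (ℤₚ.*-identityˡ (p y z k))
        (ℤₚ.+-identityˡ (X (p (act g y) z) k))) (go k)
        where
        go : ∀ k → p y z k + X (p (act g y) z) k ≡ X (asc z) k
        go zero    = trans (ℤₚ.+-identityʳ (p y z 0)) (p-zero z≤N
          (λ e → true≢false (trans (cong (desc g) (sym e)) gy) gz))
        go (suc k) = trans (ℤₚ.+-comm (p y z (suc k)) (p (act g y) z k))
          (sym (step-down g z z≤N gz y gy k))
      ... | inj₂ gy rewrite gy = trans (ℤₚ.+-identityˡ _)
        (trans (cong (λ ⋆ → ⋆ + X (p (act g y) z) k) (ℤₚ.*-identityˡ (X (X (p y z)) k))) (go k))
        where
        go : ∀ k → X (X (p y z)) k + X (p (act g y) z) k ≡ X (asc z) k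
        go zero    = refl
        go (suc k) = trans (ℤₚ.+-comm (X (p y z) k) (p (act g y) z k)) (sym (step-up g z z≤N gz y gy k))

      t₁₂ : ℕ → Alcove → ℤ
      t₁₂ k u = ⟦ desc g u ⟧ * (cv u u k + X (X (cv u u)) k)

      t₃ t₃′ : ℕ → Alcove → ℤ
      t₃ k u = ⟦ desc g u ⟧ * X (cv (act g u) u) k
      t₃′ k z = ⟦ not (desc g z) ⟧ * X (cv z (act g z)) k

      t₄ : ℕ → Alcove → Alcove → ℤ
      t₄ k u z = ⟦ desc g u ⟧ * (⟦ not (desc g z) ⟧ * (μ u z * X (cv z u) k))

      X-∑ : (f : Alcove → Poly) → ∀ k → X (λ k → ∑ E (λ z → f z k)) k ≡ ∑ E (λ z → X (f z) k)
      X-∑ f zero    = sym (∑-zero E (λ _ → refl))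
      X-∑ f (suc k) = refl

      X-scale : ∀ a f k → X (λ k → a * f k) k ≡ a * X f k
      X-scale a f zero    = sym (ℤₚ.*-zeroʳ a)
      X-scale a f (suc k) = refl

      X-+ : ∀ f h k → X (λ k → f k + h k) k ≡ X f k + X h k
      X-+ f h zero    = refl
      X-+ f h (suc k) = refl

      conv-XX : ∀ f h k → conv (X (X f)) h k ≡ X (X (conv f h)) k
      conv-XX f h k = trans (conv-Xˡ (X f) h k) (X-cong (conv-Xˡ f h) k)

      conv-lhs : ∀ u k → conv (lhs u) (p y u) k ≡
                 (t₁₂ k u + (t₃ k u + ∑ E (t₄ k u))) + - 1ℤ * X (X (cv u u)) k
      conv-lhs u k = begin
        conv (lhs u) (p y u) k
          ≡⟨ conv-+ˡ _ _ (p y u) k ⟩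
        conv (λ k → b * ((Fx u k + X (X (Fx u)) k) + X (λ k → Fx (act g u) k + above u k) k)) (p y u) k
          + conv (λ k → - 1ℤ * X (X (Fx u)) k) (p y u) k
          ≡⟨ cong₂ _+_ (trans (conv-*ˡ b _ (p y u) k) (cong (λ ⋆ → b * ⋆) (trans (conv-+ˡ _ _ (p y u) k)
               (cong₂ _+_ (trans (conv-+ˡ (Fx u) _ (p y u) k)
                 (cong (λ ⋆ → cv u u k + ⋆) (conv-XX (Fx u) (p y u) k)))
                            inner))))
             (trans (conv-*ˡ (- 1ℤ) _ (p y u) k) (cong (λ ⋆ → - 1ℤ * ⋆) (conv-XX (Fx u) (p y u) k))) ⟩
        b * ((cv u u k + X (X (cv u u)) k) + (X (cv (act g u) u) k + ∑ E
          (λ z → ⟦ not (desc g z) ⟧ * (μ u z * X (cv z u) k))))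
          + - 1ℤ * X (X (cv u u)) k
          ≡⟨ cong (λ ⋆ → ⋆ + - 1ℤ * X (X (cv u u)) k) (trans
            (distrib b (cv u u k + X (X (cv u u)) k) (X (cv (act g u) u) k) _)
               (cong (λ v → t₁₂ k u + (t₃ k u + v)) (sym (∑-* E b _)))) ⟩
        (t₁₂ k u + (t₃ k u + ∑ E (t₄ k u))) + - 1ℤ * X (X (cv u u)) k ∎
        where
        open ≡-Reasoning
        b = ⟦ desc g u ⟧
        distrib : ∀ b a c d → b * (a + (c + d)) ≡ b * a + (b * c + b * d)
        distrib = solve-∀
        inner : conv (X (λ k → Fx (act g u) k + above u k)) (p y u) k ≡
                X (cv (act g u) u) k + ∑ E (λ z → ⟦ not (desc g z) ⟧ * (μ u z * X (cv z u) k))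
        inner = trans (conv-Xˡ _ (p y u) k) (trans (X-cong (conv-+ˡ (Fx (act g u)) (above u) (p y u)) k)
          (trans (X-+ (cv (act g u) u) (conv (above u) (p y u)) k)
            (cong (λ ⋆ → X (cv (act g u) u) k + ⋆)
          (trans (X-cong (conv-∑ˡ E (λ z k → ⟦ not (desc g z) ⟧ * (μ u z * Fx z k)) (p y u)) k)
          (trans (X-∑ (λ z k → conv (λ k → ⟦ not (desc g z) ⟧ * (μ u z * Fx z k)) (p y u) k) k)
          (∑-cong E λ z → trans (X-cong (λ k → trans (conv-*ˡ ⟦ not (desc g z) ⟧ (λ k → μ u z * Fx z k)
            (p y u) k)
              (cong (λ ⋆ → ⟦ not (desc g z) ⟧ * ⋆) (conv-*ˡ (μ u z) (Fx z) (p y u) k))) k)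
            (trans (X-scale ⟦ not (desc g z) ⟧ (λ k → μ u z * cv z u k) k)
              (cong (λ ⋆ → ⟦ not (desc g z) ⟧ * ⋆) (X-scale (μ u z) (cv z u) k)))))))))

      conv-c : ∀ z k → conv (Fx z) (c z) k ≡ t₁₂ k z + (t₃′ k z + ∑ E (λ u → t₄ k u z))
      conv-c z k with len z ℕ.≤? N
      ... | no ¬l = trans (conv-zeroˡ (Fx z) (c z) k Fz)
        (sym (cong₂ _+_ a₁ (cong₂ _+_ a₂ (∑-zero E a₃))))
        where
        Fz : ∀ i → Fx z i ≡ 0ℤ
        Fz = F-long z x (ℕₚ.≤-<-trans x≤N (ℕₚ.≰⇒> ¬l))
        cv0 : ∀ u i → cv z u i ≡ 0ℤ
        cv0 u i = conv-zeroˡ (Fx z) (p y u) i Fz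
        a₁ : t₁₂ k z ≡ 0ℤ
        a₁ = trans (cong (λ ⋆ → ⟦ desc g z ⟧ * ⋆) (cong₂ _+_ (cv0 z k) (X-zero (X-zero (cv0 z)) k)))
          (ℤₚ.*-zeroʳ ⟦ desc g z ⟧)
        a₂ : t₃′ k z ≡ 0ℤ
        a₂ = trans (cong (λ ⋆ → ⟦ not (desc g z) ⟧ * ⋆) (X-zero (cv0 (act g z)) k))
          (ℤₚ.*-zeroʳ ⟦ not (desc g z) ⟧)
        a₃ : ∀ u → t₄ k u z ≡ 0ℤ
        a₃ u = trans (cong (λ v → ⟦ desc g u ⟧ * (⟦ not (desc g z) ⟧ * (μ u z * v))) (X-zero (cv0 u) k))
                     (lemma ⟦ desc g u ⟧ ⟦ not (desc g z) ⟧ (μ u z))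
          where
          lemma : ∀ a b c → a * (b * (c * 0ℤ)) ≡ 0ℤ
          lemma = solve-∀
      ... | yes l with bool? (desc g z)
      ...   | inj₁ gz = trans (conv-congʳ (Fx z) k (c-desc z l gz))
        (trans (conv-+ʳ (Fx z) (p y z) (X (X (p y z))) k)
              (trans (cong (λ ⋆ → cv z z k + ⋆) (trans (conv-Xʳ (Fx z) (X (p y z)) k)
                (X-cong (conv-Xʳ (Fx z) (p y z)) k)))
              (sym (trans (cong₂ _+_ (⟦⟧-true _ gz) (cong₂ _+_
                (⟦⟧-false (X (cv z (act g z)) k) (cong not gz)) (∑-zero E a₃)))
                          (ℤₚ.+-identityʳ _)))))
        where
        a₃ : ∀ u → t₄ k u z ≡ 0ℤ
        a₃ u = trans (cong (λ ⋆ → ⟦ desc g u ⟧ * ⋆) (⟦⟧-false (μ u z * X (cv z u) k) (cong not gz)))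
          (ℤₚ.*-zeroʳ ⟦ desc g u ⟧)
      ...   | inj₂ gz = trans (conv-congʳ (Fx z) k (c-asc z l gz)) (trans (conv-Xʳ (Fx z) _ k)
              (trans (X-cong (λ k → trans (conv-+ʳ (Fx z) (p y (act g z)) _ k)
                (cong (λ ⋆ → cv z (act g z) k + ⋆)
                (trans (conv-∑ʳ E (Fx z) (λ u k → ⟦ desc g u ⟧ * (μ u z * p y u k)) k)
                (∑-cong E λ u → trans (conv-*ʳ ⟦ desc g u ⟧ (Fx z) _ k)
                  (cong (λ ⋆ → ⟦ desc g u ⟧ * ⋆) (conv-*ʳ (μ u z) (Fx z) (p y u) k)))))) k)
              (trans (X-+ (cv z (act g z)) _ k)
              (sym (trans (cong₂ _+_ (⟦⟧-false (cv z z k + X (X (cv z z)) k) gz)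
                (cong₂ _+_ (⟦⟧-true (X (cv z (act g z)) k) (cong not gz)) sum))
                          (ℤₚ.+-identityˡ _))))))
        where
        sum : ∑ E (λ u → t₄ k u z) ≡ X (λ k → ∑ E (λ u → ⟦ desc g u ⟧ * (μ u z * cv z u k))) k
        sum = trans (∑-cong E λ u → cong (λ ⋆ → ⟦ desc g u ⟧ * ⋆)
          (⟦⟧-true (μ u z * X (cv z u) k) (cong not gz)))
              (sym (trans (X-∑ (λ u k → ⟦ desc g u ⟧ * (μ u z * cv z u k)) k) (∑-cong E λ u →
                trans (X-scale ⟦ desc g u ⟧ (λ k → μ u z * cv z u k) k)
                  (cong (λ ⋆ → ⟦ desc g u ⟧ * ⋆) (X-scale (μ u z) (cv z u) k)))))

      ∑-lhs : ∀ k → ∑ E (λ u → conv (lhs u) (p y u) k) ≡ ∑ E (λ z → conv (Fx z) (c z) k) + - 1ℤ * X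
        (X (Δ y x)) k
      ∑-lhs k = begin
        ∑ E (λ u → conv (lhs u) (p y u) k)
          ≡⟨ trans (∑-cong E (λ u → conv-lhs u k)) (∑-+ E _ _) ⟩
        ∑ E (λ u → t₁₂ k u + (t₃ k u + ∑ E (t₄ k u))) + ∑ E (λ u → - 1ℤ * X (X (cv u u)) k)
          ≡⟨ cong₂ _+_ regroup (trans (∑-* E (- 1ℤ) _) (cong (λ ⋆ → - 1ℤ * ⋆)
            (trans (sym (X-∑ (λ u → X (cv u u)) k))
               (X-cong (λ k → trans (sym (X-∑ (λ u → cv u u) k)) (X-cong (F-inverse x x≤N y) k)) k)))) ⟩
        ∑ E (λ z → conv (Fx z) (c z) k) + - 1ℤ * X (X (Δ y x)) k ∎
        where
        open ≡-Reasoning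
        t₃-reindex : ∑ E (t₃ k) ≡ ∑ E (t₃′ k)
        t₃-reindex = trans (reindex g (λ u → X (cv (act g u) u) k) far)
                           (∑-cong E λ z → cong (λ v → ⟦ not (desc g z) ⟧ * X (cv v (act g z)) k)
                             (act-invol g z))
          where
          far : ∀ u → desc g u ≡ true → N < len u → X (cv (act g u) u) k ≡ 0ℤ
          far u gu l = X-zero (λ k → conv-zeroˡ (Fx (act g u)) (p y u) k (F-long (act g u) x
                         (ℕₚ.<-≤-trans x<N (ℕₚ.≤-pred (subst (N <_) (sym (len-down g u gu)) l))))) k
        regroup : ∑ E (λ u → t₁₂ k u + (t₃ k u + ∑ E (t₄ k u))) ≡ ∑ E (λ z → conv (Fx z) (c z) k)
        regroup = begin
          ∑ E (λ u → t₁₂ k u + (t₃ k u + ∑ E (t₄ k u)))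
            ≡⟨ trans (∑-+ E _ _) (cong (λ ⋆ → ∑ E (t₁₂ k) + ⋆) (∑-+ E _ _)) ⟩
          ∑ E (t₁₂ k) + (∑ E (t₃ k) + ∑ E (λ u → ∑ E (t₄ k u)))
            ≡⟨ cong (λ ⋆ → ∑ E (t₁₂ k) + ⋆) (cong₂ _+_ t₃-reindex (∑-swap E E (t₄ k))) ⟩
          ∑ E (t₁₂ k) + (∑ E (t₃′ k) + ∑ E (λ z → ∑ E (λ u → t₄ k u z)))
            ≡⟨ sym (trans (∑-+ E _ _) (cong (λ ⋆ → ∑ E (t₁₂ k) + ⋆) (∑-+ E _ _))) ⟩
          ∑ E (λ z → t₁₂ k z + (t₃′ k z + ∑ E (λ u → t₄ k u z)))
            ≡⟨ ∑-cong E (λ z → sym (conv-c z k)) ⟩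
          ∑ E (λ z → conv (Fx z) (c z) k) ∎

      ∑-c : ∀ k → ∑ E (λ z → conv (Fx z) (c z) k) ≡
            ⟦ desc g y ⟧ * Δ y x k + (⟦ not (desc g y) ⟧ * X (X (Δ y x)) k + X (Δ (act g y) x) k)
      ∑-c k = begin
        ∑ E (λ z → conv (Fx z) (c z) k)
          ≡⟨ ∑-cong E (λ z → trans (conv-+ʳ (Fx z) (λ k → a * p y z k) _ k)
            (cong₂ _+_ (conv-*ʳ a (Fx z) (p y z) k)
               (trans (conv-+ʳ (Fx z) (λ k → b * X (X (p y z)) k) (X (p (act g y) z)) k)
                 (cong₂ _+_ (trans (conv-*ʳ b (Fx z) (X (X (p y z))) k) (cong (λ ⋆ → b * ⋆)
                   (trans (conv-Xʳ (Fx z) (X (p y z)) k) (X-cong (conv-Xʳ (Fx z) (p y z)) k))))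
                   (conv-Xʳ (Fx z) (p (act g y) z) k))))) ⟩
        ∑ E (λ z → a * cv z z k + (b * X (X (cv z z)) k + X (cv′ z) k))
          ≡⟨ trans (∑-+ E _ _) (cong₂ _+_ (∑-* E a _) (trans (∑-+ E _ _)
            (cong₂ _+_ (∑-* E b _) refl))) ⟩
        a * ∑ E (λ z → cv z z k) + (b * ∑ E (λ z → X (X (cv z z)) k) + ∑ E (λ z → X (cv′ z) k))
          ≡⟨ cong₂ _+_ (cong (λ ⋆ → a * ⋆) (F-inverse x x≤N y k)) (cong₂ _+_ (cong (λ ⋆ → b * ⋆)
               (trans (sym (X-∑ (λ u → X (cv u u)) k)) (X-cong
                 (λ k → trans (sym (X-∑ (λ u → cv u u) k)) (X-cong (F-inverse x x≤N y) k)) k)))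
               (trans (sym (X-∑ cv′ k)) (X-cong (F-inverse x x≤N (act g y)) k))) ⟩
        a * Δ y x k + (b * X (X (Δ y x)) k + X (Δ (act g y) x) k) ∎
        where
        open ≡-Reasoning
        a = ⟦ desc g y ⟧
        b = ⟦ not (desc g y) ⟧
        cv′ : Alcove → Poly
        cv′ z = conv (Fx z) (p (act g y) z)

      -- The coordinate at T_y of v⁻¹T_gT_x = v⁻¹T_{gx}, reached through the expansion in the basis
      -- C.
      ∑-lhs-Δ : ∀ k → ∑ E (λ u → conv (lhs u) (p y u) k) ≡ X (Δ y (act g x)) k
      ∑-lhs-Δ k = trans (∑-lhs k) (trans (cong (λ ⋆ → ⋆ + - 1ℤ * X (X (Δ y x)) k) (∑-c k)) final)
        where
        Δ-≢ : ∀ {u v} → u ≢ v → ∀ k → Δ u v k ≡ 0ℤ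
        Δ-≢ ne zero    = cong ⟦_⟧ (does-≢ ne)
        Δ-≢ ne (suc k) = refl
        final : ⟦ desc g y ⟧ * Δ y x k + (⟦ not (desc g y) ⟧ * X (X (Δ y x)) k + X (Δ (act g y) x) k)
                + - 1ℤ * X (X (Δ y x)) k ≡ X (Δ y (act g x)) k
        final with bool? (desc g y)
        ... | inj₁ gy = trans (cong₂ (λ u v → u + (⟦ not (desc g y) ⟧ * v + X (Δ (act g y) x) k) + - 1ℤ
          * v)
                          (trans (cong (λ ⋆ → ⟦ desc g y ⟧ * ⋆) (Δ-≢ y≢x k)) (ℤₚ.*-zeroʳ ⟦ desc g y ⟧))
                            (X-zero (X-zero (Δ-≢ y≢x)) k))
                        (trans (lemma ⟦ not (desc g y) ⟧ (X (Δ (act g y) x) k)) (X-cong swap k))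
          where
          y≢x : y ≢ x
          y≢x = desc-≢ g gy gx
          lemma : ∀ b v → 0ℤ + (b * 0ℤ + v) + - 1ℤ * 0ℤ ≡ v
          lemma = solve-∀
          swap : ∀ k → Δ (act g y) x k ≡ Δ y (act g x) k
          swap (suc k) = refl
          swap zero with y ≟ act g x
          ... | yes refl = cong ⟦_⟧ (trans (cong (λ v → does (v ≟ x)) (act-invol g x)) (does-refl x))
          ... | no ne    = cong ⟦_⟧ (does-≢ λ e → ne (trans (sym (act-invol g y)) (cong (act g) e)))
        ... | inj₂ gy = trans (cong₂ (λ u v → u + (v + X (Δ (act g y) x) k) + - 1ℤ * X (X (Δ y x)) k)
                          (⟦⟧-false (Δ y x k) gy) (⟦⟧-true (X (X (Δ y x)) k) (cong not gy)))
                        (trans (cong (λ w → 0ℤ + (X (X (Δ y x)) k + w) + - 1ℤ * X (X (Δ y x)) k)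
                          (X-zero (Δ-≢ gy≢x) k))
                        (trans (lemma (X (X (Δ y x)) k)) (sym (X-zero (Δ-≢ y≢gx) k))))
          where
          gy≢x : act g y ≢ x
          gy≢x = desc-≢ g (trans (desc-act g y) (cong not gy)) gx
          y≢gx : y ≢ act g x
          y≢gx e = gy≢x (trans (cong (act g) e) (act-invol g x))
          lemma : ∀ v → 0ℤ + (v + 0ℤ) + - 1ℤ * v ≡ 0ℤ
          lemma = solve-∀

    lhs-long : ∀ u k → N < len u → lhs u k ≡ 0ℤ
    lhs-long u k l = cong₂ _+_ (part (bool? (desc g u)))
      (trans (cong (λ ⋆ → - 1ℤ * ⋆) (X-zero (X-zero Fu) k)) refl)
      where
      Fu : ∀ i → Fx u i ≡ 0ℤ
      Fu = F-long u x (ℕₚ.<-trans x<N l)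
      rest : Poly
      rest k = (Fx u k + X (X (Fx u)) k) + X (λ k → Fx (act g u) k + above u k) k
      part : (desc g u ≡ true) ⊎ (desc g u ≡ false) → ⟦ desc g u ⟧ * rest k ≡ 0ℤ
      part (inj₂ gu) = ⟦⟧-false (rest k) gu
      part (inj₁ gu) = trans (cong (λ ⋆ → ⟦ desc g u ⟧ * ⋆)
        (cong₂ _+_ (cong₂ _+_ (Fu k) (X-zero (X-zero Fu) k))
          (X-zero (λ i → cong₂ _+_ (F-long (act g u) x (ℕₚ.<-≤-trans x<N
            (ℕₚ.≤-pred (subst (N <_) (sym (len-down g u gu)) l))) i)
                                  (∑-zero E (λ z → above0 i z))) k))) (ℤₚ.*-zeroʳ ⟦ desc g u ⟧)
        where
        above0 : ∀ i z → ⟦ not (desc g z) ⟧ * (μ u z * Fx z i) ≡ 0ℤ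
        above0 i z with μ u z ℤ.≟ 0ℤ
        ... | yes e = trans (cong (λ m → ⟦ not (desc g z) ⟧ * (m * Fx z i)) e)
          (ℤₚ.*-zeroʳ ⟦ not (desc g z) ⟧)
        ... | no ne = trans (cong (λ m → ⟦ not (desc g z) ⟧ * (μ u z * m))
          (F-long z x (ℕₚ.<-trans x<N (ℕₚ.<-trans l (μ-len ne))) i))
                            (trans (cong (λ ⋆ → ⟦ not (desc g z) ⟧ * ⋆) (ℤₚ.*-zeroʳ (μ u z)))
                              (ℤₚ.*-zeroʳ ⟦ not (desc g z) ⟧))

    -- Multiplied by p, both sides become v⁻¹T_{gx}, and p can be cancelled by `unique-zero`.
    lhs-F : ∀ u k → lhs u k ≡ X (F u (act g x)) k
    lhs-F u k = minus-zero (lhs u k) _ (unique-zero (λ u k → lhs u k + - 1ℤ * X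
      (F u (act g x)) k) long solves (suc k) k (ℕₚ.n<1+n k) u)
      where
      minus-zero : ∀ a b → a + - 1ℤ * b ≡ 0ℤ → a ≡ b
      minus-zero a b e = trans (lemma a b) (trans (cong (λ ⋆ → ⋆ + b) e) (ℤₚ.+-identityˡ b))
        where
        lemma : ∀ a b → a ≡ (a + - 1ℤ * b) + b
        lemma = solve-∀
      long : ∀ u k → N < len u → lhs u k + - 1ℤ * X (F u (act g x)) k ≡ 0ℤ
      long u k l = cong₂ _+_ (lhs-long u k l)
        (cong (λ ⋆ → - 1ℤ * ⋆) (X-zero (F-long u (act g x) (ℕₚ.≤-<-trans gx≤N l)) k))
      solves : ∀ y → len y ≤ N → ∀ k → ∑ E (λ u → conv (λ k → lhs u k + - 1ℤ * X (F u (act g x)) k)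
        (p y u) k) ≡ 0ℤ
      solves y _ k = begin
        ∑ E (λ u → conv (λ k → lhs u k + - 1ℤ * X (F u (act g x)) k) (p y u) k)
          ≡⟨ trans (∑-cong E (λ u → trans (conv-+ˡ (lhs u) _ (p y u) k)
            (cong (λ ⋆ → conv (lhs u) (p y u) k + ⋆)
               (trans (conv-*ˡ (- 1ℤ) (X (F u (act g x))) (p y u) k)
                 (cong (λ ⋆ → - 1ℤ * ⋆) (conv-Xˡ (F u (act g x)) (p y u) k)))))) (∑-+ E _ _) ⟩
        ∑ E (λ u → conv (lhs u) (p y u) k) + ∑ E (λ u → - 1ℤ * X (conv (F u (act g x)) (p y u)) k)
          ≡⟨ cong₂ _+_ (∑-lhs-Δ k) (trans (∑-* E (- 1ℤ) _) (cong (λ ⋆ → - 1ℤ * ⋆)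
               (trans (sym (X-∑ (λ u → conv (F u (act g x)) (p y u)) k))
                 (X-cong (F-inverse (act g x) gx≤N y) k)))) ⟩
        X (Δ y (act g x)) k + - 1ℤ * X (Δ y (act g x)) k
          ≡⟨ lemma (X (Δ y (act g x)) k) ⟩
        0ℤ ∎
        where
        open ≡-Reasoning
        open At y
        lemma : ∀ a → a + - 1ℤ * a ≡ 0ℤ
        lemma = solve-∀

    -- Every C_u occurring in C_gT_x has g ∈ L(u); for all other u only the term -v⁻¹T_x
    -- contributes.
    F-ascent : ∀ u → desc g u ≡ false → ∀ k → F u (act g x) (suc k) ≡ - F u x k
    F-ascent u gu k = trans (sym (lhs-F u (suc (suc k))))
      (trans (cong (λ ⋆ → ⋆ + - 1ℤ * Fx u k) (⟦⟧-false _ gu)) (lemma (Fx u k)))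
      where
      lemma : ∀ a → 0ℤ + - 1ℤ * a ≡ - a
      lemma = solve-∀

    F-descent : ∀ u → desc g u ≡ true → ∀ k → F u (act g x) k ≡ F u x (suc k) +
      (F (act g u) x k + above u k)
    F-descent u gu k = trans (sym (lhs-F u (suc k))) (trans (cong (λ ⋆ → ⋆ + - 1ℤ * X (Fx u) k)
        (⟦⟧-true ((Fx u (suc k) + X (Fx u) k) + (Fx (act g u) k + above u k)) gu))
          (lemma (Fx u (suc k)) (X (Fx u) k) _))
      where
      lemma : ∀ a b c → (a + b) + c + - 1ℤ * b ≡ a + c
      lemma = solve-∀

-- Identities for the leading coefficients μ

∑-one : ∀ N (f : Alcove → ℤ) a → (N < len a → f a ≡ 0ℤ) → (∀ z → z ≢ a → f z ≡ 0ℤ) → ∑ (ball N) f ≡ f a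
∑-one N f a long other with len a ℕ.≤? N
... | yes l = ∑-single f (ball-unique N) (∈-ball N a l) other
... | no ¬l = trans (∑-zero (ball N) all0) (sym (long (ℕₚ.≰⇒> ¬l)))
  where
  all0 : ∀ z → f z ≡ 0ℤ
  all0 z with z ≟ a
  ... | yes refl = long (ℕₚ.≰⇒> ¬l)
  ... | no ne    = other z ne

∑-two : ∀ N (f : Alcove → ℤ) a b → a ≢ b → (∀ z → N < len z → f z ≡ 0ℤ) →
        (∀ z → z ≢ a → z ≢ b → f z ≡ 0ℤ) → ∑ (ball N) f ≡ f a + f b
∑-two N f a b a≢b long other = trans (∑-cong (ball N) split) (trans (∑-+ (ball N) f₁ f₂)
    (cong₂ _+_ (trans (∑-one N f₁ a (λ l → trans f₁a (long a l)) (λ z ne → f₁≢ z ne)) f₁a)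
                 (trans (∑-one N f₂ b (λ l → trans f₂b (long b l)) f₂≢) f₂b)))
  where
  f₁ f₂ : Alcove → ℤ
  f₁ z = ⟦ does (z ≟ a) ⟧ * f z
  f₂ z = ⟦ not (does (z ≟ a)) ⟧ * f z
  f₁a : f₁ a ≡ f a
  f₁a = ⟦⟧-true (f a) (does-refl a)
  f₁≢ : ∀ z → z ≢ a → f₁ z ≡ 0ℤ
  f₁≢ z ne = ⟦⟧-false (f z) (does-≢ ne)
  f₂b : f₂ b ≡ f b
  f₂b = ⟦⟧-true (f b) (cong not (does-≢ λ e → a≢b (sym e)))
  f₂≢ : ∀ z → z ≢ b → f₂ z ≡ 0ℤ
  f₂≢ z ne with z ≟ a
  ... | yes e = refl
  ... | no n  = trans (ℤₚ.*-identityˡ (f z)) (other z n ne)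
  split : ∀ z → f z ≡ f₁ z + f₂ z
  split z with z ≟ a
  ... | yes _ = sym (trans (ℤₚ.+-identityʳ _) (ℤₚ.*-identityˡ (f z)))
  ... | no _  = sym (trans (ℤₚ.+-identityˡ _) (ℤₚ.*-identityˡ (f z)))

module Leading (P : Word → Word → Poly) (K : IsKL P) where

  μ : Alcove → Alcove → ℤ
  μ y w = mu P (nf y) (nf w)

  μ-< : ∀ {y w} → μ y w ≢ 0ℤ → len y < len w
  μ-< {y} {w} ne with KL.μ-view P K 0 y w
  ... | inj₂ (e , _)     = ⊥-elim (ne e)
  ... | inj₁ (m , e , _) = subst (len y <_) (sym e) (ℕₚ.m<m+n (len y) (s≤s z≤n))

  μ-long : ∀ {y w} → len w ≤ len y → μ y w ≡ 0ℤ
  μ-long {y} {w} l with μ y w ℤ.≟ 0ℤ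
  ... | yes e = e
  ... | no ne = ⊥-elim (ℕₚ.<⇒≱ (μ-< {y} {w} ne) l)

  module _ {w : Alcove} where
    open Normalised P K (len w) hiding (μ)

    -- By `p-desc`, p_{u,w} = v⁻¹p_{ku,w}. Thus μ(u, w) is a constant term of p, equal to 1 if ku =
    -- w and to 0 otherwise.
    μ-desc : ∀ k {u} → desc k w ≡ true → desc k u ≡ false → μ u w ≡ p (act k u) w 0
    μ-desc k {u} kw ku = begin
      μ u w                       ≡⟨ p-one u w ⟨
      p u w 1                     ≡⟨ cong (λ v → p v w 1) (act-invol k u) ⟨
      p (act k (act k u)) w 1     ≡⟨ p-desc _ w (ℕₚ.n<1+n _) ℕₚ.≤-refl k kw (act k u)
        (trans (desc-act k u) (cong not ku)) 0 ⟩
      p (act k u) w 0             ∎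
      where open ≡-Reasoning

    μ-desc-≢ : ∀ k {u} → desc k w ≡ true → desc k u ≡ false → act k u ≢ w → μ u w ≡ 0ℤ
    μ-desc-≢ k kw ku ne = trans (μ-desc k kw ku) (p-zero ℕₚ.≤-refl ne)

    μ-desc-≡ : ∀ k {u} → desc k u ≡ false → act k u ≡ w → μ u w ≡ 1ℤ
    μ-desc-≡ k {u} ku e = trans (μ-desc k (subst (λ v → desc k v ≡ true) e
      (trans (desc-act k u) (cong not ku))) ku)
                                (trans (cong (λ v → p v w 0) e) (p-refl w))

    p-two : ∀ k {u} → desc k w ≡ true → desc k u ≡ false → p u w 2 ≡ μ (act k u) w
    p-two k {u} kw ku = trans (cong (λ v → p v w 2) (sym (act-invol k u)))
      (trans (p-desc _ w (ℕₚ.n<1+n _) ℕₚ.≤-refl k kw (act k u) (trans (desc-act k u) (cong not ku)) 1)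
        (p-one (act k u) w))

  μ-up : ∀ k {u} → desc k u ≡ false → μ u (act k u) ≡ 1ℤ
  μ-up k ku = μ-desc-≡ k ku refl

  μ-desc-only : ∀ k {u w} → desc k w ≡ true → desc k u ≡ false → μ u w ≢ 0ℤ → act k u ≡ w
  μ-desc-only k {u} {w} kw ku ne with act k u ≟ w
  ... | yes e = e
  ... | no n  = ⊥-elim (ne (μ-desc-≢ k kw ku n))

  -- The coefficient of v⁻¹ in the recursion for p_{u,gx} with gu < u. The second-order coefficient
  -- of p_{u,x} is passed as v, to be evaluated by the caller.
  μ-step : ∀ g {x u} → desc g x ≡ false → desc g u ≡ true →
           ∀ v → Normalised.p P K (len x) u x 2 ≡ v →
           μ u (act g x) + ∑ (ball (len x)) (λ z → ⟦ desc g z ⟧ * (μ z x * μ u z)) ≡ μ (act g u) x + v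
  μ-step g {x} {u} gx gu v e = begin
    μ u (act g x) + ∑ E (λ z → ⟦ desc g z ⟧ * (μ z x * μ u z))
      ≡⟨ cong₂ _+_ (sym (p-one u (act g x))) (∑-cong E λ z → cong (λ c → ⟦ desc g z ⟧ * (μ z x * c))
        (sym (p-one u z))) ⟩
    p u (act g x) 1 + corr g x ℕₚ.≤-refl gx u 1
      ≡⟨ step-down g x ℕₚ.≤-refl gx u gu 1 ⟩
    p (act g u) x 1 + p u x 2
      ≡⟨ cong₂ _+_ (p-one (act g u) x) e ⟩
    μ (act g u) x + v ∎
    where
    open ≡-Reasoning
    open Normalised P K (len x) hiding (μ)

  -- Since h ∈ L(x) ∖ L(u), only the summands z = h x and z = h u of the correction survive.
  string : ∀ g h {x u} → desc g x ≡ false → desc h x ≡ true → desc g u ≡ true → desc h u ≡ false →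
           μ u (act g x) ≡ (μ (act g u) x + ⟦ not (desc g (act h u)) ⟧ * μ (act h u) x)
                           - ⟦ desc g (act h x) ⟧ * μ u (act h x)
  string g h {x} {u} gx hx gu hu = solve-for (desc g (act h u)) (μ u (act g x))
    (⟦ desc g (act h x) ⟧ * μ u (act h x)) (μ (act g u) x) (μ (act h u) x)
      (trans (cong (λ c → μ u (act g x) + c) (sym corr≡))
      (μ-step g {x} {u} gx gu (μ (act h u) x) (p-two h hx hu)))
    where
    f : Alcove → ℤ
    f z = ⟦ desc g z ⟧ * (μ z x * μ u z)
    f-0 : ∀ z → (μ z x ≢ 0ℤ → μ u z ≡ 0ℤ) → f z ≡ 0ℤ
    f-0 z h with μ z x ℤ.≟ 0ℤ
    ... | yes e = trans (cong (λ m → ⟦ desc g z ⟧ * (m * μ u z)) e) (ℤₚ.*-zeroʳ ⟦ desc g z ⟧)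
    ... | no ne = trans (cong (λ m → ⟦ desc g z ⟧ * (μ z x * m)) (h ne))
                    (trans (cong (λ m → ⟦ desc g z ⟧ * m) (ℤₚ.*-zeroʳ (μ z x)))
                      (ℤₚ.*-zeroʳ ⟦ desc g z ⟧))
    other : ∀ z → z ≢ act h x → z ≢ act h u → f z ≡ 0ℤ
    other z ne₁ ne₂ with bool? (desc h z)
    ... | inj₁ hz = f-0 z λ _ → μ-desc-≢ h hz hu (λ e → ne₂ (sym e))
    ... | inj₂ hz = f-0 z λ ne → ⊥-elim (ne (μ-desc-≢ h hx hz
      (λ e → ne₁ (trans (sym (act-invol h z)) (cong (act h) e)))))
    hx′ : desc h (act h x) ≡ false
    hx′ = trans (desc-act h x) (cong not hx)
    hu′ : desc h (act h u) ≡ true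
    hu′ = trans (desc-act h u) (cong not hu)
    corr≡ : ∑ (ball (len x)) f ≡ ⟦ desc g (act h x) ⟧ * μ u (act h x) + ⟦ desc g (act h u) ⟧ * μ
      (act h u) x
    corr≡ = trans (∑-two (len x) f (act h x) (act h u) (λ e → desc-≢ h hu′ hx′ (sym e))
              (λ z l → f-0 z λ ne → ⊥-elim (ne (μ-long {z} {x} (ℕₚ.<⇒≤ l)))) other)
              (cong₂ _+_ (cong (λ m → ⟦ desc g (act h x) ⟧ * m) (trans (cong (λ m → m * μ u (act h x))
                              (μ-desc-≡ h hx′ (act-invol h x))) (ℤₚ.*-identityˡ _)))
                           (cong (λ m → ⟦ desc g (act h u) ⟧ * m) (trans (cong (λ m → μ (act h u) x * m)
                              (μ-up h hu)) (ℤₚ.*-identityʳ _))))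
    -- The second-order coefficient is μ(hu, x). If g ∈ L(hu), the summand z = hu has the same value
    -- and cancels it; otherwise it survives.
    solve-for : ∀ b m a c d → m + (a + ⟦ b ⟧ * d) ≡ c + d → m ≡ (c + ⟦ not b ⟧ * d) - a
    solve-for true m a c d e = trans (lemma₁ m a d) (trans (cong (λ k → k - a - d) e) (lemma₂ c d a))
      where
      lemma₁ : ∀ m a d → m ≡ m + (a + 1ℤ * d) - a - d
      lemma₁ = solve-∀
      lemma₂ : ∀ c d a → c + d - a - d ≡ (c + 0ℤ * d) - a
      lemma₂ = solve-∀
    solve-for false m a c d e = trans (lemma₁ m a d) (trans (cong (λ k → k - a) e) (lemma₂ c d a))
      where
      lemma₁ : ∀ m a d → m ≡ m + (a + 0ℤ * d) - a
      lemma₁ = solve-∀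
      lemma₂ : ∀ c d a → c + d - a ≡ (c + 1ℤ * d) - a
      lemma₂ = solve-∀

  -- Here gu and x have equal length. This leaves no length for a z with μ(z, x) and μ(gu, z) both
  -- nonzero, and p_{gu,x} has no second-order coefficient.
  cover : ∀ g {x u} → desc g x ≡ false → desc g u ≡ false → len x ≡ suc (len u) → μ (act g u) (act g x)
    ≡ μ u x
  cover g {x} {u} gx gu l = trans (sym (ℤₚ.+-identityʳ _))
    (trans (cong (λ c → μ (act g u) (act g x) + c) (sym corr≡))
      (trans (μ-step g {x} {act g u} gx (trans (desc-act g u) (cong not gu)) 0ℤ
        (Normalised.p-big P K (len x) (act g u) x 2 short))
      (trans (ℤₚ.+-identityʳ _) (cong (λ v → μ v x) (act-invol g u)))))
    where
    lgu : len (act g u) ≡ len x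
    lgu = trans (len-up g u gu) (sym l)
    short : len x < len (act g u) ℕ.+ 2
    short = subst (λ k → len x < k ℕ.+ 2) (sym lgu) (ℕₚ.m<m+n (len x) (s≤s z≤n))
    corr≡ : ∑ (ball (len x)) (λ z → ⟦ desc g z ⟧ * (μ z x * μ (act g u) z)) ≡ 0ℤ
    corr≡ = ∑-zero (ball (len x)) zero-at
      where
      zero-at : ∀ z → ⟦ desc g z ⟧ * (μ z x * μ (act g u) z) ≡ 0ℤ
      zero-at z with len x ℕ.≤? len z
      ... | yes b = trans (cong (λ m → ⟦ desc g z ⟧ * (m * μ (act g u) z)) (μ-long {z} {x} b))
        (ℤₚ.*-zeroʳ ⟦ desc g z ⟧)
      ... | no ¬b = trans (cong (λ m → ⟦ desc g z ⟧ * (μ z x * m)) (μ-long {act g u} {z}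
                      (subst (len z ≤_) (sym lgu) (ℕₚ.<⇒≤ (ℕₚ.≰⇒> ¬b)))))
                      (trans (cong (λ m → ⟦ desc g z ⟧ * m) (ℤₚ.*-zeroʳ (μ z x)))
                        (ℤₚ.*-zeroʳ ⟦ desc g z ⟧))

-- Descent sets, braids and fully commutative elements

D ND : Gen → Alcove → Set
D g x = desc g x ≡ true
ND g x = desc g x ≡ false

clash : ∀ {A : Set} {g x} → D g x → ND g x → A
clash p q = ⊥-elim (true≢false p q)

D? : ∀ g x → D g x ⊎ ND g x
D? g x = bool? (desc g x)

toggle-D : ∀ {g x} → D g x → ND g (act g x)
toggle-D {g} {x} e = trans (desc-act g x) (cong not e)

toggle-ND : ∀ {g x} → ND g x → D g (act g x)
toggle-ND {g} {x} e = trans (desc-act g x) (cong not e)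

act-injective : ∀ g {x y} → act g x ≡ act g y → x ≡ y
act-injective g {x} {y} e = trans (sym (act-invol g x)) (trans (cong (act g) e) (act-invol g y))

transpose : ∀ g {x y} → act g x ≡ y → x ≡ act g y
transpose g {x} e = trans (sym (act-invol g x)) (cong (act g) e)

data Ends : Gen → Gen → Set where
  ends-rt : Ends r t
  ends-tr : Ends t r

flip-ends : ∀ {a b} → Ends a b → Ends b a
flip-ends ends-rt = ends-tr
flip-ends ends-tr = ends-rt

end₁ : ∀ {a b} → Ends a b → End a
end₁ ends-rt = end-r
end₁ ends-tr = end-t

end₂ : ∀ {a b} → Ends a b → End b
end₂ e = end₁ (flip-ends e)

commute : ∀ {a b} → Ends a b → ∀ x → act a (act b x) ≡ act b (act a x)
commute ends-rt x = act-rt x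
commute ends-tr x = sym (act-rt x)

desc-end : ∀ {a b} → Ends a b → ∀ x → desc a (act b x) ≡ desc a x
desc-end ends-rt = desc-rt
desc-end ends-tr = desc-tr

D-end : ∀ {a b} → Ends a b → ∀ {x} → D a x → D a (act b x)
D-end e {x} p = trans (desc-end e x) p

ND-end : ∀ {a b} → Ends a b → ∀ {x} → ND a x → ND a (act b x)
ND-end e {x} p = trans (desc-end e x) p

D-end⁻ : ∀ {a b} → Ends a b → ∀ {x} → D a (act b x) → D a x
D-end⁻ e {x} p = trans (sym (desc-end e x)) p

which : ∀ {a b} → Ends a b → ∀ g → g ≡ s ⊎ g ≡ a ⊎ g ≡ b
which ends-rt r = inj₂ (inj₁ refl)
which ends-rt s = inj₁ refl
which ends-rt t = inj₂ (inj₂ refl)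
which ends-tr r = inj₂ (inj₂ refl)
which ends-tr s = inj₁ refl
which ends-tr t = inj₂ (inj₁ refl)

which-end : ∀ {a b} → Ends a b → ∀ {h} → End h → h ≡ a ⊎ h ≡ b
which-end ends-rt end-r = inj₁ refl
which-end ends-rt end-t = inj₂ refl
which-end ends-tr end-r = inj₂ refl
which-end ends-tr end-t = inj₁ refl

not-all : ∀ {a b} → Ends a b → ∀ {x} → D s x → D a x → D b x → ⊥
not-all ends-rt {x} p q o = not-all-descents x q p o
not-all ends-tr {x} p q o = not-all-descents x o p q

some-descent : ∀ {a b} → Ends a b → ∀ {x} → x ≢ id₀ → D s x ⊎ D a x ⊎ D b x
some-descent e {x} ne with descent? x
... | inj₁ z = ⊥-elim (ne z)
... | inj₂ (g , p) with which e g
...   | inj₁ refl = inj₁ p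
...   | inj₂ (inj₁ refl) = inj₂ (inj₁ p)
...   | inj₂ (inj₂ refl) = inj₂ (inj₂ p)

module Dih {h : Gen} (e : End h) {x : Alcove} (p : D s x) (q : D h x) = Dihedral (dihedral e x p q)

-- If w = ghgh… reduced with g, h non-commuting, then also h is a left descent of w.
braid-descent : ∀ {g h} → NonComm g h → ∀ {w} → D g w → D h (act g w) → D g (act h (act g w)) →
       D h (act g (act h (act g w))) → D h w
braid-descent {g} {h} nc {w} d₁ d₂ d₃ d₄ with D? h w
... | inj₁ d = d
... | inj₂ n = ⊥-elim (ℕₚ.<-irrefl refl (begin-strict
  len w                  <⟨ ℕₚ.≤-reflexive (sym (len-up h w n)) ⟩
  len (act h w)          ≡⟨ cong len hw ⟩
  len (act g (act h (act g z))) ≤⟨ ℕₚ.≤-trans (len-act≤ g _)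
    (s≤s (ℕₚ.≤-trans (len-act≤ h _) (s≤s (len-act≤ g z)))) ⟩
  3 ℕ.+ len z            <⟨ ℕₚ.n<1+n _ ⟩
  4 ℕ.+ len z            ≡⟨ lw ⟩
  len w                  ∎))
  where
  open ℕₚ.≤-Reasoning
  z = act h (act g (act h (act g w)))
  w≡ : act g (act h (act g (act h z))) ≡ w
  w≡ = trans (cong (λ v → act g (act h (act g v))) (act-invol h _))
    (trans (cong (λ v → act g (act h v)) (act-invol g _))
       (trans (cong (act g) (act-invol h _)) (act-invol g w)))
  hw : act h w ≡ act g (act h (act g z))
  hw = trans (cong (act h) (trans (sym w≡) (nc-braid nc z))) (act-invol h _)
  lw : 4 ℕ.+ len z ≡ len w
  lw = trans (cong (3 ℕ.+_) (len-down h _ d₄)) (trans (cong (2 ℕ.+_) (len-down g _ d₃))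
       (trans (cong suc (len-down h _ d₂)) (len-down g w d₁)))

-- Elements with a reduced expression containing rsrs or stst; the others are the fully commutative elements.
data Braid : Alcove → Set where
  base : ∀ {h x} → End h → D s x → D h x → Braid x
  step : ∀ g {x} → D g x → Braid (act g x) → Braid x

FC : Alcove → Set
FC x = ¬ Braid x

braid? : ∀ x → Dec (Braid x)
braid? x = go (suc (len x)) x (ℕₚ.n<1+n _)
  where
  go : ∀ n x → len x < n → Dec (Braid x)
  below : ∀ n x → len x ≤ n → ∀ g → Dec (D g x × Braid (act g x))
  below n x l g with D? g x
  ... | inj₂ nd = no λ { (p , _) → clash p nd }
  ... | inj₁ p with go n (act g x) (ℕₚ.<-≤-trans (len-< g p) l)
  ...   | yes b = yes (p , b)
  ...   | no nb = no λ { (_ , b) → nb b }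
  go (suc n) x (s≤s l) with below n x l r | below n x l s | below n x l t
  ... | yes (p , b) | _ | _ = yes (step r p b)
  ... | no _ | yes (p , b) | _ = yes (step s p b)
  ... | no _ | no _ | yes (p , b) = yes (step t p b)
  ... | no ¬r | no ¬s | no ¬t with D? s x | D? r x | D? t x
  ...   | inj₁ p | inj₁ q | _ = yes (base end-r p q)
  ...   | inj₁ p | inj₂ _ | inj₁ q = yes (base end-t p q)
  ...   | inj₂ n | _ | _ = no λ { (base _ p _) → clash p n ; (step r p b) → ¬r (p , b) ;
    (step s p b) → ¬s (p , b) ; (step t p b) → ¬t (p , b) }
  ...   | inj₁ _ | inj₂ m | inj₂ k = no λ { (base end-r _ q) → clash q m ; (base end-t _ q) → clash q k
        ; (step r p b) → ¬r (p , b) ; (step s p b) → ¬s (p , b) ; (step t p b) → ¬t (p , b) }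

module _ {a b : Gen} (ab : Ends a b) where
  private ba = flip-ends ab

  -- A braid at the very beginning would require two descents, and any later one lies behind the
  -- only possible first letter.
  braid-only : ∀ {x} → Braid x → ∀ g → (∀ h → D h x → h ≡ g) → Braid (act g x)
  braid-only (base {h} e p q) g only with only s p | only h q
  braid-only (base end-r p q) g only | refl | ()
  braid-only (base end-t p q) g only | refl | ()
  braid-only (step h p b) g only with only h p
  ... | refl = b

  only-s : ∀ {x} → ND a x → ND b x → ∀ h → D h x → h ≡ s
  only-s na nb h p with which ab h
  ... | inj₁ e = e
  ... | inj₂ (inj₁ refl) = clash p na
  ... | inj₂ (inj₂ refl) = clash p nb

  only-a : ∀ {x} → ND s x → ND b x → ∀ h → D h x → h ≡ a
  only-a ns nb h p with which ab h
  ... | inj₁ refl = clash p ns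
  ... | inj₂ (inj₁ e) = e
  ... | inj₂ (inj₂ refl) = clash p nb

  braid-≢ : ∀ {x} → Braid x → x ≢ id₀
  braid-≢ (base _ p _) refl = clash p (desc-id₀ s)
  braid-≢ (step g p _) refl = clash p (desc-id₀ g)

  FC-down : ∀ {g u} → FC u → D g u → FC (act g u)
  FC-down f p b = f (step _ p b)

  FC-s : ∀ {h u} → End h → FC u → D s u → ND h u
  FC-s {h} {u} e f p with D? h u
  ... | inj₁ q = ⊥-elim (f (base e p q))
  ... | inj₂ n = n

  FC-h : ∀ {h u} → End h → FC u → D h u → ND s u
  FC-h {h} {u} e f p with D? s u
  ... | inj₁ q = ⊥-elim (f (base e q p))
  ... | inj₂ n = n

  -- Removing a from au leaves u. If b were a descent of au, it would be one of u as well, next to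
  -- s.
  FC-a-s : ∀ {u} → FC u → D s u → ND s (act a u) → FC (act a u)
  FC-a-s f su n (base _ p _) = clash p n
  FC-a-s {u} f su n (step g p b) with which ab g
  ... | inj₁ refl = clash p n
  ... | inj₂ (inj₁ refl) = f (subst Braid (act-invol a u) b)
  ... | inj₂ (inj₂ refl) = f (base (end₂ ab) su (D-end⁻ ba p))

  module _ {u} (f : FC u) (au : D a u) (bu : D b u) where
    both-s : ND s u
    both-s = FC-h (end₁ ab) f au

    both-as : ND s (act a u)
    both-as = FC-h (end₂ ab) (FC-down f au) (D-end ba bu)

    both-a-s : ND a (act s u)
    both-a-s with D? a (act s u)
    ... | inj₂ n = n
    ... | inj₁ p = clash (trans (cong (λ v → desc s (act a v)) (sym (act-invol s u)))
                    (Dih.d-shs (end₁ ab) (toggle-ND both-s) p)) both-as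

  FC-s-a : ∀ {u} → FC u → D a u → ND a (act s u) → (D b u → ND b (act s u)) → FC (act s u)
  FC-s-a {u} f au n nb b′ = by b′
    where
    su : D s (act s u)
    su = toggle-ND (FC-h (end₁ ab) f au)
    no-b : D b (act s u) → ⊥
    no-b p = clash p (nb (trans (cong (desc b) (sym (act-invol s u))) (Dih.d-hs (end₂ ab) su p)))
    by : Braid (act s u) → ⊥
    by (base e _ q) with which-end ab e
    ... | inj₁ refl = clash q n
    ... | inj₂ refl = no-b q
    by (step g p b′) with which ab g
    ... | inj₁ refl = f (subst Braid (act-invol s u) b′)
    ... | inj₂ (inj₁ refl) = clash p n
    ... | inj₂ (inj₂ refl) = no-b p

  -- Both a and b are descents of abu, so s is not, as no element has all three. Removing either of
  -- them leaves an element that is fully commutative by assumption.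
  FC-ab : ∀ {u} → FC (act a u) → FC (act b u) → ND a u → ND b u → FC (act a (act b u))
  FC-ab {u} fa fb na nb (base _ p _) = not-all ab p (toggle-ND (ND-end ab na)) (D-end ba (toggle-ND nb))
  FC-ab {u} fa fb na nb (step g p b′) with which ab g
  ... | inj₁ refl = not-all ab p (toggle-ND (ND-end ab na)) (D-end ba (toggle-ND nb))
  ... | inj₂ (inj₁ refl) = fb (subst Braid (act-invol a _) b′)
  ... | inj₂ (inj₂ refl) = fa (subst Braid (trans (cong (act b) (commute ab u)) (act-invol b _)) b′)

module _ {a b : Gen} (ab : Ends a b) where
  private ba = flip-ends ab

  FC-s-up : ∀ {u} → FC u → D a u → ND a (act s u) → FC (act s u)
  FC-s-up f au n = FC-s-a ab f au n (λ bu → both-a-s ba f bu au)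

  module Both {u} (f : FC u) (au : D a u) (bu : D b u) where
    s-u : ND s u
    s-u = both-s ab f au bu

    s-au : ND s (act a u)
    s-au = both-as ab f au bu

    s-bu : ND s (act b u)
    s-bu = both-as ba f bu au

    a-su : ND a (act s u)
    a-su = both-a-s ab f au bu

    b-su : ND b (act s u)
    b-su = both-a-s ba f bu au

    D-su : D s (act s u)
    D-su = toggle-ND s-u

    FC-su : FC (act s u)
    FC-su = FC-s-up f au a-su

    -- Otherwise asu begins with asas, hence u with as, and s would be a descent of au.
    s-asu : ND s (act a (act s u))
    s-asu with D? s (act a (act s u))
    ... | inj₂ n = n
    ... | inj₁ p = clash (trans (cong (λ v → desc s (act a v))
      (sym (trans (cong (act s) (act-invol a (act s u))) (act-invol s u))))
                     (Dih.d-shsh (end₁ ab) p (toggle-ND a-su))) s-au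

    FC-asu : FC (act a (act s u))
    FC-asu = FC-a-s ab FC-su D-su s-asu

  module Both₂ {u} (f : FC u) (au : D a u) (bu : D b u) where
    open Both f au bu

    FC-bsu : FC (act b (act s u))
    FC-bsu = FC-a-s ba FC-su D-su s-bsu
      where
      s-bsu : ND s (act b (act s u))
      s-bsu with D? s (act b (act s u))
      ... | inj₂ n = n
      ... | inj₁ p = clash (trans (cong (λ v → desc s (act b v))
        (sym (trans (cong (act s) (act-invol b (act s u))) (act-invol s u))))
                       (Dih.d-shsh (end₂ ab) p (toggle-ND b-su))) s-bu

    -- Prepending abs preserves the hypotheses on u. Iterated, this produces the family with a = 2;
    -- one such step from u also leads to `z₂` in the critical case.
    FC-absu : FC (act a (act b (act s u)))
    FC-absu = FC-ab ab FC-asu FC-bsu a-su b-su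

    D-a-absu : D a (act a (act b (act s u)))
    D-a-absu = toggle-ND (ND-end ab a-su)

    D-b-absu : D b (act a (act b (act s u)))
    D-b-absu = D-end ba (toggle-ND b-su)

braid-len : ∀ {x} → Braid x → 4 ≤ len x
braid-len (base {h} {x} e p q) = begin
  4                                          ≤⟨ s≤s (s≤s (s≤s (s≤s z≤n))) ⟩
  4 ℕ.+ len (act h (act s (act h (act s x)))) ≡⟨ trans (cong (3 ℕ.+_) (len-down h _ (Dih.d-hshs e p q)))
                                                 (trans (cong (2 ℕ.+_) (len-down s _ (Dih.d-shs e p q)))
                                                 (trans (cong suc (len-down h _ (Dih.d-hs e p q)))
                                                   (len-down s x p))) ⟩
  len x                                      ∎
  where open ℕₚ.≤-Reasoning
braid-len (step g p b) = ℕₚ.≤-trans (braid-len b) (ℕₚ.<⇒≤ (len-< g p))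

-- The induction step by means of the string identity

module Ideal (P : Word → Word → Poly) (K : IsKL P) where
  open Leading P K public

  -- Covers are left out because μ = 1 can occur there. No relation u < w is demanded, so the
  -- hypothesis can be applied to gu or hu without any comparison in the Bruhat order.
  Isolated : Alcove → Set
  Isolated w = ∀ u → FC u → len w ≢ suc (len u) → μ u w ≡ 0ℤ

  long-≢id : ∀ {x n} → len x ≡ suc n → x ≢ id₀
  long-≢id l refl = ℕₚ.1+n≢0 (trans (sym l) len-id₀)

  down-suc : ∀ g {x u} → D g x → D g u → len x ≡ suc (len u) → len (act g x) ≡ suc (len (act g u))
  down-suc g {x} {u} gx gu l = ℕₚ.suc-injective (trans (len-down g x gx)
    (trans l (cong suc (sym (len-down g u gu)))))

  cover-down : ∀ g {x u} → D g x → D g u → len x ≡ suc (len u) → μ u x ≡ μ (act g u) (act g x)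
  cover-down g {x} {u} gx gu l = sym (trans (sym (cover g (toggle-D gx) (toggle-D gu)
    (down-suc g gx gu l)))
                                            (cong₂ μ (act-invol g u) (act-invol g x)))

  μ-missing : ∀ g {w u} → D g w → ND g u → len w ≢ suc (len u) → μ u w ≡ 0ℤ
  μ-missing g {w} {u} gw gu ne = μ-desc-≢ g gw gu (λ e → ne (trans (cong len (sym e)) (len-up g u gu)))

  module _ {a b : Gen} (ab : Ends a b) where
    private ba = flip-ends ab

    -- Removing b from both leads to μ(bu, bz), where s is a descent of bz but not of bu. A nonzero
    -- value would mean sbz = bu; but the braid of z survives in sbz, since L(z) = {b} and L(bz) =
    -- {s}, while bu has none.
    cover-both : ∀ {z u} → FC u → D a u → D b u → Braid z → ND s z → ND a z → D b z →
                 len z ≡ suc (len u) → μ u z ≡ 0ℤ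
    cover-both {z} {u} f au bu bz sz az bz′ l = trans (cover-down b bz′ bu l)
      (μ-desc-≢ s sz₁ s-bu apart)
      where
      open Both ab f au bu
      z₁ = act b z
      Bz₁ : Braid z₁
      Bz₁ = braid-only ba bz b (only-a ba sz az)
      sz₁ : D s z₁
      sz₁ with some-descent ab (braid-≢ ba Bz₁)
      ... | inj₁ p = p
      ... | inj₂ (inj₁ p) = clash p (ND-end ab az)
      ... | inj₂ (inj₂ p) = clash p (toggle-D bz′)
      apart : act s (act b u) ≢ z₁
      apart e = FC-down ba f bu (subst Braid (trans (cong (act s) (sym e)) (act-invol s _))
               (braid-only ab Bz₁ s (only-s ab (ND-end ab az) (toggle-D bz′))))

  module Step (w : Alcove) (Bw : Braid w) (ih : ∀ v → len v < len w → Braid v → Isolated v) where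

    -- The last two terms of the string identity for w = g x cancel.
    module Rest {g h : Gen} {u : Alcove} (gw : D g w) (hx : D h (act g w)) (Bx : Braid (act g w))
                (f : FC u) (gu : D g u) (hu : ND h u) (ne : len w ≢ suc (len u))
                (f-hu : ND g (act h u) → FC (act h u))
                (B-hx : D g (act h (act g w)) → Braid (act h (act g w)))
                (case₁ : ND g (act h u) → ND g (act h (act g w)) → len (act h (act g w)) ≡ suc (len u) →
                      μ u (act h (act g w)) ≡ 0ℤ)
                (case₂ : D g (act h u) → D g (act h (act g w)) → len (act h (act g w)) ≡ suc (len u) →
                      μ u (act h (act g w)) ≡ 0ℤ) where
      x = act g w
      x₂ = act h x

      x<w : len x < len w
      x<w = len-< g gw

      x₂<w : len x₂ < len w
      x₂<w = ℕₚ.<-trans (len-< h hx) x<w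

      up-suc : len x₂ ≢ suc (len u) → len x ≢ suc (len (act h u))
      up-suc n e = n (ℕₚ.suc-injective (trans (len-down h x hx) (trans e (cong suc (len-up h u hu)))))

      cov : len x₂ ≡ suc (len u) → μ (act h u) x ≡ μ u x₂
      cov l = trans (cong (μ (act h u)) (sym (act-invol h x))) (cover h (toggle-D hx) hu l)

      -- If l(hx) ≠ l(u) + 1, both sides vanish, by induction or through their bracket. If hx is one
      -- longer than u, `cover` equates the two values of μ, and only when the two brackets differ
      -- must the common value vanish: this is what `case₁` and `case₂` provide.
      rest : (⟦ not (desc g (act h u)) ⟧ * μ (act h u) x) ≡ ⟦ desc g x₂ ⟧ * μ u x₂
      rest with D? g (act h u) | D? g x₂ | len x₂ ℕ.≟ suc (len u)
      ... | inj₁ p | inj₂ q | _ = trans (⟦⟧-false _ (cong not p)) (sym (⟦⟧-false _ q))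
      ... | inj₁ p | inj₁ q | yes l = trans (⟦⟧-false _ (cong not p))
        (sym (trans (⟦⟧-true _ q) (case₂ p q l)))
      ... | inj₁ p | inj₁ q | no n = trans (⟦⟧-false _ (cong not p))
        (sym (trans (⟦⟧-true _ q) (ih x₂ x₂<w (B-hx q) u f n)))
      ... | inj₂ p | inj₁ q | yes l = trans (⟦⟧-true _ (cong not p)) (trans (cov l) (sym (⟦⟧-true _ q)))
      ... | inj₂ p | inj₁ q | no n = trans (⟦⟧-true _ (cong not p))
        (trans (ih x x<w Bx (act h u) (f-hu p) (up-suc n))
                                       (sym (trans (⟦⟧-true _ q) (ih x₂ x₂<w (B-hx q) u f n))))
      ... | inj₂ p | inj₂ q | yes l = trans (⟦⟧-true _ (cong not p))
        (trans (cov l) (trans (case₁ p q l) (sym (⟦⟧-false _ q))))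
      ... | inj₂ p | inj₂ q | no n = trans (⟦⟧-true _ (cong not p))
        (trans (ih x x<w Bx (act h u) (f-hu p) (up-suc n))
                                       (sym (⟦⟧-false _ q)))

      first : D g u → μ (act g u) x ≡ 0ℤ
      first gu = ih x x<w Bx (act g u) (λ b → f (step g gu b))
        (λ e → ne (trans (sym (len-down g w gw)) (trans (cong suc e) (cong suc (len-down g u gu)))))

      vanishes : μ u w ≡ 0ℤ
      vanishes = trans (cong (μ u) (sym (act-invol g w))) (trans (string g h (toggle-D gw) hx gu hu)
        (trans (cong₂ (λ m n → (m + n) - ⟦ desc g x₂ ⟧ * μ u x₂) (first gu) rest)
          (lemma (⟦ desc g x₂ ⟧ * μ u x₂))))
        where
        lemma : ∀ c → (0ℤ + c) - c ≡ 0ℤ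
        lemma = solve-∀

    module _ {a b : Gen} (ab : Ends a b) where
      private ba = flip-ends ab

      -- String identity with g = s and h = a. In the exceptional covers the third generator b
      -- decides: where b ∉ L(u), or b ∉ L(su), a nonzero μ would make the longer element bu,
      -- respectively bsu, contradicting the braid or the descents of w.
      case-s : D s w → ND a w → ND b w → D a (act s w) → Isolated w
      case-s sw aw bw ax u f ne with D? s u
      ... | inj₂ su = μ-missing s sw su ne
      ... | inj₁ su = Rest.vanishes sw ax Bx f su au ne (FC-a-s ab f su) B-ax Z₁ Z₂
        where
        x = act s w
        x₂ = act a x
        Bx : Braid x
        Bx = braid-only ab Bw s (only-s ab aw bw)
        au : ND a u
        au = FC-s ab (end₁ ab) f su
        bu : ND b u
        bu = FC-s ab (end₂ ab) f su
        B-ax : D s x₂ → Braid x₂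
        B-ax p with braid? x₂
        ... | yes b = b
        ... | no n = ⊥-elim (subst FC (act-invol a x) (FC-a-s ab n p
          (subst (ND s) (sym (act-invol a x)) (toggle-D sw))) Bx)
        Z₁ : ND s (act a u) → ND s x₂ → len x₂ ≡ suc (len u) → μ u x₂ ≡ 0ℤ
        Z₁ p q l with some-descent ab (long-≢id l)
        ... | inj₁ d = clash d q
        ... | inj₂ (inj₁ d) = clash d (toggle-D ax)
        ... | inj₂ (inj₂ d) = μ-desc-≢ b d bu apart
          where
          apart : act b u ≢ x₂
          apart e = subst FC (trans (cong (act a) e) (act-invol a x))
            (FC-ab ab (FC-a-s ab f su p) (FC-a-s ba f su (subst (ND s) (sym e) q)) au bu) Bx
        Z₂ : D s (act a u) → D s x₂ → len x₂ ≡ suc (len u) → μ u x₂ ≡ 0ℤ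
        Z₂ p q l = trans (cover-down s q su l) (by (D? b (act s u)))
          where
          x₃ = act s x₂
          ax₃ : ND a x₃
          ax₃ with D? a x₃
          ... | inj₂ n = n
          ... | inj₁ d = clash (braid-descent (s-end (end₁ ab)) sw ax q d) aw
          a-su : D a (act s u)
          a-su = trans (cong (λ v → desc a (act s v)) (sym (act-invol a u)))
            (Dih.d-hsh (end₁ ab) p (toggle-ND au))
          b-x₃ : D b x₃
          b-x₃ with some-descent ab {x₃} (long-≢id (down-suc s q su l))
          ... | inj₁ d = clash d (toggle-D q)
          ... | inj₂ (inj₁ d) = clash d ax₃
          ... | inj₂ (inj₂ d) = d
          by : D b (act s u) ⊎ ND b (act s u) → μ (act s u) x₃ ≡ 0ℤ
          by (inj₁ d) = ⊥-elim (FC-down ab (FC-down ab f su) a-su (base (end₂ ab)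
            (trans (cong (λ v → desc s (act a (act s v))) (sym (act-invol a u)))
              (Dih.d-shsh (end₁ ab) p (toggle-ND au)))
            (D-end ba d)))
          by (inj₂ n) = μ-desc-≢ b b-x₃ n λ e → clash (subst (D a) e (D-end ab a-su)) ax₃

      -- String identity with g = a and h = s. In the exceptional covers b must be a descent of the
      -- longer element; if it is one of u too, `cover-both` settles the first of them.
      case-a : D a w → ND s w → ND b w → Isolated w
      case-a aw sw bw u f ne with D? a u
      ... | inj₂ au = μ-missing a aw au ne
      ... | inj₁ au = Rest.vanishes aw sx Bx f au su ne (FC-s-up ab f au) (λ _ → Bx₂) Z₁ Z₂
        where
        x = act a w
        x₂ = act s x
        Bx : Braid x
        Bx = braid-only ab Bw a (only-a ab sw bw)
        ax : ND a x
        ax = toggle-D aw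
        bx : ND b x
        bx = ND-end ba bw
        sx : D s x
        sx with some-descent ab (braid-≢ ab Bx)
        ... | inj₁ p = p
        ... | inj₂ (inj₁ p) = clash p ax
        ... | inj₂ (inj₂ p) = clash p bx
        Bx₂ : Braid x₂
        Bx₂ = braid-only ab Bx s (only-s ab ax bx)
        su : ND s u
        su = FC-h ab (end₁ ab) f au
        fau : FC (act a u)
        fau = FC-down ab f au
        Z₁ : ND a (act s u) → ND a x₂ → len x₂ ≡ suc (len u) → μ u x₂ ≡ 0ℤ
        Z₁ p q l with some-descent ab (long-≢id l)
        ... | inj₁ d = clash d (toggle-D sx)
        ... | inj₂ (inj₁ d) = clash d q
        ... | inj₂ (inj₂ d) with D? b u
        ...   | inj₁ bu = cover-both ab f au bu Bx₂ (toggle-D sx) q d l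
        ...   | inj₂ bu = μ-desc-≢ b d bu λ e → clash (subst (D a) e (D-end ab au)) q
        Z₂ : D a (act s u) → D a x₂ → len x₂ ≡ suc (len u) → μ u x₂ ≡ 0ℤ
        Z₂ p q l = trans (cover-down a q au l) (by (D? b (act a u)))
          where
          x₃ = act a x₂
          sx₃ : ND s x₃
          sx₃ with D? s x₃
          ... | inj₂ n = n
          ... | inj₁ d = clash (braid-descent (end-s (end₁ ab)) aw sx q d) sw
          s-au : D s (act a u)
          s-au = trans (cong (λ v → desc s (act a v)) (sym (act-invol s u)))
            (Dih.d-shs (end₁ ab) (toggle-ND su) p)
          b-x₃ : D b x₃
          b-x₃ with some-descent ab {x₃} (long-≢id (down-suc a q au l))
          ... | inj₁ d = clash d sx₃
          ... | inj₂ (inj₁ d) = clash d (toggle-D q)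
          ... | inj₂ (inj₂ d) = d
          by : D b (act a u) ⊎ ND b (act a u) → μ (act a u) x₃ ≡ 0ℤ
          by (inj₁ d) = ⊥-elim (fau (base (end₂ ab) s-au d))
          by (inj₂ n) = μ-desc-≢ b b-x₃ n λ e → subst FC (trans (cong (act a) e) (act-invol a x₂))
            (FC-ab ab (subst FC (sym (act-invol a u)) f) (FC-a-s ba fau s-au
              (subst (ND s) (sym e) sx₃)) (toggle-D au) n) Bx₂

      -- String identity with g = b and h = s. As x = bw has both s and a as descents, every
      -- surviving μ either falls under the hypothesis or is compared at a descent that the shorter
      -- element lacks.
      case-ab : D a w → D b w → D s (act b w) → Isolated w
      case-ab aw bw sx u f ne with D? a u | D? b u
      ... | inj₂ au | _ = μ-missing a aw au ne
      ... | inj₁ _ | inj₂ bu = μ-missing b bw bu ne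
      ... | inj₁ au | inj₁ bu = trans (cong (μ u) (sym (act-invol b w)))
        (trans (string b s (toggle-D bw) sx bu s-u)
              (trans (cong₂ _-_ (cong₂ _+_ first second) third) refl))
        where
        open Both ab f au bu
        x = act b w
        x<w : len x < len w
        x<w = len-< b bw
        ax : D a x
        ax = D-end ab aw
        Bx : Braid x
        Bx = base (end₁ ab) sx ax
        first : μ (act b u) x ≡ 0ℤ
        first = ih x x<w Bx (act b u) (FC-down ab f bu)
          (λ e → ne (trans (sym (len-down b w bw)) (trans (cong suc e) (cong suc (len-down b u bu)))))
        second : ⟦ not (desc b (act s u)) ⟧ * μ (act s u) x ≡ 0ℤ
        second = trans (⟦⟧-true _ (cong not b-su)) (μ-desc-≢ a ax a-su λ e → clash
          (subst (D s) (sym e) sx) s-asu)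
        third : ⟦ desc b (act s x) ⟧ * μ u (act s x) ≡ 0ℤ
        third with D? b (act s x)
        ... | inj₂ n = ⟦⟧-false _ n
        ... | inj₁ d = trans (⟦⟧-true _ d) (by (len x₂ ℕ.≟ suc (len u)))
          where
          x₂ = act s x
          a-x₂ : D a x₂
          a-x₂ = Dih.d-hs (end₁ ab) sx ax
          s-ax₂ : D s (act a x₂)
          s-ax₂ = Dih.d-shs (end₁ ab) sx ax
          by : Dec (len x₂ ≡ suc (len u)) → μ u x₂ ≡ 0ℤ
          by (no n) = ih x₂ (ℕₚ.<-trans (len-< s sx) x<w) (step a a-x₂
            (base (end₂ ab) s-ax₂ (D-end ba d))) u f n
          by (yes l) = trans (cover-down a a-x₂ au l) (μ-desc-≢ s s-ax₂ s-au λ e →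
            clash (subst (D a) (sym (transpose s e)) (Dih.d-hshs (end₁ ab) sx ax)) (toggle-D au))

-- The critical configuration w = ab·s·ab·x₂

product-0 : ∀ b m n → b ≡ false ⊎ m ≡ 0ℤ ⊎ n ≡ 0ℤ → ⟦ b ⟧ * (m * n) ≡ 0ℤ
product-0 b m n (inj₁ e) = ⟦⟧-false (m * n) e
product-0 b m n (inj₂ (inj₁ e)) = trans (cong (λ m → ⟦ b ⟧ * (m * n)) e) (ℤₚ.*-zeroʳ ⟦ b ⟧)
product-0 b m n (inj₂ (inj₂ e)) = trans (cong (λ n → ⟦ b ⟧ * (m * n)) e)
                                    (trans (cong (λ k → ⟦ b ⟧ * k) (ℤₚ.*-zeroʳ m)) (ℤₚ.*-zeroʳ ⟦ b ⟧))

product-1 : ∀ {b m} n → b ≡ true → m ≡ 1ℤ → ⟦ b ⟧ * (m * n) ≡ n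
product-1 n refl refl = trans (ℤₚ.*-identityˡ _) (ℤₚ.*-identityˡ n)

-- The one configuration in which the string identity gives no information.  Both r and t are removed
-- from w, and F u w is expanded down to x₂.

module Critical (P : Word → Word → Poly) (K : IsKL P) {a b : Gen} (ab : Ends a b) (x₂ : Alcove) where
  open Ideal P K
  private ba = flip-ends ab

  p₁ q₁ y x w : Alcove
  p₁ = act a x₂
  q₁ = act b x₂
  y = act a q₁
  x = act s y
  w = act a (act b x)

  -- `flag` breaks the symmetry between a and b: the missing case s ∈ L(p₁) ∖ L(q₁) is reduced to
  -- its first alternative by exchanging them. If s is a descent of neither, x₂ itself contains a
  -- braid.
  module Hyp (ax₂ : ND a x₂) (bx₂ : ND b x₂) (sx₂ : D s x₂) (sy : ND s y) (ax : ND a x) (bx : ND b x)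
             (Bq₁ : Braid q₁) (By : Braid y) (Bx : Braid x)
             (flag : D s q₁ ⊎ (ND s p₁ × Braid x₂))
             (ih : ∀ v → len v < len w → Braid v → Isolated v) where

    by≡p₁ : act b y ≡ p₁
    by≡p₁ = trans (cong (act b) (commute ab x₂)) (act-invol b p₁)

    y≡bp₁ : y ≡ act b p₁
    y≡bp₁ = commute ab x₂

    ay≡q₁ : act a y ≡ q₁
    ay≡q₁ = act-invol a q₁

    sx≡y : act s x ≡ y
    sx≡y = act-invol s y

    a-q₁ : ND a q₁
    a-q₁ = ND-end ab ax₂

    b-q₁ : D b q₁
    b-q₁ = toggle-ND bx₂

    a-p₁ : D a p₁
    a-p₁ = toggle-ND ax₂

    b-p₁ : ND b p₁
    b-p₁ = ND-end ba bx₂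

    a-y : D a y
    a-y = toggle-ND a-q₁

    b-y : D b y
    b-y = D-end ba b-q₁

    s-x : D s x
    s-x = toggle-ND sy

    a-bx : ND a (act b x)
    a-bx = ND-end ab ax

    b-bx : D b (act b x)
    b-bx = toggle-ND bx

    len-q₁ : len q₁ ≡ suc (len x₂)
    len-q₁ = len-up b x₂ bx₂

    len-p₁ : len p₁ ≡ suc (len x₂)
    len-p₁ = len-up a x₂ ax₂

    len-y : len y ≡ 2 ℕ.+ len x₂
    len-y = trans (len-up a q₁ a-q₁) (cong suc len-q₁)

    len-x : len x ≡ 3 ℕ.+ len x₂
    len-x = trans (len-up s y sy) (cong suc len-y)

    len-bx : len (act b x) ≡ 4 ℕ.+ len x₂
    len-bx = trans (len-up b x bx) (cong suc len-x)

    len-w : len w ≡ 5 ℕ.+ len x₂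
    len-w = trans (len-up a (act b x) a-bx) (cong suc len-bx)

    below-w : ∀ {v n} → len v ≡ n ℕ.+ len x₂ → n < 5 → len v < len w
    below-w {v} {n} e l = subst₂ _<_ (sym e) (sym len-w) (ℕₚ.+-monoˡ-< (len x₂) l)

    q₁<w : len q₁ < len w
    q₁<w = below-w {q₁} len-q₁ (s≤s (s≤s z≤n))

    y<w : len y < len w
    y<w = below-w {y} len-y (s≤s (s≤s (s≤s z≤n)))

    x<w : len x < len w
    x<w = below-w {x} len-x (s≤s (s≤s (s≤s (s≤s z≤n))))

    bx<w : len (act b x) < len w
    bx<w = below-w {act b x} len-bx ℕₚ.≤-refl

    Bbx : Braid (act b x)
    Bbx = step b b-bx (subst Braid (sym (act-invol b x)) Bx)

    module Above {z} (f : FC z) (bz : D b z) (sz : ND s z) (az : ND a z) where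
      z≢q₁ : z ≢ q₁
      z≢q₁ e = f (subst Braid (sym e) Bq₁)

      z≢ay : z ≢ act a y
      z≢ay e = z≢q₁ (trans e ay≡q₁)

      μ-z-y : μ z y ≡ 0ℤ
      μ-z-y = μ-desc-≢ a a-y az (λ e → z≢ay (transpose a e))

      s-sz : D s (act s z)
      s-sz = toggle-ND sz

      a-sz : ND a (act s z)
      a-sz with D? a (act s z)
      ... | inj₂ n = n
      ... | inj₁ p = clash (trans (cong (desc a) (sym (act-invol s z))) (Dih.d-hs (end₁ ab) s-sz p)) az

      -- b is a descent of y and of ay = q₁, but not of asz and sz, so both values of μ vanish
      -- unless sz = x₂. In that case either both terms are 1, or x₂ contains a braid and so does z
      -- = sx₂.
      remaining : Dec (act s z ≡ x₂) → ND b (act s z) →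
                  ⟦ not (desc s (act a (act s z))) ⟧ * μ (act a (act s z)) y ≡
                  ⟦ desc s (act a y) ⟧ * μ (act s z) (act a y)
      remaining (no ne) bsz = trans
        (trans (cong (λ m → ⟦ not (desc s (act a (act s z))) ⟧ * m)
          (μ-desc-≢ b b-y (ND-end ba bsz) λ e →
          ne (act-injective b (act-injective a (trans (commute ab (act s z)) e)))))
            (ℤₚ.*-zeroʳ ⟦ not (desc s (act a (act s z))) ⟧))
        (sym (trans (cong (λ m → ⟦ desc s (act a y) ⟧ * m)
          (μ-desc-≢ b (subst (D b) (sym ay≡q₁) b-q₁) bsz λ e →
          ne (act-injective b (trans e ay≡q₁)))) (ℤₚ.*-zeroʳ ⟦ desc s (act a y) ⟧)))
      remaining (yes e) bsz = by flag
        where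
        by : D s q₁ ⊎ (ND s p₁ × Braid x₂) →
             ⟦ not (desc s (act a (act s z))) ⟧ * μ (act a (act s z)) y ≡
             ⟦ desc s (act a y) ⟧ * μ (act s z) (act a y)
        to-y : act b (act a (act s z)) ≡ y
        s-asz : ND s (act a (act s z))
        by (inj₂ (_ , Bx₂)) = ⊥-elim (f (subst Braid (sym (transpose s e))
          (braid-only ab Bx₂ s (only-s ab ax₂ bx₂))))
        by (inj₁ s-q₁) = trans (⟦⟧-true (μ (act a (act s z)) y) (cong not s-asz))
          (trans (μ-desc-≡ b (ND-end ba bsz) to-y)
          (sym (trans (⟦⟧-true (μ (act s z) (act a y)) (trans (cong (desc s) ay≡q₁) s-q₁))
            (μ-desc-≡ b bsz (trans (cong (act b) e) (sym ay≡q₁))))))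
        to-y = trans (cong (λ v → act b (act a v)) e) (sym (commute ab x₂))
        s-asz with D? s (act a (act s z))
        ... | inj₂ n = n
        ... | inj₁ p = clash (trans (cong (desc a) (sym (trans (cong (act s) (act-invol a (act s z)))
          (act-invol s z))))
                         (Dih.d-hsh (end₁ ab) p (toggle-ND a-sz))) az

      μ-sz-x : ⟦ not (desc b (act s z)) ⟧ * μ (act s z) x ≡ 0ℤ
      μ-sz-x with D? b (act s z)
      ... | inj₁ p = ⟦⟧-false (μ (act s z) x) (cong not p)
      ... | inj₂ n = trans (⟦⟧-true (μ (act s z) x) (cong not n)) (trans (string s a sy a-y s-sz a-sz)
          (trans (cong₂ (λ m k → (m + k) - ⟦ desc s (act a y) ⟧ * μ (act s z) (act a y))
                   (trans (cong (λ v → μ v y) (act-invol s z)) μ-z-y) (remaining (act s z ≟ x₂) n))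
                 (lemma (⟦ desc s (act a y) ⟧ * μ (act s z) (act a y)))))
        where
        lemma : ∀ c → (0ℤ + c) - c ≡ 0ℤ
        lemma = solve-∀

      μ-z-bx : μ z (act b x) ≡ μ (act b z) x
      μ-z-bx = trans (string b s bx s-x bz sz) (trans (cong₂ (λ m k → (μ (act b z) x + m) - k) μ-sz-x
          (trans (cong (λ m → ⟦ desc b (act s x) ⟧ * m) (trans (cong (μ z) sx≡y) μ-z-y))
            (ℤₚ.*-zeroʳ ⟦ desc b (act s x) ⟧)))
          (lemma (μ (act b z) x)))
        where
        lemma : ∀ c → (c + 0ℤ) - 0ℤ ≡ c
        lemma = solve-∀

      eval-0 : ND s (act b z) → μ z (act b x) ≡ 0ℤ
      eval-0 n = trans μ-z-bx (μ-desc-≢ s s-x n λ e → clash (subst (D b) (sym (act-injective s e)) b-y)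
        (toggle-D bz))

      -- Two string identities, through x and then through y. Each further term would be nonzero
      -- only if z = ay = q₁, which contains a braid.
      eval-s : D s (act b z) → μ z (act b x) ≡ μ (act s (act b z)) y
      eval-s d = trans μ-z-bx (trans (string s a sy a-y d a-bz)
        (trans (cong₂ (λ m k → (μ (act s (act b z)) y + m) - k)
          (trans (cong (λ m → ⟦ not (desc s (act a (act b z))) ⟧ * m)
            (μ-desc-≢ b b-y (ND-end ba (toggle-D bz)) λ e →
            z≢ay (transpose a (trans (sym (trans (cong (act b) (commute ab z))
              (act-invol b (act a z)))) e))))
            (ℤₚ.*-zeroʳ ⟦ not (desc s (act a (act b z))) ⟧))
          (trans (cong (λ m → ⟦ desc s (act a y) ⟧ * m) (μ-desc-≢ b (subst (D b) (sym ay≡q₁) b-q₁)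
            (toggle-D bz) λ e →
            z≢ay (trans (sym (act-invol b z)) e))) (ℤₚ.*-zeroʳ ⟦ desc s (act a y) ⟧)))
          (lemma (μ (act s (act b z)) y))))
        where
        a-bz : ND a (act b z)
        a-bz = ND-end ab az
        lemma : ∀ c → (c + 0ℤ) - 0ℤ ≡ c
        lemma = solve-∀

    module Edge {u v} (f : FC u) (au : D a u) (bu : D b u) (f′ : FC v) (av : D a v) (bv : D b v) where
      module U = Both ab f au bu
      module V = Both ab f′ av bv

      -- Two string identities, through sv and then through v; μ(u, v) enters once with each sign.
      μ-asu-v : μ u (act b (act s v)) ≡ μ (act a (act s u)) v
      μ-asu-v = trans (string b s V.b-su V.D-su bu U.s-u)
        (trans (cong₂ (λ m k → (m + k) - ⟦ desc b (act s (act s v)) ⟧ * μ u (act s (act s v)))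
          first (trans (⟦⟧-true _ (cong not U.b-su)) second))
          (trans (cong (λ k → (0ℤ + (μ u v + μ (act a (act s u)) v)) - k)
            (trans (⟦⟧-true _ (trans (cong (desc b) (act-invol s v)) bv)) (cong (μ u) (act-invol s v))))
            (lemma (μ u v) (μ (act a (act s u)) v))))
        where
        first : μ (act b u) (act s v) ≡ 0ℤ
        first = μ-desc-≢ s V.D-su U.s-bu λ e → clash (subst (D b) (sym (act-injective s e)) bv)
          (toggle-D bu)
        second : μ (act s u) (act s v) ≡ μ u v + μ (act a (act s u)) v
        second = trans (string s a V.s-u av U.D-su U.a-su)
          (trans (cong₂ _-_ (cong₂ _+_ (cong (λ z → μ z v) (act-invol s u))
            (⟦⟧-true (μ (act a (act s u)) v) (cong not U.s-asu)))
              (⟦⟧-false (μ (act s u) (act a v)) V.s-au)) (ℤₚ.+-identityʳ _))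
        lemma : ∀ m k → (0ℤ + (m + k)) - m ≡ k
        lemma = solve-∀

      edge-≢ : act b (act a (act s u)) ≢ v → μ u (act b (act s v)) ≡ 0ℤ
      edge-≢ ne = trans μ-asu-v (μ-desc-≢ b bv (ND-end ba U.b-su) ne)

      edge-≡ : act b (act a (act s u)) ≡ v → μ u (act b (act s v)) ≡ 1ℤ
      edge-≡ e = trans μ-asu-v (μ-desc-≡ b (ND-end ba U.b-su) e)

    module Main {u} (f : FC u) (au : D a u) (bu : D b u) (u<w : len u < len w)
      (ne : len w ≢ suc (len u)) where
      open Both ab f au bu
      open Both₂ ab f au bu using (FC-bsu; FC-absu; D-a-absu; D-b-absu)

      N : ℕ
      N = len w ℕ.+ 6

      open Inverse P K N using (F; F-one; F-long; F-zero-≢; F-zero-refl; module Step)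

      ≤N : ∀ {v} → len v ≤ len w → len v ≤ N
      ≤N l = ℕₚ.≤-trans l (ℕₚ.m≤m+n (len w) 6)

      ascent : ∀ g v → len (act g v) ≤ len w → ND g v → ∀ z → ND g z → ∀ k → F z (act g v) (suc k)
        ≡ - F z v k
      ascent g v l gv z gz k = Step.F-ascent g v (≤N {act g v} l) gv z gz k

      summand : Gen → Alcove → Alcove → ℕ → Alcove → ℤ
      summand g v z₀ k z = ⟦ not (desc g z) ⟧ * (μ z₀ z * F z v k)

      summand-0 : ∀ g v z₀ k z → desc g z ≡ true ⊎ μ z₀ z ≡ 0ℤ ⊎ F z v k ≡ 0ℤ → summand g v z₀ k z ≡ 0ℤ
      summand-0 g v z₀ k z (inj₁ e) = product-0 (not (desc g z)) (μ z₀ z) (F z v k) (inj₁ (cong not e))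
      summand-0 g v z₀ k z (inj₂ e) = product-0 (not (desc g z)) (μ z₀ z) (F z v k) (inj₂ e)

      summand-1 : ∀ g v z₀ k z → ND g z → μ z₀ z ≡ 1ℤ → summand g v z₀ k z ≡ F z v k
      summand-1 g v z₀ k z e e′ = product-1 {not (desc g z)} {μ z₀ z} (F z v k) (cong not e) e′

      descent : ∀ g v → len (act g v) ≤ len w → ND g v → ∀ z → D g z → ∀ k →
                F z (act g v) k ≡ F z v (suc k) + (F (act g z) v k + ∑ (ball N) (summand g v z k))
      descent g v l gv z gz k = Step.F-descent g v (≤N {act g v} l) gv z gz k

      two : ∀ g v z₀ k z₁ z₂ → len v ≤ len w → z₁ ≢ z₂ →
        (∀ z → z ≢ z₁ → z ≢ z₂ → summand g v z₀ k z ≡ 0ℤ) →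
            ∑ (ball N) (summand g v z₀ k) ≡ summand g v z₀ k z₁ + summand g v z₀ k z₂
      two g v z₀ k z₁ z₂ l ne h = ∑-two N (summand g v z₀ k) z₁ z₂ ne
        (λ z b → summand-0 g v z₀ k z (inj₂ (inj₂
        (F-long z v (ℕₚ.≤-<-trans (≤N {v} l) b) k)))) h

      su asu bsu : Alcove
      su = act s u
      asu = act a su
      bsu = act b su

      u≢y : u ≢ y
      u≢y refl = f By

      -- The only descent of su is s. So a z with s ∉ L(z) and μ(su, z) ≠ 0 has a descent a or b
      -- that su lacks, whence z = asu or z = bsu. The unknown second-order term `F u y 2` is kept.
      F-su : F su x 2 ≡ - μ su x₂ + (F u y 2 + (μ asu p₁ + μ bsu q₁))
      F-su = trans (descent s y (ℕₚ.<⇒≤ x<w) sy su D-su 2)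
        (cong₂ _+_ first (cong₂ _+_ (cong (λ v → F v y 2) (act-invol s u))
               (trans (two s y su 2 asu bsu (ℕₚ.<⇒≤ y<w) (λ e → clash (subst (D a) e (toggle-ND a-su))
                 (ND-end ab a-su)) other)
                 (cong₂ _+_ (trans (summand-1 s y su 2 asu s-asu (μ-up a a-su)) at-asu)
                              (trans (summand-1 s y su 2 bsu (Both.s-asu ba f bu au)
                                (μ-up b b-su)) at-bsu)))))
        where
        first : F su y 3 ≡ - μ su x₂
        first = trans (ascent a q₁ (ℕₚ.<⇒≤ y<w) a-q₁ su a-su 2)
          (trans (cong -_ (ascent b x₂ (ℕₚ.<⇒≤ q₁<w) bx₂ su b-su 1))
                  (trans (ℤₚ.neg-involutive (F su x₂ 1)) (F-one su x₂
                    (≤N {x₂} (ℕₚ.≤-trans (ℕₚ.m≤n+m (len x₂) 5) (ℕₚ.≤-reflexive (sym len-w)))))))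
        at-asu : F asu y 2 ≡ μ asu p₁
        at-asu = trans (cong (λ v → F asu v 2) y≡bp₁) (trans
          (ascent b p₁ (subst (λ v → len v ≤ len w) y≡bp₁ (ℕₚ.<⇒≤ y<w)) b-p₁ asu (ND-end ba b-su) 1)
                   (trans (cong -_ (F-one asu p₁ (≤N {p₁} (ℕₚ.<⇒≤
                     (below-w {p₁} len-p₁ (s≤s (s≤s z≤n))))))) (ℤₚ.neg-involutive (μ asu p₁))))
        at-bsu : F bsu y 2 ≡ μ bsu q₁
        at-bsu = trans (ascent a q₁ (ℕₚ.<⇒≤ y<w) a-q₁ bsu (ND-end ab a-su) 1)
                   (trans (cong -_ (F-one bsu q₁ (≤N {q₁} (ℕₚ.<⇒≤ q₁<w))))
                     (ℤₚ.neg-involutive (μ bsu q₁)))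
        other : ∀ z → z ≢ asu → z ≢ bsu → summand s y su 2 z ≡ 0ℤ
        other z n₁ n₂ with D? a z | D? b z | D? s z
        ... | _ | _ | inj₁ p = summand-0 s y su 2 z (inj₁ p)
        ... | inj₁ p | _ | _ = summand-0 s y su 2 z (inj₂ (inj₁ (μ-desc-≢ a p a-su (λ e → n₁ (sym e)))))
        ... | _ | inj₁ p | _ = summand-0 s y su 2 z (inj₂ (inj₁ (μ-desc-≢ b p b-su (λ e → n₂ (sym e)))))
        ... | inj₂ p | inj₂ q | inj₂ o with z ≟ id₀
        ...   | yes refl = summand-0 s y su 2 z (inj₂ (inj₁
          (μ-long {su} {id₀} (subst (_≤ len su) (sym len-id₀) z≤n))))
        ...   | no n with some-descent ab n
        ...     | inj₁ d = clash d o
        ...     | inj₂ (inj₁ d) = clash d p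
        ...     | inj₂ (inj₂ d) = clash d q

      μ-u-p₁ : D s p₁ → μ u p₁ ≡ 0ℤ
      μ-u-p₁ d = μ-desc-≢ s d s-u λ e → clash (subst (D a) (sym e) a-p₁) a-su

      -- The sum over z is reduced to su and p₁. The unknown `F u y 2` enters through F u x 3 = -F u
      -- y 2 and, with the opposite sign, through `F-su`; it cancels, and only values of μ are left.
      F-u : F u (act b x) 2 ≡ (μ u p₁ + (μ asu p₁ + μ bsu q₁)) - μ su x₂
      F-u = trans (descent b x (ℕₚ.<⇒≤ bx<w) bx u bu 2) (trans
        (cong₂ _+_ (ascent s y (ℕₚ.<⇒≤ x<w) sy u s-u 2) (cong₂ _+_ F-bu
              (trans (two b x u 2 su p₁ (ℕₚ.<⇒≤ x<w) (λ e → clash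
                (subst (D a) (sym e) a-p₁) a-su) other)
                (cong₂ _+_ (trans (summand-1 b x u 2 su b-su (μ-up s s-u)) F-su) at-p₁))))
              (lemma (F u y 2) (μ su x₂) (μ asu p₁ + μ bsu q₁) (μ u p₁)))
        where
        lemma : ∀ f m k n → - f + (0ℤ + ((- m + (f + k)) + n)) ≡ (n + k) - m
        lemma = solve-∀
        F-bu : F (act b u) x 2 ≡ 0ℤ
        F-bu = trans (ascent s y (ℕₚ.<⇒≤ x<w) sy (act b u) s-bu 1)
          (trans (cong -_ (F-one (act b u) y (≤N {y} (ℕₚ.<⇒≤ y<w))))
                 (trans (ℤₚ.neg-involutive (μ (act b u) y)) (μ-desc-≢ b b-y (toggle-D bu)
                   (λ e → u≢y (trans (sym (act-invol b u)) e)))))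
        F-z : ∀ {z} → ND s z → F z x 2 ≡ μ z y
        F-z {z} sz = trans (ascent s y (ℕₚ.<⇒≤ x<w) sy z sz 1)
          (trans (cong -_ (F-one z y (≤N {y} (ℕₚ.<⇒≤ y<w)))) (ℤₚ.neg-involutive (μ z y)))
        at-p₁ : summand b x u 2 p₁ ≡ μ u p₁
        at-p₁ with D? s p₁
        ... | inj₁ d = trans (summand-0 b x u 2 p₁ (inj₂ (inj₁ (μ-u-p₁ d)))) (sym (μ-u-p₁ d))
        ... | inj₂ n = trans (⟦⟧-true _ (cong not b-p₁)) (trans (cong (λ k → μ u p₁ * k)
                         (trans (F-z n) (μ-desc-≡ b b-p₁ (sym y≡bp₁)))) (ℤₚ.*-identityʳ (μ u p₁)))
        other : ∀ z → z ≢ su → z ≢ p₁ → summand b x u 2 z ≡ 0ℤ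
        other z n₁ n₂ with D? b z | D? s z
        ... | inj₁ p | _ = summand-0 b x u 2 z (inj₁ p)
        ... | inj₂ p | inj₁ q = summand-0 b x u 2 z (inj₂ (inj₁ (μ-desc-≢ s q s-u (λ e → n₁ (sym e)))))
        ... | inj₂ p | inj₂ q = summand-0 b x u 2 z (inj₂ (inj₂ (trans (F-z q) (μ-desc-≢ b b-y p
                (λ e → n₂ (act-injective b (trans e y≡bp₁)))))))

      z₁ z₂ absu : Alcove
      absu = act a bsu
      z₁ = act b (act s p₁)
      z₂ = act b (act s absu)

      module S = Both ab FC-absu D-a-absu D-b-absu

      z₁≢z₂ : z₁ ≢ z₂
      z₁≢z₂ e = clash (subst (D b) (sym (act-injective s (act-injective b e))) D-b-absu) b-p₁

      G : Alcove → ℤ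
      G = summand a (act b x) u 1

      F-bx : ∀ z → F z (act b x) 1 ≡ - μ z (act b x)
      F-bx z = F-one z (act b x) (≤N {act b x} (ℕₚ.<⇒≤ bx<w))

      G-≡ : ∀ z → ND a z → G z ≡ - (μ u z * μ z (act b x))
      G-≡ z az = trans (⟦⟧-true (μ u z * F z (act b x) 1) (cong not az))
        (trans (cong (λ ⋆ → μ u z * ⋆) (F-bx z)) (sym (ℤₚ.neg-distribʳ-* (μ u z) (μ z (act b x)))))

      -- Only z₁ and z₂ contribute to the sum in the recursion for F u w.
      contributing : ∀ z → ND a z → μ u z ≢ 0ℤ → μ z (act b x) ≢ 0ℤ → (z ≡ z₁ × ND s p₁) ⊎ z ≡ z₂
      contributing z az n₁ n₂ with D? s z
      ... | inj₁ sz = ⊥-elim (n₂ (trans (cong (λ v → μ v (act b x)) (sym su≡z))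
        (μ-desc-≢ b b-bx b-su λ e →
                        FC-su (subst Braid (sym (act-injective b e)) Bx))))
        where
        su≡z : su ≡ z
        su≡z = μ-desc-only s sz s-u n₁
      ... | inj₂ sz with some-descent ab {z} (λ { refl → ℕₚ.n≮0
        (subst (len u <_) len-id₀ (μ-< {u} {id₀} n₁)) })
      ...   | inj₁ d = clash d sz
      ...   | inj₂ (inj₁ d) = clash d az
      ...   | inj₂ (inj₂ bz) with braid? z
      -- A braid in z contradicts μ(u, z) ≠ 0 by induction, or by `cover-both` if z is just one
      -- longer than u.
      ...     | yes Bz = ⊥-elim (n₁ (by (len z ℕ.≟ suc (len u))))
        where
        by : Dec (len z ≡ suc (len u)) → μ u z ≡ 0ℤ
        by (yes l) = cover-both ab f au bu Bz sz az bz l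
        by (no n) = ih z (ℕₚ.<-trans (μ-< {z} {act b x} n₂) bx<w) Bz u f n
      ...     | no fz with D? s (act b z)
      ...       | inj₂ n = ⊥-elim (n₂ (Above.eval-0 fz bz sz az n))
      ...       | inj₁ d = by (D? a z₃) (D? b z₃)
        where
        z₃ = act s (act b z)
        z≡ : z ≡ act b (act s z₃)
        z≡ = sym (trans (cong (act b) (act-invol s (act b z))) (act-invol b z))
        f₃ : FC z₃
        f₃ = FC-down ab (FC-down ab fz bz) d
        n₃ : μ z₃ y ≢ 0ℤ
        n₃ e = n₂ (trans (Above.eval-s fz bz sz az d) e)
        -- Now z = bsz₃ with μ(z₃, y) ≠ 0 and a, b ∈ L(y). If z₃ lacks a, then z₃ = ay contains a
        -- braid; if it lacks only b, then z₃ = by = p₁; if it has both, `Edge` leaves z₃ = absu.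
        by : D a z₃ ⊎ ND a z₃ → D b z₃ ⊎ ND b z₃ → (z ≡ z₁ × ND s p₁) ⊎ z ≡ z₂
        by (inj₂ n) _ = ⊥-elim (f₃ (subst Braid (trans (sym ay≡q₁)
          (sym (transpose a (μ-desc-only a a-y n n₃)))) Bq₁))
        by (inj₁ _) (inj₂ n) = inj₁ (trans z≡ (cong (λ v → act b (act s v)) z₃≡p₁) , subst (ND s) z₃≡p₁
          (toggle-D d))
          where
          z₃≡p₁ : z₃ ≡ p₁
          z₃≡p₁ = trans (transpose b (μ-desc-only b b-y n n₃)) by≡p₁
        by (inj₁ a₃) (inj₁ b₃) with act b (act a (act s u)) ≟ z₃
        ... | yes e = inj₂ (trans z≡ (cong (λ v → act b (act s v))
          (trans (sym e) (sym (commute ab (act s u))))))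
        ... | no n = ⊥-elim (n₁ (trans (cong (μ u) z≡) (Edge.edge-≢ f au bu f₃ a₃ b₃ n)))

      G-other : ∀ z → z ≢ z₂ → (z ≡ z₁ → D s p₁) → G z ≡ 0ℤ
      G-other z n₂ n₁ with D? a z
      ... | inj₁ p = summand-0 a (act b x) u 1 z (inj₁ p)
      ... | inj₂ az with μ u z ℤ.≟ 0ℤ | μ z (act b x) ℤ.≟ 0ℤ
      ...   | yes e | _ = summand-0 a (act b x) u 1 z (inj₂ (inj₁ e))
      ...   | no _ | yes e = summand-0 a (act b x) u 1 z (inj₂ (inj₂ (trans (F-bx z) (cong -_ e))))
      ...   | no m₁ | no m₂ with contributing z az m₁ m₂
      ...     | inj₁ (e , n) = clash (n₁ e) n
      ...     | inj₂ e = ⊥-elim (n₂ e)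

      G-z₂ : G z₂ ≡ - μ absu y
      G-z₂ = trans (G-≡ z₂ (ND-end ab S.a-su)) (cong -_ (trans (cong₂ _*_
          (Edge.edge-≡ f au bu FC-absu D-a-absu D-b-absu (sym (commute ab su)))
          (trans (Above.eval-s fz₂ (toggle-ND S.b-su) (Both.s-asu ba FC-absu D-b-absu D-a-absu)
            (ND-end ab S.a-su)
                   (subst (D s) (sym bz₂) S.D-su))
                 (cong (λ v → μ v y) (trans (cong (act s) bz₂) (act-invol s absu)))))
                   (ℤₚ.*-identityˡ (μ absu y))))
        where
        bz₂ : act b z₂ ≡ act s absu
        bz₂ = act-invol b (act s absu)
        fz₂ : FC z₂
        fz₂ = Both₂.FC-bsu ab FC-absu D-a-absu D-b-absu

      -- The part of `F-u` to be cancelled by the contribution of z₁; the remaining term μ(bsu, q₁)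
      -- is cancelled by that of z₂.
      T : ℤ
      T = (μ u p₁ + μ asu p₁) - μ su x₂

      b-sp₁ : ND s p₁ → ND b (act s p₁)
      b-sp₁ n with D? b (act s p₁)
      ... | inj₂ o = o
      ... | inj₁ d = clash (trans (cong (desc b) (sym (act-invol s p₁)))
        (Dih.d-hs (end₂ ab) (toggle-ND n) d)) b-p₁

      -- Expand μ(u, bsp₁) with h = s, then μ(su, sp₁) with h = a. The last term is present since s
      -- is a descent of ap₁ = x₂.
      T≡ : ND s p₁ → T ≡ μ u z₁
      T≡ n = sym (trans (string b s (b-sp₁ n) (toggle-ND n) bu s-u) (trans (cong₂ _-_ (cong₂ _+_ first
          (trans (⟦⟧-true _ (cong not b-su)) second)) (⟦⟧-false (μ u (act s (act s p₁)))
            (trans (cong (desc b) (act-invol s p₁)) b-p₁)))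
          (lemma T)))
        where
        lemma : ∀ m → (0ℤ + m) - 0ℤ ≡ m
        lemma = solve-∀
        first : μ (act b u) (act s p₁) ≡ 0ℤ
        first = μ-desc-≢ s (toggle-ND n) s-bu λ e → u≢y (trans (transpose b (act-injective s e))
          (sym y≡bp₁))
        second : μ su (act s p₁) ≡ T
        second = trans (string s a n a-p₁ D-su a-su) (cong₂ _-_
          (cong₂ _+_ (cong (λ v → μ v p₁) (act-invol s u))
            (⟦⟧-true (μ asu p₁) (cong not s-asu)))
            (trans (⟦⟧-true (μ su (act a p₁)) (trans (cong (desc s) (act-invol a x₂)) sx₂))
              (cong (μ su) (act-invol a x₂))))

      -- μ(z₁, bx) = μ(p₁, y) = 1 if z₁ is fully commutative, so its contribution is -μ(u, z₁). If
      -- z₁ contains a braid, then μ(u, z₁) = 0 and both terms vanish.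
      T+G-z₁ : ND s p₁ → T + G z₁ ≡ 0ℤ
      T+G-z₁ n = trans (cong (λ ⋆ → ⋆ + G z₁) (T≡ n)) (by (braid? z₁))
        where
        s-sp₁ : D s (act s p₁)
        s-sp₁ = toggle-ND n
        b-z₁ : D b z₁
        b-z₁ = toggle-ND (b-sp₁ n)
        bz₁ : act b z₁ ≡ act s p₁
        bz₁ = act-invol b (act s p₁)
        len-z₁ : len z₁ ≡ 3 ℕ.+ len x₂
        len-z₁ = trans (len-up b _ (b-sp₁ n)) (cong suc (trans (len-up s p₁ n) (cong suc len-p₁)))
        by : Dec (Braid z₁) → μ u z₁ + G z₁ ≡ 0ℤ
        by (yes B) = cong₂ _+_ zero₁ (summand-0 a (act b x) u 1 z₁ (inj₂ (inj₁ zero₁)))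
          where
          zero₁ : μ u z₁ ≡ 0ℤ
          zero₁ with len z₁ ℕ.≟ suc (len u)
          ... | no m = ih z₁ (below-w {z₁} len-z₁ (s≤s (s≤s (s≤s (s≤s z≤n))))) B u f m
          ... | yes l = trans (cover-down b b-z₁ bu l) (μ-desc-≢ s
            (subst (D s) (sym bz₁) s-sp₁) s-bu λ e →
                  u≢y (trans (transpose b (act-injective s (trans e bz₁))) (sym y≡bp₁)))
        by (no fz) = trans (cong (λ ⋆ → μ u z₁ + ⋆) (trans (G-≡ z₁ (ND-end ab a-sp₁))
          (cong -_ (trans (cong (λ ⋆ → μ u z₁ * ⋆)
            (trans (Above.eval-s fz b-z₁ s-z₁ (ND-end ab a-sp₁) (subst (D s) (sym bz₁) s-sp₁))
            (trans (cong (λ v → μ v y) (trans (cong (act s) bz₁) (act-invol s p₁)))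
              (μ-desc-≡ b b-p₁ (sym y≡bp₁)))))
            (ℤₚ.*-identityʳ (μ u z₁)))))) (ℤₚ.+-inverseʳ (μ u z₁))
          where
          a-sp₁ : ND a (act s p₁)
          a-sp₁ = FC-s ab (end₁ ab) (subst FC bz₁ (FC-down ab fz b-z₁)) s-sp₁
          s-z₁ : ND s z₁
          s-z₁ = FC-h ab (end₂ ab) fz b-z₁

      sum : ∀ {c} → (c ≡ G z₁ × ND s p₁) ⊎ (c ≡ 0ℤ × D s p₁) → ∑ (ball N) G ≡ c + G z₂
      sum (inj₁ (refl , _)) = two a (act b x) u 1 z₁ z₂ (ℕₚ.<⇒≤ bx<w) z₁≢z₂
        (λ z n₁ n₂ → G-other z n₂ (λ e → ⊥-elim (n₁ e)))
      sum (inj₂ (refl , d)) = trans (two a (act b x) u 1 z₁ z₂ (ℕₚ.<⇒≤ bx<w) z₁≢z₂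
        (λ z n₁ n₂ → G-other z n₂ (λ e → ⊥-elim (n₁ e))))
                                    (cong (λ ⋆ → ⋆ + G z₂) (G-other z₁ z₁≢z₂ (λ _ → d)))

      Bp₁∧Bx₂ : D s p₁ → Braid p₁ × Braid x₂
      Bp₁∧Bx₂ d = base (end₁ ab) d a-p₁ , by flag
        where
        by : D s q₁ ⊎ (ND s p₁ × Braid x₂) → Braid x₂
        by (inj₂ (n , _)) = clash d n
        by (inj₁ q) = step s sx₂ (step a a₁ (base (end₂ ab) s₁ (D-end ba b₁)))
          where
          a₁ : D a (act s x₂)
          a₁ = trans (cong (λ v → desc a (act s v)) (sym (act-invol a x₂))) (Dih.d-hsh (end₁ ab) d a-p₁)
          s₁ : D s (act a (act s x₂))
          s₁ = trans (cong (λ v → desc s (act a (act s v))) (sym (act-invol a x₂)))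
            (Dih.d-shsh (end₁ ab) d a-p₁)
          b₁ : D b (act s x₂)
          b₁ = trans (cong (λ v → desc b (act s v)) (sym (act-invol b x₂))) (Dih.d-hsh (end₂ ab) q b-q₁)

      -- s separates p₁ from u, so μ(u, p₁) = 0. The other two terms agree by `cover` if the lengths
      -- are adjacent, and otherwise vanish by induction, as p₁ and x₂ both contain braids here.
      T-0 : D s p₁ → T ≡ 0ℤ
      T-0 d = trans (cong₂ (λ m k → (m + k) - μ su x₂) (μ-u-p₁ d) equal) (lemma (μ su x₂))
        where
        lemma : ∀ m → (0ℤ + m) - m ≡ 0ℤ
        lemma = solve-∀
        equal : μ asu p₁ ≡ μ su x₂
        equal with len x₂ ℕ.≟ suc (len su)
        ... | yes l = cover a ax₂ a-su l
        ... | no n = trans (ih p₁ (below-w {p₁} len-p₁ (s≤s (s≤s z≤n))) (proj₁ (Bp₁∧Bx₂ d)) asu FC-asu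
                       (λ e → n (ℕₚ.suc-injective (trans (sym len-p₁)
                         (trans e (cong suc (len-up a su a-su)))))))
                     (sym (ih x₂ (below-w {x₂} {0} refl (s≤s z≤n)) (proj₂ (Bp₁∧Bx₂ d)) su FC-su n))

      -- Multiplication by a carries one pair to the other: `cover` for adjacent lengths, the
      -- induction hypothesis on both sides otherwise.
      last : μ bsu q₁ ≡ μ absu y
      last with len q₁ ℕ.≟ suc (len bsu)
      ... | yes l = sym (cover a a-q₁ (ND-end ab a-su) l)
      ... | no n = trans (ih q₁ q₁<w Bq₁ bsu FC-bsu n) (sym (ih y y<w By absu FC-absu
              (λ e → n (ℕₚ.suc-injective (trans (sym (len-up a q₁ a-q₁))
                (trans e (cong suc (len-up a bsu (ND-end ab a-su)))))))))

      vanishes : μ u w ≡ 0ℤ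
      vanishes = ℤₚ.neg-injective (trans (sym (F-one u w (≤N {w} ℕₚ.≤-refl)))
        (trans (descent a (act b x) ℕₚ.≤-refl a-bx u au 1)
          (trans (cong₂ (λ m k → m + (k + ∑ (ball N) G)) F-u second) (by (D? s p₁)))))
        where
        second : F (act a u) (act b x) 1 ≡ 0ℤ
        second = trans (F-bx (act a u)) (cong -_ (ih (act b x) bx<w Bbx (act a u) (FC-down ab f au)
          (λ e → ne (trans (len-up a (act b x) a-bx) (trans (cong suc e)
            (cong suc (len-down a u au)))))))
        combine : ∀ c → T + c ≡ 0ℤ → ∑ (ball N) G ≡ c + G z₂ →
                  ((μ u p₁ + (μ asu p₁ + μ bsu q₁)) - μ su x₂) + (0ℤ + ∑ (ball N) G) ≡ 0ℤ
        combine c e e′ = trans (cong (λ k → ((μ u p₁ + (μ asu p₁ + μ bsu q₁)) - μ su x₂) + (0ℤ + k))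
          (trans e′ (cong (λ ⋆ → c + ⋆) G-z₂)))
            (trans (lemma (μ u p₁) (μ asu p₁) (μ bsu q₁) (μ su x₂) c (μ absu y))
              (trans (cong₂ (λ m k → m + (k - μ absu y)) e last)
              (trans (ℤₚ.+-identityˡ _) (ℤₚ.+-inverseʳ (μ absu y)))))
          where
          lemma : ∀ i j k l c m → ((i + (j + k)) - l) + (0ℤ + (c + - m)) ≡ (((i + j) - l) + c) + (k - m)
          lemma = solve-∀
        by : D s p₁ ⊎ ND s p₁ → ((μ u p₁ + (μ asu p₁ + μ bsu q₁)) - μ su x₂) + (0ℤ + ∑ (ball N) G) ≡ 0ℤ
        by (inj₁ d) = combine 0ℤ (trans (ℤₚ.+-identityʳ T) (T-0 d)) (sum (inj₂ (refl , d)))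
        by (inj₂ n) = combine (G z₁) (T+G-z₁ n) (sum (inj₁ (refl , n)))

-- The case distinction by L(w), and covers

module Edges (P : Word → Word → Poly) (K : IsKL P) where
  open Ideal P K

  -- The shape of w is forced: s is the only descent of x = baw, then a and b are both descents of y
  -- = sx by `no-single`, and s is the only one of x₂ = bay. What remains is to trace the braid of w
  -- down to q₁.
  critical : ∀ {a b} (ab : Ends a b) (w : Alcove) → Braid w →
    (∀ v → len v < len w → Braid v → Isolated v) →
             D a w → D b w → ND s (act a w) → ND s (act b w) →
             let x₂ = act b (act a (act s (act b (act a w)))) in
             D s (act b x₂) ⊎ (ND s (act a x₂) × ND s (act b x₂)) → Isolated w
  critical {a} {b} ab w Bw ih aw bw s-aw s-bw flag u f ne with len w ℕ.≤? len u | D? a u | D? b u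
  ... | yes l | _ | _ = μ-long {u} {w} l
  ... | no _ | inj₂ n | _ = μ-missing a aw n ne
  ... | no _ | inj₁ _ | inj₂ n = μ-missing b bw n ne
  ... | no ¬l | inj₁ au | inj₁ bu = subst (λ v → μ u v ≡ 0ℤ) w≡
    (C.Hyp.Main.vanishes ax₂ bx₂ sx₂ (subst (ND s) (sym y≡) sy) (subst (ND a) (sym x≡) ax)
                  (subst (ND b) (sym x≡) bx) Bq₁ (subst Braid (sym y≡) By) (subst Braid (sym x≡) Bx)
                    (flag′ flag)
                  (subst (λ v → ∀ v′ → len v′ < len v → Braid v′ → Isolated v′) (sym w≡) ih) f
                  au bu (subst (λ v → len u < len v) (sym w≡) (ℕₚ.≰⇒> ¬l))
                    (λ e → ne (trans (cong len (sym w≡)) e)))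
    where
    ba = flip-ends ab
    x = act b (act a w)
    y = act s x
    x₂ = act b (act a y)
    module C = Critical P K ab x₂
    y≡ : C.y ≡ y
    y≡ = trans (cong (act a) (act-invol b (act a y))) (act-invol a y)
    x≡ : C.x ≡ x
    x≡ = trans (cong (act s) y≡) (act-invol s x)
    w≡ : C.w ≡ w
    w≡ = trans (cong (λ v → act a (act b v)) x≡) (trans (cong (act a) (act-invol b (act a w)))
      (act-invol a w))
    sw : ND s w
    sw with D? s w
    ... | inj₂ n = n
    ... | inj₁ p = ⊥-elim (not-all ab p aw bw)
    Bx : Braid x
    Bx = by Bw
      where
      by : Braid w → Braid x
      by (base _ p _) = clash p sw
      by (step g p B) with which ab g
      ... | inj₁ refl = clash p sw
      ... | inj₂ (inj₁ refl) = braid-only ba B b (only-a ba s-aw (toggle-D aw))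
      ... | inj₂ (inj₂ refl) = subst Braid (commute ab w)
        (braid-only ab B a (only-a ab s-bw (toggle-D bw)))
    ax : ND a x
    ax = ND-end ab (toggle-D aw)
    bx : ND b x
    bx = toggle-D (D-end ba bw)
    sx : D s x
    sx with some-descent ab (braid-≢ ab Bx)
    ... | inj₁ p = p
    ... | inj₂ (inj₁ p) = clash p ax
    ... | inj₂ (inj₂ p) = clash p bx
    By : Braid y
    By = braid-only ab Bx s (only-s ab ax bx)
    sy : ND s y
    sy = toggle-D sx
    bx≡ : act b x ≡ act a w
    bx≡ = act-invol b (act a w)
    ax≡ : act a x ≡ act b w
    ax≡ = trans (cong (act a) (sym (commute ab w))) (act-invol a (act b w))
    -- If y has a single descent, then a x or b x starts with a braid.
    no-single : ∀ {c d} → Ends c d → D c y → ND d y → ND c x → ND s (act c x) → ⊥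
    no-single {c} {d} cd cy dy cx s-cx with some-descent cd {act c y}
      (braid-≢ cd (braid-only cd By c (only-a cd sy dy)))
    ... | inj₁ p = true≢false (braid-descent (end-s (end₁ cd)) (toggle-ND cx)
      (subst (D s) (sym (act-invol c x)) sx)
                     (subst (D c) (cong (act s) (sym (act-invol c x))) cy)
                     (subst (λ v → D s (act c (act s v))) (sym (act-invol c x)) p)) s-cx
    ... | inj₂ (inj₁ p) = clash p (toggle-D cy)
    ... | inj₂ (inj₂ p) = clash p (ND-end (flip-ends cd) dy)
    ay : D a y
    ay with D? a y
    ... | inj₁ p = p
    ... | inj₂ n with some-descent ab (braid-≢ ab By)
    ...   | inj₁ p = clash p sy
    ...   | inj₂ (inj₁ p) = p
    ...   | inj₂ (inj₂ p) = ⊥-elim (no-single ba p n bx (subst (ND s) (sym bx≡) s-aw))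
    by′ : D b y
    by′ with D? b y
    ... | inj₁ p = p
    ... | inj₂ n = ⊥-elim (no-single ab ay n ax (subst (ND s) (sym ax≡) s-bw))
    ax₂ : ND a x₂
    ax₂ = ND-end ab (toggle-D ay)
    bx₂ : ND b x₂
    bx₂ = toggle-D (D-end ba by′)
    len-y : 2 ℕ.+ len x₂ ≡ len y
    len-y = trans (cong suc (len-down b (act a y) (D-end ba by′))) (len-down a y ay)
    sx₂ : D s x₂
    sx₂ with D? s x₂
    ... | inj₁ p = p
    -- Without s, x₂ has no descent at all, so y has length 2, too short for a braid.
    ... | inj₂ n = ⊥-elim (ℕₚ.<⇒≱ (s≤s (s≤s (s≤s z≤n)))
      (subst (4 ≤_) (trans (sym len-y) (cong (2 ℕ.+_) (trans (cong len x₂≡) len-id₀))) (braid-len By)))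
      where
      x₂≡ : x₂ ≡ id₀
      x₂≡ with x₂ ≟ id₀
      ... | yes e = e
      ... | no m with some-descent ab m
      ...   | inj₁ p = clash p n
      ...   | inj₂ (inj₁ p) = clash p ax₂
      ...   | inj₂ (inj₂ p) = clash p bx₂
    Bends : Braid (act a y) ⊎ Braid (act b y)
    Bends = by By
      where
      by : Braid y → Braid (act a y) ⊎ Braid (act b y)
      by (base _ p _) = clash p sy
      by (step g p B) with which ab g
      ... | inj₁ refl = clash p sy
      ... | inj₂ (inj₁ refl) = inj₁ B
      ... | inj₂ (inj₂ refl) = inj₂ B
    p₁≡ : act a x₂ ≡ act b y
    p₁≡ = trans (cong (act a) (sym (commute ab y))) (act-invol a (act b y))
    q₁≡ : act b x₂ ≡ act a y
    q₁≡ = act-invol b (act a y)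
    Bx₂ : ND s (act a x₂) → ND s (act b x₂) → Braid x₂
    Bx₂ p q with Bends
    ... | inj₁ B = braid-only ba B b (only-a ba (subst (ND s) q₁≡ q) (toggle-D ay))
    ... | inj₂ B = subst Braid (commute ab y) (braid-only ab B a
      (only-a ab (subst (ND s) p₁≡ p) (toggle-D by′)))
    flag′ : D s (act b x₂) ⊎ (ND s (act a x₂) × ND s (act b x₂)) → D s C.q₁ ⊎ (ND s C.p₁ × Braid x₂)
    flag′ (inj₁ p) = inj₁ p
    flag′ (inj₂ (p , q)) = inj₂ (p , Bx₂ p q)
    Bq₁ : Braid (act b x₂)
    Bq₁ with D? s (act b x₂) | D? s (act a x₂)
    ... | inj₁ p | _ = base (end₂ ab) p (toggle-ND bx₂)
    ... | inj₂ q | inj₂ p = step b (toggle-ND bx₂) (subst Braid (sym (act-invol b x₂)) (Bx₂ p q))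
    ... | inj₂ q | inj₁ p = ⊥-elim (no-q flag)
      where
      no-q : D s (act b x₂) ⊎ (ND s (act a x₂) × ND s (act b x₂)) → ⊥
      no-q (inj₁ q′) = true≢false q′ q
      no-q (inj₂ (p′ , _)) = true≢false p p′

  isolated : ∀ n w → len w < n → Braid w → Isolated w
  isolated (suc n) w (s≤s w≤n) Bw = by (D? s w) (D? r w) (D? t w)
    where
    ih : ∀ v → len v < len w → Braid v → Isolated v
    ih v l = isolated n v (ℕₚ.<-≤-trans l w≤n)
    open Step w Bw ih
    -- A fully commutative u lacks s or h as a descent, so μ(u, w) can be nonzero only if w covers
    -- u.
    braid-case : ∀ {h} → End h → D s w → D h w → Isolated w
    braid-case {h} e p q u f ne with D? s u
    ... | inj₁ su = μ-missing h q (FC-s ends-rt e f su) ne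
    ... | inj₂ su = μ-missing s p su ne
    two-ends : D r w → D t w → Isolated w
    two-ends rw tw with D? s (act t w) | D? s (act r w)
    ... | inj₁ p | _ = case-ab ends-rt rw tw p
    ... | inj₂ _ | inj₁ p = case-ab ends-tr tw rw p
    ... | inj₂ p | inj₂ q with D? s (act t x₂) | D? s (act r x₂)
      where
      x₂ = act t (act r (act s (act t (act r w))))
    ...   | inj₁ d | _ = critical ends-rt w Bw ih rw tw q p (inj₁ d)
    ...   | inj₂ m | inj₂ k = critical ends-rt w Bw ih rw tw q p (inj₂ (k , m))
    ...   | inj₂ _ | inj₁ d = critical ends-tr w Bw ih tw rw p q
      (inj₁ (subst (λ v → D s (act r v)) swap d))
      where
      swap : act t (act r (act s (act t (act r w)))) ≡ act r (act t (act s (act r (act t w))))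
      swap = trans (cong (λ v → act t (act r (act s v))) (sym (act-rt w))) (sym (act-rt _))
    by : D s w ⊎ ND s w → D r w ⊎ ND r w → D t w ⊎ ND t w → Isolated w
    by (inj₁ p) (inj₁ q) _ = braid-case end-r p q
    by (inj₁ p) _ (inj₁ q) = braid-case end-t p q
    by (inj₁ p) (inj₂ m) (inj₂ k) with some-descent ends-rt
      (braid-≢ ends-rt (braid-only ends-rt Bw s (only-s ends-rt m k)))
    ... | inj₁ d = clash d (toggle-D p)
    ... | inj₂ (inj₁ d) = case-s ends-rt p m k d
    ... | inj₂ (inj₂ d) = case-s ends-tr p k m d
    by (inj₂ n) (inj₁ p) (inj₁ q) = two-ends p q
    by (inj₂ n) (inj₁ p) (inj₂ m) = case-a ends-rt p n m
    by (inj₂ n) (inj₂ m) (inj₁ p) = case-a ends-tr p n m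
    by (inj₂ n) (inj₂ m) (inj₂ k) with some-descent ends-rt (braid-≢ ends-rt Bw)
    ... | inj₁ d = clash d n
    ... | inj₂ (inj₁ d) = clash d m
    ... | inj₂ (inj₂ d) = clash d k

  -- Common left descents are stripped by `cover`. A descent g of w that u lacks gives gu = w by
  -- `reflect-fold`, and there μ = 1.
  reflection-edge : ∀ n w → len w < n → ∀ y h u → w ≡ reflect y h u → len w ≡ suc (len u) → μ u w ≡ 1ℤ
  reflection-edge (suc n) w (s≤s w≤n) y h u e l with descent? w
  ... | inj₁ refl = ⊥-elim (ℕₚ.1+n≢0 (trans (sym l) len-id₀))
  ... | inj₂ (g , gw) with D? g u
  ...   | inj₂ gu = μ-desc-≡ g gu (trans (reflect-fold y h g u
    (subst (λ v → len u < len v) e (ℕₚ.≤-reflexive (sym l))) gu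
            (subst (λ v → len (act g v) < len (act g u)) e (ℕₚ.<-≤-trans (len-< g gw)
              (ℕₚ.≤-reflexive (trans l (sym (len-up g u gu))))))) (sym e))
  ...   | inj₁ gu = trans (cover-down g gw gu l) (reflection-edge n (act g w)
    (ℕₚ.<-≤-trans (len-< g gw) w≤n) (g ∷ y) h (act g u)
            (trans (cong (act g) e) (sym (trans (reflect-conj g y h (act g u))
              (cong (λ v → act g (reflect y h v)) (act-invol g u)))))
            (down-suc g gw gu l))

-- The a-function and full commutativity

record Expression (x : Alcove) : Set where
  constructor expr
  field
    word   : Word
    pt-eq  : pt word ≡ x
    len-eq : length word ≡ len x
open Expression

extend : ∀ g {x} → D g x → Expression (act g x) → Expression x
extend g {x} d (expr v e l) = expr (g ∷ v) (trans (cong (act g) e) (act-invol g x))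
  (trans (cong suc l) (len-down g x d))

nf-expr : ∀ x → Expression x
nf-expr x = expr (nf x) (pt-nf x) (length-nf x)

-- At the braid one expression continues with s and the other with h. A unique reduced expression
-- therefore excludes braids.
braid-expressions : ∀ {x} → Braid x → Σ (Expression x) λ v → Σ (Expression x) λ v′ → word v ≢ word v′
braid-expressions (base {h} {x} e p q) = extend s p (nf-expr (act s x)) , extend h q
  (nf-expr (act h x)) , differ e
  where
  differ : ∀ {h} → End h → s ∷ nf (act s x) ≢ h ∷ nf (act h x)
  differ end-r ()
  differ end-t ()
braid-expressions (step g p B) with braid-expressions B
... | v , v′ , ne = extend g p v , extend g p v′ , λ e → ne (Listₚ.∷-injectiveʳ e)

expression-reduced : ∀ {x} (v : Expression x) → Reduced (word v)
expression-reduced (expr v refl l) = len⇒reduced l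

unique⇒FC : ∀ {w} → UniqueReduced w → FC (pt w)
unique⇒FC {w} (w₀ , _ , _ , uniq) B with braid-expressions B
... | v , v′ , ne = ne (trans (same-word v) (sym (same-word v′)))
  where
  same-word : (v : Expression (pt w)) → word v ≡ w₀
  same-word v = uniq (word v) (pt-injective (pt-eq v)) (expression-reduced v)

core : ℕ → Word → Word
core m v = (r ∷ t ∷ rep m (s ∷ r ∷ t ∷ [])) ++ v

record TwoEnds (x : Alcove) : Set where
  constructor two-ends
  field
    fc  : FC x
    d-r : D r x
    d-t : D t x

short-FC : ∀ v → length v ≤ 3 → FC (pt v)
short-FC v l B = ℕₚ.<⇒≱ (s≤s l) (ℕₚ.≤-trans (braid-len B) (len≤length v))

no-end : ∀ {v h} → RightFactor v → End h → ND h (pt v)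
no-end {h = h} rf-e _ = desc-id₀ h
no-end {h = h} rf-s e with D? h (act s id₀)
... | inj₂ n = n
no-end rf-s end-r | inj₁ d with desc-act-id₀ r s d
... | ()
no-end rf-s end-t | inj₁ d with desc-act-id₀ t s d
... | ()
no-end rf-st e = FC-s ends-rt e (short-FC (s ∷ t ∷ []) (s≤s (s≤s z≤n))) (toggle-ND s-t)
  where
  s-t : ND s (act t id₀)
  s-t with D? s (act t id₀)
  ... | inj₂ n = n
  ... | inj₁ d with desc-act-id₀ s t d
  ...   | ()
no-end rf-sr e = FC-s ends-rt e (short-FC (s ∷ r ∷ []) (s≤s (s≤s z≤n))) (toggle-ND s-r)
  where
  s-r : ND s (act r id₀)
  s-r with D? s (act r id₀)
  ... | inj₂ n = n
  ... | inj₁ d with desc-act-id₀ s r d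
  ...   | ()

right-short : ∀ {v} → RightFactor v → length v ≤ 2
right-short rf-e  = z≤n
right-short rf-s  = s≤s z≤n
right-short rf-st = s≤s (s≤s z≤n)
right-short rf-sr = s≤s (s≤s z≤n)

core-two : ∀ m {v} → RightFactor v → TwoEnds (pt (core m v))
core-two zero {v} rf = two-ends
  (FC-ab ends-rt (short-FC (r ∷ v) (s≤s (right-short rf))) (short-FC (t ∷ v) (s≤s (right-short rf)))
    (no-end rf end-r) (no-end rf end-t))
  (toggle-ND (ND-end ends-rt (no-end rf end-r))) (D-end ends-tr (toggle-ND (no-end rf end-t)))
core-two (suc m) rf with core-two m rf
... | two-ends f p q = two-ends FC-absu D-a-absu D-b-absu
  where open Both₂ ends-rt f p q

left-FC : ∀ {u} → LeftFactor u → ∀ {v} → TwoEnds (pt v) → FC (pt (u ++ v))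
left-FC lf-e  (two-ends f p q) = f
left-FC lf-s  (two-ends f p q) = Both.FC-su ends-rt f p q
left-FC lf-ts (two-ends f p q) = Both₂.FC-bsu ends-rt f p q
left-FC lf-rs (two-ends f p q) = Both.FC-asu ends-rt f p q

A2⇒FC : ∀ {w} → InA2 w → FC (pt w)
A2⇒FC (u , v , m , lf , rf , e) = subst FC (sym (pt-≈ e)) (left-FC lf (core-two m rf))

-- The alternatives are the values a = 0, 1, 2, so exhibiting a shape for each fully commutative
-- element leaves only elements with a braid for a = 4.
data Shape (x : Alcove) : Set where
  trivial : x ≡ id₀ → Shape x
  unique  : (w₀ : Word) → pt w₀ ≡ x → length w₀ ≡ len x →
            (∀ v → pt v ≡ x → length v ≡ len x → v ≡ w₀) → Shape x
  family  : ∀ {u v} m → LeftFactor u → RightFactor v → x ≡ pt (u ++ core m v) → Shape x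

module _ {a b : Gen} (ab : Ends a b) where
  private ba = flip-ends ab

  -- If q were longer than a single letter, it would begin with as. Then asq begins with asas, which
  -- is a braid.
  single-tail : ∀ {q} → FC (act a (act s q)) → ND s q → D a q → ND b q →
                ND a (act s q) → q ≡ act a id₀
  single-tail {q} f sq aq bq a-sq with act a q ≟ id₀
  ... | yes e = transpose a e
  ... | no n with some-descent ab n
  ...   | inj₂ (inj₁ d) = clash d (toggle-D aq)
  ...   | inj₂ (inj₂ d) = clash d (ND-end ba bq)
  ...   | inj₁ d = ⊥-elim (f (base (end₁ ab) (braid-descent
    (end-s (end₁ ab)) a-asq s-asq a-sasq s-asasq) a-asq))
    where
    z = act a (act s q)
    a-asq : D a z
    a-asq = toggle-ND a-sq
    s-asq : D s (act a z)
    s-asq = subst (D s) (sym (act-invol a (act s q))) (toggle-ND sq)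
    sz : act s (act a z) ≡ q
    sz = trans (cong (act s) (act-invol a (act s q))) (act-invol s q)
    a-sasq : D a (act s (act a z))
    a-sasq = subst (D a) (sym sz) aq
    s-asasq : D s (act a (act s (act a z)))
    s-asasq = subst (λ v → D s (act a v)) (sym sz) d

-- Strip rt and then s. The descents of the remainder q decide: both ends mean one more block rts
-- and recursion, one end ends the word by `single-tail`, none means q is trivial.
two-ends-shape : ∀ n x → len x < n → FC x → D r x → D t x →
                 Σ ℕ λ m → Σ Word λ v → RightFactor v × x ≡ pt (core m v)
two-ends-shape (suc n) x (s≤s x≤n) f rx tx = by (D? s p)
  where
  p = act t (act r x)
  x≡ : x ≡ act r (act t p)
  x≡ = sym (trans (cong (act r) (act-invol t (act r x))) (act-invol r x))
  rp : ND r p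
  rp = ND-end ends-rt (toggle-D rx)
  tp : ND t p
  tp = toggle-D (D-end ends-tr tx)
  fr : FC (act r p)
  fr = subst FC (trans (cong (act t) (trans x≡ (act-rt p))) (act-invol t (act r p)))
    (FC-down ends-rt f tx)
  ft : FC (act t p)
  ft = subst FC (trans (cong (act r) x≡) (act-invol r (act t p))) (FC-down ends-rt f rx)
  by : D s p ⊎ ND s p → Σ ℕ λ m → Σ Word λ v → RightFactor v × x ≡ pt (core m v)
  by (inj₂ sp) = 0 , [] , rf-e , trans x≡ (cong (λ v → act r (act t v)) p≡)
    where
    p≡ : p ≡ id₀
    p≡ = no-descents p rp sp tp
  by (inj₁ sp) = next (D? r q) (D? t q)
    where
    q = act s p
    p≡ : p ≡ act s q
    p≡ = sym (act-invol s p)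
    sq : ND s q
    sq = toggle-D sp
    x≡q : x ≡ act r (act t (act s q))
    x≡q = trans x≡ (cong (λ v → act r (act t v)) p≡)
    q<n : len q < n
    q<n = ℕₚ.<-≤-trans (ℕₚ.<-trans (len-< s sp) (ℕₚ.<-trans (len-< t (D-end ends-tr tx))
      (len-< r rx))) x≤n
    next : D r q ⊎ ND r q → D t q ⊎ ND t q → Σ ℕ λ m → Σ Word λ v → RightFactor v × x ≡ pt (core m v)
    next (inj₁ rq) (inj₁ tq) with two-ends-shape n q q<n
      (FC-down ends-rt (subst FC (act-invol t p) (FC-down ends-rt ft (toggle-ND tp))) sp) rq tq
    ... | m , v , rf , e = suc m , v , rf , trans x≡q (cong (λ z → act r (act t (act s z))) e)
    next (inj₁ rq) (inj₂ tq) = 0 , s ∷ r ∷ [] , rf-sr , trans x≡q (cong (λ z → act r (act t (act s z)))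
      (single-tail ends-rt (subst (λ v → FC (act r v)) p≡ fr) sq rq tq (subst (ND r) p≡ rp)))
    next (inj₂ rq) (inj₁ tq) = 0 , s ∷ t ∷ [] , rf-st , trans x≡q (cong (λ z → act r (act t (act s z)))
      (single-tail ends-tr (subst (λ v → FC (act t v)) p≡ ft) sq tq rq (subst (ND t) p≡ tp)))
    next (inj₂ rq) (inj₂ tq) = 0 , s ∷ [] , rf-s , trans x≡q
      (cong (λ z → act r (act t (act s z))) (no-descents q rq sq tq))

forced-head : ∀ {g x} → D g x → (∀ k → D k x → k ≡ g) → ∀ v → pt v ≡ x → length v ≡ len x →
              Σ Word λ v′ → v ≡ g ∷ v′ × pt v′ ≡ act g x × length v′ ≡ len (act g x)
forced-head {g} {x} gx only [] e l = clash (subst (D g) (sym e) gx) (desc-id₀ g)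
forced-head {g} {x} gx only (k ∷ v) e l with D? k x
... | inj₁ kx with only k kx
...   | refl = v , refl , sym (trans (cong (act k) (sym e)) (act-invol k (pt v))) ,
               ℕₚ.suc-injective (trans l (sym (len-down k x kx)))
forced-head {g} {x} gx only (k ∷ v) e l | inj₂ kx = ⊥-elim (ℕₚ.<-irrefl refl (begin-strict
  len x           <⟨ ℕₚ.≤-reflexive (sym (len-up k x kx)) ⟩
  len (act k x)   ≡⟨ cong len (trans (cong (act k) (sym e)) (act-invol k (pt v))) ⟩
  len (pt v)      ≤⟨ len≤length v ⟩
  length v        <⟨ ℕₚ.n<1+n _ ⟩
  suc (length v)  ≡⟨ l ⟩
  len x           ∎))
  where open ℕₚ.≤-Reasoning

module _ {a b : Gen} (ab : Ends a b) where

  -- x = sasc with a ∈ L(c) begins with sasa, hence with a braid.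
  no-third : ∀ {c x} → FC x → D s x → act s x ≡ act a (act s c) → D a (act a (act s c)) → D s (act s c)
    → D a c → ⊥
  no-third {c} {x} f sx e p q o = f (base (end₁ ab) sx
    (braid-descent (s-end (end₁ ab)) sx (subst (D a) (sym e) p)
    (subst (D s) (sym e₂) q) (subst (D a) (sym (trans (cong (act s) e₂) (act-invol s c))) o)))
    where
    e₂ : act a (act s x) ≡ act s c
    e₂ = trans (cong (act a) e) (act-invol a (act s c))

-- With a single descent the first letter is forced, so a unique expression stays unique. In the
-- family, prepending a letter runs through the left factors e, s, ts, rs; any other letter cancels,
-- creates both descents r and t, or completes a braid.
single-shape : ∀ {g x} → FC x → D g x → (∀ k → D k x → k ≡ g) → Shape (act g x) → Shape x
single-shape {g} {x} f gx only (trivial e) = unique (g ∷ [])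
  (trans (cong (act g) (sym e)) (act-invol g x))
    (trans (cong suc (sym (trans (cong len e) len-id₀))) (len-down g x gx)) uniq
  where
  uniq : ∀ v → pt v ≡ x → length v ≡ len x → v ≡ g ∷ []
  uniq v e′ l with forced-head gx only v e′ l
  ... | [] , eq , _ , _ = eq
  ... | _ ∷ _ , _ , _ , l′ = ⊥-elim (ℕₚ.1+n≢0 (trans l′ (trans (cong len e) len-id₀)))
single-shape {g} {x} f gx only (unique w₀ e l u) = unique (g ∷ w₀)
  (trans (cong (act g) e) (act-invol g x))
    (trans (cong suc l) (len-down g x gx)) uniq
  where
  uniq : ∀ v → pt v ≡ x → length v ≡ len x → v ≡ g ∷ w₀
  uniq v e′ l′ with forced-head gx only v e′ l′
  ... | v′ , eq , e″ , l″ = trans eq (cong (g ∷_) (u v′ e″ l″))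
single-shape {g} {x} f gx only (family {v = v} m lf rf e) = by g lf gx only e (sym (act-invol g x))
  where
  c : Alcove
  c = pt (core m v)
  open TwoEnds (core-two m rf)
  module C = Both ends-rt fc d-r d-t
  by : ∀ g {u} → LeftFactor u → D g x → (∀ k → D k x → k ≡ g) → act g x ≡ pt (u ++ core m v) → x
    ≡ act g (act g x) → Shape x
  by r lf-e gx _ e _ = clash d-r (subst (ND r) e (toggle-D gx))
  by s lf-e _ _ e e′ = family m lf-s rf (trans e′ (cong (act s) e))
  by t lf-e gx _ e _ = clash d-t (subst (ND t) e (toggle-D gx))
  by r lf-s _ _ e e′ = family m lf-rs rf (trans e′ (cong (act r) e))
  by s lf-s gx _ e _ = clash C.D-su (subst (ND s) e (toggle-D gx))
  by t lf-s _ _ e e′ = family m lf-ts rf (trans e′ (cong (act t) e))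
  by r lf-ts _ only e e′ with only t (subst (D t) (sym (trans e′ (cong (act r) e)))
    (D-end ends-tr (toggle-ND C.b-su)))
  ... | ()
  by s lf-ts gx _ e _ = ⊥-elim (no-third ends-tr f gx e (toggle-ND C.b-su) C.D-su d-t)
  by t lf-ts gx _ e _ = clash (toggle-ND C.b-su) (subst (ND t) e (toggle-D gx))
  by r lf-rs gx _ e _ = clash (toggle-ND C.a-su) (subst (ND r) e (toggle-D gx))
  by s lf-rs gx _ e _ = ⊥-elim (no-third ends-rt f gx e (toggle-ND C.a-su) C.D-su d-r)
  by t lf-rs _ only e e′ with only r (subst (D r) (sym (trans e′ (cong (act t) e)))
    (D-end ends-rt (toggle-ND C.a-su)))
  ... | ()

shape : ∀ n x → len x < n → FC x → Shape x
shape (suc n) x (s≤s x≤n) f with descent? x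
... | inj₁ e = trivial e
... | inj₂ (g , gx) with D? r x | D? t x
...   | inj₁ rx | inj₁ tx with two-ends-shape (suc n) x (s≤s x≤n) f rx tx
...     | m , v , rf , e = family m lf-e rf e
shape (suc n) x (s≤s x≤n) f | inj₂ (g , gx) | rx | inj₂ tx =
  single-shape f gx (only rx) (shape n (act g x) (ℕₚ.<-≤-trans (len-< g gx) x≤n) (FC-down ends-rt f gx))
  where
  agree : ∀ {k g} → (∀ {h} → End h → D h x → h ≡ r) → D k x → D g x → k ≡ g
  agree {r} {r} h p q = refl
  agree {s} {s} h p q = refl
  agree {t} {t} h p q = refl
  agree {r} {s} h p q = ⊥-elim (f (base end-r q p))
  agree {s} {r} h p q = ⊥-elim (f (base end-r p q))
  agree {s} {t} h p q = ⊥-elim (f (base end-t p q))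
  agree {t} {s} h p q = ⊥-elim (f (base end-t q p))
  agree {r} {t} h p q with h end-t q
  ... | ()
  agree {t} {r} h p q with h end-t p
  ... | ()
  only : D r x ⊎ ND r x → ∀ k → D k x → k ≡ g
  only _ k p = agree (λ { end-r _ → refl ; end-t d → clash d tx }) p gx
shape (suc n) x (s≤s x≤n) f | inj₂ (g , gx) | inj₂ rx | inj₁ tx =
  single-shape f gx (λ k p → agree p gx) (shape n (act g x) (ℕₚ.<-≤-trans (len-< g gx) x≤n)
    (FC-down ends-rt f gx))
  where
  agree : ∀ {k g} → D k x → D g x → k ≡ g
  agree {r} p _ = clash p rx
  agree {_} {r} _ q = clash q rx
  agree {s} {s} p q = refl
  agree {t} {t} p q = refl
  agree {s} {t} p q = ⊥-elim (f (base end-t p q))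
  agree {t} {s} p q = ⊥-elim (f (base end-t q p))

a4⇒braid : ∀ {w} → HasA w 4 → Braid (pt w)
a4⇒braid {w} (a-4 ¬e ¬u ¬2) with braid? (pt w)
... | yes B = B
... | no f with shape (suc (len (pt w))) (pt w) (ℕₚ.n<1+n _) f
...   | trivial e = ⊥-elim (¬e (pt-injective e))
...   | unique w₀ e l u = ⊥-elim (¬u (w₀ , pt-injective e , len⇒reduced (trans l (cong len (sym e))) ,
          λ v v≈w red → u v (pt-≈ v≈w) (trans (reduced⇒len red) (cong len (pt-≈ v≈w)))))
...   | family {u} {v} m lf rf e = ⊥-elim (¬2 (u , v , m , lf , rf , pt-injective e))

a12⇒FC : ∀ {u} → HasA u 1 ⊎ HasA u 2 → FC (pt u)
a12⇒FC (inj₁ (a-1 _ uniq)) = unique⇒FC uniq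
a12⇒FC (inj₂ (a-2 in2))    = A2⇒FC in2

mu-cong : ∀ {P} → IsKL P → ∀ {u w u′ w′} → length u ≡ length u′ → length w ≡ length w′ → u ≈ u′
  → w ≈ w′ →
          mu P u w ≡ mu P u′ w′
mu-cong {P} K {u} {w} {u′} {w′} lu lw eu ew
  with odd (length w ∸ length u) in e | odd (length w′ ∸ length u′) in e′
... | true  | true  = trans (IsKL.invariant K eu ew _) (cong (λ d → P u′ w′ ⌊ d /2⌋) (cong₂ _∸_ lw lu))
... | true  | false = ⊥-elim (true≢false e (trans (cong odd (cong₂ _∸_ lw lu)) e′))
... | false | true  = ⊥-elim (true≢false e′ (trans (cong odd (sym (cong₂ _∸_ lw lu))) e))
... | false | false = refl

theorem7p1 : (P : Word → Word → Poly) → IsKL P →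
    (u w : Word) → Reduced u → Reduced w → u <B w →
    (HasA u 1 ⊎ HasA u 2) → HasA w 4 →
    (length w ≡ suc (length u) → mu P u w ≡ + 1) ×
    (length w ≢ suc (length u) → mu P u w ≡ + 0)
theorem7p1 P K u w ru rw (u≤w , u≉w) au aw =
    (λ l → trans mu-pt (adjacent u≤w (trans (sym lw) (trans l (cong suc lu)))))
  , (λ l → trans mu-pt (isolated (suc (len y)) y (ℕₚ.n<1+n _) (a4⇒braid aw) x (a12⇒FC au)
      (λ e → l (trans lw (trans e (cong suc (sym lu)))))))
  where
  open Edges P K
  open Ideal P K using (μ)
  x = pt u
  y = pt w
  lu : length u ≡ len x
  lu = reduced⇒len ru
  lw : length w ≡ len y
  lw = reduced⇒len rw
  -- `mu` depends on the lengths of the given words; both these and the normal forms are reduced, so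
  -- the lengths agree.
  mu-pt : mu P u w ≡ μ x y
  mu-pt = mu-cong K (trans lu (sym (length-nf x))) (trans lw (sym (length-nf y))) (nf-pt u) (nf-pt w)
  adjacent : u ≤B w → len y ≡ suc (len x) → μ x y ≡ + 1
  adjacent (≤B-refl e) _ = ⊥-elim (u≉w e)
  adjacent (≤B-step {v = v} z h u≤v eq lt) l with ≤B-len u≤v
  ... | inj₁ e = reflection-edge (suc (len y)) y (ℕₚ.n<1+n _) (v ++ z) h x
                   (trans (step-reflect {v} {w} z h eq) (cong (reflect (v ++ z) h) (sym e))) l
  -- A Bruhat chain from u to w with two strict steps would raise the length by at least 2.
  ... | inj₂ lt′ = ⊥-elim (ℕₚ.<⇒≱ lt′ (ℕₚ.≤-pred (subst (len (pt v) <_) l (lengthLt⇒ lt))))
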